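{- For every $X\subseteq V$, put $R_X:=V\setminus X$, $S_X:=S_c(G)-R_X$, and $S_{X,C}:=S_c(G)-S(C)-R_X$ for $C\in\mathcal C(G)$. Then $$\det L_c[X,X]=m(S_X,|X|)+\sum_{\substack{C\in\mathcal C(G) \\ V(C)\subseteq X}}(-2)^{p(C)}\,c(C)\,m\bigl(S_{X,C},|X|-|C|\bigr).$$
   Context: $G=(V,E)$ is a finite connected simple undirected graph; each edge $e$ has a conductance $c_e\in\mathbb R_{>0}$. The weighted Laplacian $L_c$ is the $V\times V$ matrix with $(L_c)_{uu}=\sum_{e\ni u}c_e$, $(L_c)_{uv}=-c_{uv}$ if $uv\in E$, and $0$ otherwise. $L_c[X,X]$ is the principal submatrix on $X$, and the empty determinant equals $1$. The weighted subdivision graph $S_c(G)$ has vertex set $V\sqcup\{e^*:e\in E\}$ and, for each $e\in E$ and each endpoint $v$ of $e$, an edge $ve^*$ of weight $c_e$. For a subgraph $C$ of $G$, $S(C)$ is its subdivision, with vertices $V(C)\cup\{e^*:e\in E(C)\}$. Subtracting a vertex set (or a subgraph) from a graph means deleting those vertices (or all vertices of that subgraph) together with all incident edges. For an edge-weighted graph $H$, $m(H,j)$ is the total weight of its $j$-edge matchings, where the weight of a matching is the product of its edge weights (so $m(H,0)=1$). $\mathcal C(G)$ is the set of nonempty vertex-disjoint unions of cycles of $G$; for $C\in\mathcal C(G)$, $p(C)$ is its number of cycle components, $c(C)=\prod_{e\in E(C)}c_e$, and $|C|$ is its number of vertices (equal to its number of edges). -}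

module Defs where

open import Algebra.Bundles using (CommutativeRing; Semiring)
open import Algebra.Structures using (IsCommutativeRing)
open import Data.Bool.Base using (true; if_then_else_)
open import Data.Empty using () renaming (⊥ to ⊥₀)
open import Data.Fin.Base as Fin using (Fin; zero; suc; toℕ; _↑ˡ_; _↑ʳ_; splitAt; punchIn)
open import Data.Fin.Properties as Fin using (any?; all?)
open import Data.List.Base as List using (List; []; _∷_; length; filter)
open import Data.List.Relation.Unary.AllPairs using (allPairs?)
open import Data.Nat.Base as ℕ using (ℕ; zero; suc; _⊔_; s≤s)
open import Data.Nat.DivMod using (_mod_)
import Data.Nat.Properties as ℕ
open import Data.Product using (_×_; _,_; ∃; proj₁; proj₂)
open import Data.Rational as ℚ using (ℚ; 0ℚ; 1ℚ; ½)
import Data.Rational.Properties as ℚ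
open import Data.Rational.Solver using (module +-*-Solver)
open import Data.Sum.Base using (_⊎_; inj₁; inj₂)
open import Data.Vec.Base as Vec using (Vec; []; _∷_; lookup)
open import Data.Vec.Functional as Vector using (Vector)
import Data.Vec.Properties as Vec
open import Data.Vec.Relation.Unary.Unique.Propositional using (Unique)
open import Data.Vec.Relation.Unary.Unique.Propositional.Properties using (lookup-injective)
open import Level using (0ℓ)
open import Relation.Binary using (IsEquivalence)
open import Relation.Binary.Construct.Closure.ReflexiveTransitive using (Star)
open import Relation.Binary.PropositionalEquality
open import Relation.Nullary using (¬_; Dec; yes; no; does; contradiction)
open import Relation.Nullary.Decidable using (map′; _×-dec_; _⊎-dec_; _→-dec_; ¬?; dec-true)
open import Relation.Unary using (Decidable)

module Estimates where

  open import Data.Rational.Base using (_+_; _*_; -_; _-_; _<_; _≤_; ∣_∣)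

  half>0 : ∀ {ε} → 0ℚ < ε → 0ℚ < ½ * ε
  half>0 {ε} 0<ε = subst (_< ½ * ε) (ℚ.*-zeroʳ ½) (ℚ.*-monoʳ-<-pos ½ 0<ε)

  half+half : ∀ ε → ½ * ε + ½ * ε ≡ ε
  half+half ε = trans (sym (ℚ.*-distribʳ-+ ε ½ ½)) (ℚ.*-identityˡ ε)

  close-refl : ∀ {ε} a → 0ℚ < ε → ∣ a - a ∣ < ε
  close-refl {ε} a 0<ε = subst (_< ε) (sym (cong ∣_∣ (ℚ.+-inverseʳ a))) 0<ε

  close-sym : ∀ {ε} a b → ∣ a - b ∣ < ε → ∣ b - a ∣ < ε
  close-sym {ε} a b = subst (_< ε) (trans (sym (ℚ.∣-p∣≡∣p∣ (a - b))) (cong ∣_∣ eq))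
    where
    open +-*-Solver
    eq : - (a - b) ≡ b - a
    eq = solve 2 (λ a b → :- (a :- b) := b :- a) refl a b

  split : ∀ {ε} r s t → r ≡ s + t → ∣ s ∣ < ½ * ε → ∣ t ∣ < ½ * ε → ∣ r ∣ < ε
  split {ε} r s t refl s< t< = subst (∣ s + t ∣ <_) (half+half ε)
    (ℚ.≤-<-trans (ℚ.∣p+q∣≤∣p∣+∣q∣ s t) (ℚ.+-mono-< s< t<))

  close-trans : ∀ {ε} a b c → ∣ a - b ∣ < ½ * ε → ∣ b - c ∣ < ½ * ε → ∣ a - c ∣ < ε
  close-trans a b c = split (a - c) (a - b) (b - c)
    (solve 3 (λ a b c → a :- c := (a :- b) :+ (b :- c)) refl a b c)
    where open +-*-Solver

  close-+ : ∀ {ε} a b c d → ∣ a - b ∣ < ½ * ε → ∣ c - d ∣ < ½ * ε →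
            ∣ (a + c) - (b + d) ∣ < ε
  close-+ a b c d = split ((a + c) - (b + d)) (a - b) (c - d)
    (solve 4 (λ a b c d → (a :+ c) :- (b :+ d) := (a :- b) :+ (c :- d)) refl a b c d)
    where open +-*-Solver

  close-neg : ∀ {ε} a b → ∣ a - b ∣ < ε → ∣ (- a) - (- b) ∣ < ε
  close-neg {ε} a b a~b = subst (λ r → ∣ r ∣ < ε) eq (close-sym a b a~b)
    where
    open +-*-Solver
    eq : b - a ≡ (- a) - (- b)
    eq = solve 2 (λ a b → b :- a := (:- a) :- (:- b)) refl a b

  δ : ∀ B ε → 0ℚ < B → 0ℚ < ε → ∃ λ δ → 0ℚ < δ × B * δ ≡ ½ * ε
  δ B ε 0<B 0<ε = B⁻¹ * (½ * ε) , pos , eq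
    where
    instance
      _ = ℚ.positive 0<B
      _ = ℚ.pos⇒nonZero B
    B⁻¹ = ℚ.1/ B
    instance _ = ℚ.1/pos⇒pos B
    pos : 0ℚ < B⁻¹ * (½ * ε)
    pos = subst (_< B⁻¹ * (½ * ε)) (ℚ.*-zeroʳ B⁻¹) (ℚ.*-monoʳ-<-pos B⁻¹ (half>0 0<ε))
    eq : B * (B⁻¹ * (½ * ε)) ≡ ½ * ε
    eq = trans (sym (ℚ.*-assoc B B⁻¹ _)) (trans (cong (_* (½ * ε)) (ℚ.*-inverseʳ B)) (ℚ.*-identityˡ _))

  small-* : ∀ {B δ η} s t → 0ℚ < B → B * δ ≡ η → ∣ s ∣ < B → ∣ t ∣ < δ → ∣ s * t ∣ < η
  small-* {B} {δ} s t 0<B refl s< t< = ℚ.≤-<-trans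
    (subst (_≤ B * ∣ t ∣) (sym (ℚ.∣p*q∣≡∣p∣*∣q∣ s t))
      (ℚ.*-monoʳ-≤-nonNeg ∣ t ∣ {{ℚ.∣-∣-nonNeg t}} (ℚ.<⇒≤ s<)))
    (ℚ.*-monoʳ-<-pos B {{ℚ.positive 0<B}} t<)

  close-* : ∀ {B δ ε} a b c d → 0ℚ < B → B * δ ≡ ½ * ε → ∣ a ∣ < B → ∣ d ∣ < B →
            ∣ a - b ∣ < δ → ∣ c - d ∣ < δ → ∣ (a * c) - (b * d) ∣ < ε
  close-* a b c d 0<B e a< d< a~b c~d = split ((a * c) - (b * d)) (a * (c - d)) (d * (a - b))
    (solve 4 (λ a b c d → (a :* c) :- (b :* d) := a :* (c :- d) :+ d :* (a :- b)) refl a b c d)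
    (small-* a (c - d) 0<B e a< c~d) (small-* d (a - b) 0<B e d< a~b)
    where open +-*-Solver

  bounded : ∀ a b → ∣ a - b ∣ < 1ℚ → ∣ a ∣ < 1ℚ + ∣ b ∣
  bounded a b a~b = ℚ.≤-<-trans
    (subst (λ r → ∣ r ∣ ≤ ∣ a - b ∣ + ∣ b ∣) eq (ℚ.∣p+q∣≤∣p∣+∣q∣ (a - b) b))
    (ℚ.+-monoˡ-< ∣ b ∣ a~b)
    where
    open +-*-Solver
    eq : (a - b) + b ≡ a
    eq = solve 2 (λ a b → (a :- b) :+ b := a) refl a b

  1+>0 : ∀ b → 0ℚ < 1ℚ + ∣ b ∣
  1+>0 b = ℚ.+-mono-<-≤ (ℚ.positive⁻¹ 1ℚ) (ℚ.0≤∣p∣ b)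

  weaken : ∀ a b c → 0ℚ < c → a < b → a < b + c
  weaken a b c 0<c a<b = ℚ.<-≤-trans a<b
    (subst (_≤ b + c) (ℚ.+-identityʳ b) (ℚ.+-monoʳ-≤ b (ℚ.<⇒≤ 0<c)))

open Estimates

record ℝ : Set where
  constructor mkℝ
  field
    seq    : ℕ → ℚ
    cauchy : ∀ ε → 0ℚ ℚ.< ε →
             ∃ λ N → ∀ i j → N ℕ.≤ i → N ℕ.≤ j → ℚ.∣ seq i ℚ.- seq j ∣ ℚ.< ε

open ℝ

infix 4 _≃_ _<ᴿ_

_≃_ : ℝ → ℝ → Set
x ≃ y = ∀ ε → 0ℚ ℚ.< ε → ∃ λ N → ∀ i → N ℕ.≤ i → ℚ.∣ seq x i ℚ.- seq y i ∣ ℚ.< ε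

-- The gap ε is uniform in i: sequences with x i < y i can have equal limits.
_<ᴿ_ : ℝ → ℝ → Set
x <ᴿ y = ∃ λ ε → 0ℚ ℚ.< ε × ∃ λ N → ∀ i → N ℕ.≤ i → seq x i ℚ.+ ε ℚ.≤ seq y i

private
  ⊔ˡ : ∀ {m n k} → m ⊔ n ℕ.≤ k → m ℕ.≤ k
  ⊔ˡ {m} {n} = ℕ.m⊔n≤o⇒m≤o m n

  ⊔ʳ : ∀ {m n k} → m ⊔ n ℕ.≤ k → n ℕ.≤ k
  ⊔ʳ {m} {n} = ℕ.m⊔n≤o⇒n≤o m n

  eventuallyBounded : ∀ x → ∃ λ B → 0ℚ ℚ.< B × ∃ λ N → ∀ i → N ℕ.≤ i → ℚ.∣ seq x i ∣ ℚ.< B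
  eventuallyBounded x =
    let N , h = cauchy x 1ℚ (ℚ.positive⁻¹ 1ℚ) in
    1ℚ ℚ.+ ℚ.∣ seq x N ∣ , 1+>0 (seq x N) , N ,
    λ i N≤i → bounded (seq x i) (seq x N) (h i N N≤i ℕ.≤-refl)

  commonBound : ∀ x y → ∃ λ B → 0ℚ ℚ.< B × ∃ λ N → ∀ i → N ℕ.≤ i →
                ℚ.∣ seq x i ∣ ℚ.< B × ℚ.∣ seq y i ∣ ℚ.< B
  commonBound x y =
    let B , 0<B , M , f = eventuallyBounded x
        C , 0<C , N , g = eventuallyBounded y
    in
    B ℚ.+ C , weaken 0ℚ B C 0<C 0<B , M ⊔ N , λ i h →
      weaken ℚ.∣ seq x i ∣ B C 0<C (f i (⊔ˡ h)) ,
      subst (ℚ.∣ seq y i ∣ ℚ.<_) (ℚ.+-comm C B)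
        (weaken ℚ.∣ seq y i ∣ C B 0<B (g i (⊔ʳ {M} h)))

fromℚ : ℚ → ℝ
fromℚ q = mkℝ (λ _ → q) λ ε 0<ε → 0 , λ _ _ _ _ → close-refl q 0<ε

0ᴿ 1ᴿ : ℝ
0ᴿ = fromℚ 0ℚ
1ᴿ = fromℚ 1ℚ

infixl 6 _+ᴿ_
infixl 7 _*ᴿ_
infix  8 -ᴿ_

_+ᴿ_ : ℝ → ℝ → ℝ
seq    (x +ᴿ y) i = seq x i ℚ.+ seq y i
cauchy (x +ᴿ y) ε 0<ε =
  let M , f = cauchy x (½ ℚ.* ε) (half>0 0<ε)
      N , g = cauchy y (½ ℚ.* ε) (half>0 0<ε)
  in M ⊔ N , λ i j p q → close-+ (seq x i) (seq x j) (seq y i) (seq y j)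
    (f i j (⊔ˡ p) (⊔ˡ q)) (g i j (⊔ʳ {M} p) (⊔ʳ {M} q))

-ᴿ_ : ℝ → ℝ
seq    (-ᴿ x) i = ℚ.- seq x i
cauchy (-ᴿ x) ε 0<ε =
  let N , f = cauchy x ε 0<ε in N , λ i j p q → close-neg (seq x i) (seq x j) (f i j p q)

_*ᴿ_ : ℝ → ℝ → ℝ
seq    (x *ᴿ y) i = seq x i ℚ.* seq y i
cauchy (x *ᴿ y) ε 0<ε =
  let B , 0<B , K , b = commonBound x y
      η , 0<η , e = δ B ε 0<B 0<ε
      M , f = cauchy x η 0<η
      N , g = cauchy y η 0<η
  in K ⊔ (M ⊔ N) , λ i j p q → close-* (seq x i) (seq x j) (seq y i) (seq y j) 0<B e
    (proj₁ (b i (⊔ˡ p))) (proj₂ (b j (⊔ˡ q)))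
    (f i j (⊔ˡ (⊔ʳ {K} p)) (⊔ˡ (⊔ʳ {K} q)))
    (g i j (⊔ʳ {M} (⊔ʳ {K} p)) (⊔ʳ {M} (⊔ʳ {K} q)))

private
  pointwise : ∀ x y → (∀ i → seq x i ≡ seq y i) → x ≃ y
  pointwise x y eq ε 0<ε = 0 , λ i _ →
    subst (λ r → ℚ.∣ seq x i ℚ.- r ∣ ℚ.< ε) (eq i) (close-refl (seq x i) 0<ε)

  ≃-isEquivalence : IsEquivalence _≃_
  ≃-isEquivalence = record
    { refl  = λ {x} → pointwise x x λ _ → refl
    ; sym   = λ {x} {y} x≃y ε 0<ε → let N , f = x≃y ε 0<ε in
                N , λ i p → close-sym (seq x i) (seq y i) (f i p)
    ; trans = λ {x} {y} {z} x≃y y≃z ε 0<ε →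
                let M , f = x≃y (½ ℚ.* ε) (half>0 0<ε)
                    N , g = y≃z (½ ℚ.* ε) (half>0 0<ε)
                in M ⊔ N , λ i p → close-trans (seq x i) (seq y i) (seq z i)
                                     (f i (⊔ˡ p)) (g i (⊔ʳ {M} p))
    }

  +ᴿ-cong : ∀ {x x′ y y′} → x ≃ x′ → y ≃ y′ → x +ᴿ y ≃ x′ +ᴿ y′
  +ᴿ-cong {x} {x′} {y} {y′} p q ε 0<ε =
    let M , f = p (½ ℚ.* ε) (half>0 0<ε)
        N , g = q (½ ℚ.* ε) (half>0 0<ε)
    in M ⊔ N , λ i h → close-+ (seq x i) (seq x′ i) (seq y i) (seq y′ i) (f i (⊔ˡ h)) (g i (⊔ʳ {M} h))

  -ᴿ-cong : ∀ {x x′} → x ≃ x′ → -ᴿ x ≃ -ᴿ x′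
  -ᴿ-cong {x} {x′} p ε 0<ε =
    let N , f = p ε 0<ε in N , λ i h → close-neg (seq x i) (seq x′ i) (f i h)

  *ᴿ-cong : ∀ {x x′ y y′} → x ≃ x′ → y ≃ y′ → x *ᴿ y ≃ x′ *ᴿ y′
  *ᴿ-cong {x} {x′} {y} {y′} p q ε 0<ε =
    let B , 0<B , K , b = commonBound x y′
        η , 0<η , e = δ B ε 0<B 0<ε
        M , f = p η 0<η
        N , g = q η 0<η
    in K ⊔ (M ⊔ N) , λ i h → close-* (seq x i) (seq x′ i) (seq y i) (seq y′ i) 0<B e
      (proj₁ (b i (⊔ˡ h))) (proj₂ (b i (⊔ˡ h)))
      (f i (⊔ˡ (⊔ʳ {K} h))) (g i (⊔ʳ {M} (⊔ʳ {K} h)))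

  isCommutativeRing : IsCommutativeRing _≃_ _+ᴿ_ _*ᴿ_ -ᴿ_ 0ᴿ 1ᴿ
  isCommutativeRing = record
    { isRing = record
      { +-isAbelianGroup = record
        { isGroup = record
          { isMonoid = record
            { isSemigroup = record
              { isMagma = record
                { isEquivalence = ≃-isEquivalence
                ; ∙-cong = λ {x} {x′} {y} {y′} → +ᴿ-cong {x} {x′} {y} {y′} }
              ; assoc = λ x y z → pointwise ((x +ᴿ y) +ᴿ z) (x +ᴿ (y +ᴿ z))
                          λ i → ℚ.+-assoc (seq x i) (seq y i) (seq z i) }
            ; identity = (λ x → pointwise (0ᴿ +ᴿ x) x λ i → ℚ.+-identityˡ (seq x i))
                       , (λ x → pointwise (x +ᴿ 0ᴿ) x λ i → ℚ.+-identityʳ (seq x i)) }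
          ; inverse = (λ x → pointwise (-ᴿ x +ᴿ x) 0ᴿ λ i → ℚ.+-inverseˡ (seq x i))
                    , (λ x → pointwise (x +ᴿ -ᴿ x) 0ᴿ λ i → ℚ.+-inverseʳ (seq x i))
          ; ⁻¹-cong = λ {x} {x′} → -ᴿ-cong {x} {x′} }
        ; comm = λ x y → pointwise (x +ᴿ y) (y +ᴿ x) λ i → ℚ.+-comm (seq x i) (seq y i) }
      ; *-cong = λ {x} {x′} {y} {y′} → *ᴿ-cong {x} {x′} {y} {y′}
      ; *-assoc = λ x y z → pointwise ((x *ᴿ y) *ᴿ z) (x *ᴿ (y *ᴿ z))
                    λ i → ℚ.*-assoc (seq x i) (seq y i) (seq z i)
      ; *-identity = (λ x → pointwise (1ᴿ *ᴿ x) x λ i → ℚ.*-identityˡ (seq x i))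
                   , (λ x → pointwise (x *ᴿ 1ᴿ) x λ i → ℚ.*-identityʳ (seq x i))
      ; distrib = (λ x y z → pointwise (x *ᴿ (y +ᴿ z)) (x *ᴿ y +ᴿ x *ᴿ z)
                      λ i → ℚ.*-distribˡ-+ (seq x i) (seq y i) (seq z i))
                , (λ x y z → pointwise ((y +ᴿ z) *ᴿ x) (y *ᴿ x +ᴿ z *ᴿ x)
                      λ i → ℚ.*-distribʳ-+ (seq x i) (seq y i) (seq z i)) }
    ; *-comm = λ x y → pointwise (x *ᴿ y) (y *ᴿ x) λ i → ℚ.*-comm (seq x i) (seq y i) }

ℝ-commutativeRing : CommutativeRing 0ℓ 0ℓ
ℝ-commutativeRing = record { isCommutativeRing = isCommutativeRing }

open import Data.Fin.Subset
  using (Subset; inside; outside; ⊤; ⊥; _∈_; _∉_; _∩_; _─_; ⋃; ∣_∣; Nonempty)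
open import Data.Fin.Subset.Properties
  using (_∈?_; _⊆?_; nonempty?; ∈⊤; x∈p∧x∉q⇒x∈p─q)
open import Data.Nat.Base using (_+_)
import Data.Vec.Relation.Unary.AllPairs as VecPairs

-- Vertices are Fin n and edges Fin m; an edge is an unordered pair of
-- distinct vertices, recorded with its smaller endpoint first.
record Graph (n m : ℕ) : Set where
  field
    lo hi  : Fin m → Fin n
    lo<hi  : ∀ e → lo e Fin.< hi e
    simple : ∀ {e f} → lo e ≡ lo f → hi e ≡ hi f → e ≡ f

open Graph

private
  variable
    n m : ℕ
    A   : Set

Incident : Graph n m → Fin m → Fin n → Set
Incident G e v = lo G e ≡ v ⊎ hi G e ≡ v

incident? : (G : Graph n m) → ∀ e v → Dec (Incident G e v)
incident? G e v = (lo G e Fin.≟ v) ⊎-dec (hi G e Fin.≟ v)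

Joins : Graph n m → Fin m → Fin n → Fin n → Set
Joins G e u v = (lo G e ≡ u × hi G e ≡ v) ⊎ (lo G e ≡ v × hi G e ≡ u)

joins? : (G : Graph n m) → ∀ e u v → Dec (Joins G e u v)
joins? G e u v = ((lo G e Fin.≟ u) ×-dec (hi G e Fin.≟ v))
           ⊎-dec ((lo G e Fin.≟ v) ×-dec (hi G e Fin.≟ u))

Adjacent : Graph n m → Fin n → Fin n → Set
Adjacent G u v = ∃ λ e → Joins G e u v

Connected : Graph n m → Set
Connected G = ∀ u v → Star (Adjacent G) u v

⟪_⟫ : {P : Fin n → Set} → Decidable P → Subset n
⟪ P? ⟫ = Vec.tabulate (λ i → does (P? i))

private
  ∈⟪⟫⁺ : {P : Fin n → Set} (P? : Decidable P) → ∀ {i} → P i → i ∈ ⟪ P? ⟫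
  ∈⟪⟫⁺ P? {i} p = Vec.lookup⇒[]= i _
    (trans (Vec.lookup∘tabulate _ i) (dec-true (P? i) p))

  ∈⟪⟫⁻ : {P : Fin n → Set} (P? : Decidable P) → ∀ {i} → i ∈ ⟪ P? ⟫ → P i
  ∈⟪⟫⁻ P? {i} h = does⇒ (P? i) (trans (sym (Vec.lookup∘tabulate _ i)) (Vec.[]=⇒lookup h))
    where
    does⇒ : ∀ {Q : Set} (Q? : Dec Q) → does Q? ≡ true → Q
    does⇒ (yes q) _ = q

span : Graph n m → Subset m → Subset n
span G F = ⟪ (λ v → any? λ e → (e ∈? F) ×-dec incident? G e v) ⟫

record Subgraph (G : Graph n m) : Set where
  field
    verts  : Subset n
    edges  : Subset m
    closed : ∀ {e} → e ∈ edges → lo G e ∈ verts × hi G e ∈ verts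

open Subgraph

whole : (G : Graph n m) → Subgraph G
whole G = record { verts = ⊤ ; edges = ⊤ ; closed = λ _ → ∈⊤ , ∈⊤ }

generated : (G : Graph n m) → Subset m → Subgraph G
generated G F = record
  { verts  = span G F
  ; edges  = F
  ; closed = λ {e} e∈F →
      ∈⟪⟫⁺ (λ v → any? λ e → (e ∈? F) ×-dec incident? G e v) (e , e∈F , inj₁ refl) ,
      ∈⟪⟫⁺ (λ v → any? λ e → (e ∈? F) ×-dec incident? G e v) (e , e∈F , inj₂ refl)
  }

infixl 6 _∖_ _∖ᴳ_

_∖_ : {G : Graph n m} → Subgraph G → Subset n → Subgraph G
_∖_ {G = G} H D = record
  { verts  = verts H ─ D
  ; edges  = ⟪ kept? ⟫
  ; closed = λ h → let e∈H , lo∉D , hi∉D = ∈⟪⟫⁻ kept? h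
                       lo∈H , hi∈H = closed H e∈H
                   in x∈p∧x∉q⇒x∈p─q lo∈H lo∉D , x∈p∧x∉q⇒x∈p─q hi∈H hi∉D
  }
  where
  kept? : Decidable λ e → e ∈ edges H × lo G e ∉ D × hi G e ∉ D
  kept? e = (e ∈? edges H) ×-dec ¬? (lo G e ∈? D) ×-dec ¬? (hi G e ∈? D)

_∖ᴳ_ : {G : Graph n m} → Subgraph G → Subgraph G → Subgraph G
H ∖ᴳ K = H ∖ verts K

-- The vertices of G come first, then the subdivision vertices e*.  The
-- first m edges are the pairs {lo e , e*}, the last m the {hi e , e*}.
subdivision : Graph n m → Graph (n + m) (m + m)
subdivision {n} {m} G = record
  { lo     = low
  ; hi     = high
  ; lo<hi  = low<high
  ; simple = λ {e} {f} → inj e f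
  }
  where
  low high : Vector (Fin (n + m)) (m + m)
  low  = (λ e → lo G e ↑ˡ m) Vector.++ (λ e → hi G e ↑ˡ m)
  high = (n ↑ʳ_) Vector.++ (n ↑ʳ_)

  ↑ˡ<↑ʳ : (v : Fin n) (e : Fin m) → v ↑ˡ m Fin.< n ↑ʳ e
  ↑ˡ<↑ʳ v e = subst₂ ℕ._<_ (sym (Fin.toℕ-↑ˡ v m)) (sym (Fin.toℕ-↑ʳ n e))
    (ℕ.<-≤-trans (Fin.toℕ<n v) (ℕ.m≤m+n n (toℕ e)))

  low<high : ∀ e → low e Fin.< high e
  low<high e with splitAt m e
  ... | inj₁ e′ = ↑ˡ<↑ʳ (lo G e′) e′
  ... | inj₂ e′ = ↑ˡ<↑ʳ (hi G e′) e′

  lo≢hi : ∀ {e f} → e ≡ f → lo G e ↑ˡ m ≡ hi G f ↑ˡ m → ⊥₀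
  lo≢hi {e} refl p = Fin.<⇒≢ (lo<hi G e) (Fin.↑ˡ-injective m _ _ p)

  inj : ∀ e f → low e ≡ low f → high e ≡ high f → e ≡ f
  inj e f p q with splitAt m e in e≡ | splitAt m f in f≡
  ... | inj₁ e′ | inj₁ f′ = trans (sym (Fin.splitAt⁻¹-↑ˡ e≡))
    (trans (cong (_↑ˡ m) (Fin.↑ʳ-injective n e′ f′ q)) (Fin.splitAt⁻¹-↑ˡ f≡))
  ... | inj₁ e′ | inj₂ f′ = contradiction p (lo≢hi (Fin.↑ʳ-injective n e′ f′ q))
  ... | inj₂ e′ | inj₁ f′ = contradiction (sym p) (lo≢hi (Fin.↑ʳ-injective n f′ e′ (sym q)))
  ... | inj₂ e′ | inj₂ f′ = trans (sym (Fin.splitAt⁻¹-↑ʳ e≡))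
    (trans (cong (m ↑ʳ_) (Fin.↑ʳ-injective n e′ f′ q)) (Fin.splitAt⁻¹-↑ʳ f≡))

original : Subset n → Subset (n + m)
original D = D Vec.++ ⊥

subdivide : {G : Graph n m} → Subgraph G → Subgraph (subdivision G)
subdivide {n} {m} {G} H = record
  { verts  = verts H Vec.++ edges H
  ; edges  = edges H Vec.++ edges H
  ; closed = λ {e} → closed′ e
  }
  where
  ∈ˡ : ∀ {k l} {p : Subset k} {q : Subset l} {i} → i ∈ p → (i ↑ˡ l) ∈ (p Vec.++ q)
  ∈ˡ {p = p} {q} {i} h = Vec.lookup⇒[]= _ _ (trans (Vec.lookup-++ˡ p q i) (Vec.[]=⇒lookup h))

  ∈ʳ : ∀ {k l} {p : Subset k} {q : Subset l} {i} → i ∈ q → (k ↑ʳ i) ∈ (p Vec.++ q)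
  ∈ʳ {p = p} {q} {i} h = Vec.lookup⇒[]= _ _ (trans (Vec.lookup-++ʳ p q i) (Vec.[]=⇒lookup h))

  closed′ : ∀ e → e ∈ (edges H Vec.++ edges H) →
            lo (subdivision G) e ∈ (verts H Vec.++ edges H) ×
            hi (subdivision G) e ∈ (verts H Vec.++ edges H)
  closed′ e h
    with e∈ ← trans (sym (Vec.lookup-splitAt m (edges H) (edges H) e)) (Vec.[]=⇒lookup h)
    with splitAt m e
  ... | inj₁ e′ = let e′∈ = Vec.lookup⇒[]= e′ _ e∈ in ∈ˡ (proj₁ (closed H e′∈)) , ∈ʳ e′∈
  ... | inj₂ e′ = let e′∈ = Vec.lookup⇒[]= e′ _ e∈ in ∈ˡ (proj₂ (closed H e′∈)) , ∈ʳ e′∈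

subsets : ∀ m → List (Subset m)
subsets zero    = [] ∷ []
subsets (suc m) = List.map (inside ∷_) (subsets m) List.++ List.map (outside ∷_) (subsets m)

sublists : List A → List (List A)
sublists []       = [] ∷ []
sublists (x ∷ xs) = List.map (x ∷_) (sublists xs) List.++ sublists xs

private
  anyVec? : ∀ k {P : Vec (Fin n) k → Set} → Decidable P → Dec (∃ P)
  anyVec? zero    P? = map′ ([] ,_) (λ { ([] , p) → p }) (P? [])
  anyVec? (suc k) P? = map′ (λ (x , xs , p) → x ∷ xs , p) (λ { (x ∷ xs , p) → x , xs , p })
    (any? λ x → anyVec? k λ xs → P? (x ∷ xs))

IsMatching : Graph n m → Subset m → Set
IsMatching G M = ∀ e f → e ∈ M → f ∈ M → e ≢ f → ∀ v → ¬ (Incident G e v × Incident G f v)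

isMatching? : (G : Graph n m) → Decidable (IsMatching G)
isMatching? G M = all? λ e → all? λ f → (e ∈? M) →-dec (f ∈? M) →-dec ¬? (e Fin.≟ f) →-dec
  all? λ v → ¬? (incident? G e v ×-dec incident? G f v)

matchings : {G : Graph n m} → Subgraph G → ℕ → List (Subset m)
matchings {m = m} {G} H j = filter
  (λ M → (M ⊆? edges H) ×-dec isMatching? G M ×-dec (∣ M ∣ ℕ.≟ j)) (subsets m)

next : ∀ {l} → Fin (3 + l) → Fin (3 + l)
next {l} i = suc (toℕ i) mod (3 + l)

-- F is the edge set of the cycle w₀ w₁ … w₂₊ₗ w₀; a cycle has at least 3 vertices.
CycleThrough : (G : Graph n m) → Subset m → ∀ {l} → Vec (Fin n) (3 + l) → Set
CycleThrough G F w =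
    Unique w
  × (∀ i → Adjacent G (lookup w i) (lookup w (next i)))
  × (∀ e → (e ∈ F → ∃ λ i → Joins G e (lookup w i) (lookup w (next i)))
         × ((∃ λ i → Joins G e (lookup w i) (lookup w (next i))) → e ∈ F))

IsCycle : Graph n m → Subset m → Set
IsCycle {n} G F = ∃ λ l → ∃ λ (w : Vec (Fin n) (3 + l)) → CycleThrough G F w

isCycle? : (G : Graph n m) → Decidable (IsCycle G)
isCycle? {n} {m} G F = map′ (λ (l , h) → toℕ l , h) bound
  (any? {n = n} λ l → anyVec? (3 + toℕ l) through?)
  where
  through? : ∀ {l} → Decidable (CycleThrough G F {l})
  through? w = VecPairs.allPairs? (λ u v → ¬? (u Fin.≟ v)) w
    ×-dec (all? λ i → any? λ e → joins? G e (lookup w i) (lookup w (next i)))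
    ×-dec (all? λ e → ((e ∈? F) →-dec any? λ i → joins? G e (lookup w i) (lookup w (next i)))
                ×-dec ((any? λ i → joins? G e (lookup w i) (lookup w (next i))) →-dec (e ∈? F)))

  bound : IsCycle G F → ∃ λ (l : Fin n) → ∃ (CycleThrough G F {toℕ l})
  bound (l , w , h) = Fin.fromℕ< l<n ,
    subst (λ l → ∃ (CycleThrough G F {l})) (sym (Fin.toℕ-fromℕ< l<n)) (w , h)
    where
    l<n : l ℕ.< n
    l<n = ℕ.≤-trans (s≤s (ℕ.≤-trans (ℕ.n≤1+n l) (ℕ.n≤1+n (suc l))))
      (Fin.injective⇒≤ {f = lookup w} λ {i} {j} → lookup-injective (proj₁ h) i j)

cycles : Graph n m → List (Subset m)
cycles {m = m} G = filter (isCycle? G) (subsets m)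

VertexDisjoint : Graph n m → Subset m → Subset m → Set
VertexDisjoint G F F′ = ¬ Nonempty (span G F ∩ span G F′)

vertexDisjoint? : (G : Graph n m) → ∀ F F′ → Dec (VertexDisjoint G F F′)
vertexDisjoint? G F F′ = ¬? (nonempty? (span G F ∩ span G F′))

-- A vertex-disjoint union of cycles is represented by the family of its
-- component cycles (each given by its edge set).  The family is a
-- sublist of the duplicate-free list `cycles G`, so each union occurs once.
cycleUnions : Graph n m → List (List (Subset m))
cycleUnions G = filter
  (λ C → (1 ℕ.≤? length C) ×-dec allPairs? (vertexDisjoint? G) C)
  (sublists (cycles G))

union : (G : Graph n m) → List (Subset m) → Subgraph G
union G C = generated G (⋃ C)

#components : List (Subset m) → ℕ
#components = length

elements : (X : Subset n) → Vec (Fin n) ∣ X ∣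
elements []            = []
elements (inside  ∷ X) = zero ∷ Vec.map suc (elements X)
elements (outside ∷ X) = Vec.map suc (elements X)

module Weighted {a ℓ} (R : CommutativeRing a ℓ) where

  open CommutativeRing R using (Carrier; 0#; 1#; -_; semiring)
    renaming (_+_ to _⊕_; _*_ to _⊗_)
  open import Algebra.Definitions.RawSemiring (Semiring.rawSemiring semiring) public using (_^_)
  open import Algebra.Definitions.RawSemiring (Semiring.rawSemiring semiring) using (sum; product)

  Matrix : ℕ → Set a
  Matrix k = Fin k → Fin k → Carrier

  _[_] : Matrix n → (X : Subset n) → Matrix ∣ X ∣
  (A [ X ]) i j = A (lookup (elements X) i) (lookup (elements X) j)

  det : ∀ {k} → Matrix k → Carrier
  det {zero}  A = 1#
  det {suc k} A = sum λ j →
    (- 1#) ^ toℕ j ⊗ A zero j ⊗ det λ r s → A (suc r) (punchIn j s)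

  ∑ : List A → (A → Carrier) → Carrier
  ∑ xs f = List.foldr (λ x s → f x ⊕ s) 0# xs

  laplacian : Graph n m → (Fin m → Carrier) → Matrix n
  laplacian G c u v with u Fin.≟ v
  ... | yes _ = sum λ e → if does (incident? G e u) then c e else 0#
  ... | no  _ with any? (λ e → joins? G e u v)
  ...   | yes (e , _) = - c e
  ...   | no  _       = 0#

  weight : (Fin m → Carrier) → Subset m → Carrier
  weight c F = product λ e → if lookup F e then c e else 1#

  subdivisionWeights : (Fin m → Carrier) → Fin (m + m) → Carrier
  subdivisionWeights c = c Vector.++ c

  matchingSum : {G : Graph n m} → (Fin m → Carrier) → Subgraph G → ℕ → Carrier
  matchingSum c H j = ∑ (matchings H j) (weight c)

open Weighted ℝ-commutativeRing public

-- Write h for a half-edge, running from its end v to the other vertex of its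
-- edge.  Row v of the Laplacian is the sum of c h (δ (end h) − δ (other h)) over
-- the half-edges h at v, so by multilinearity det L[X] is a sum over selections
-- of one half-edge at each vertex of X.  The determinant attached to a selection,
-- evaluated by merging one vertex at a time into its successor, is 1 when the
-- walk along the selected half-edges always leaves X and 0 otherwise.  Selections
-- using an edge twice contribute 0; the others are the matchings of S_X that
-- saturate X, and for such a matching M
--
--   [no cycle is traced out by M]  =  ∑_{C a set of cycles traced out by M} (−1)^|C|.
--
-- Exchanging the two sums gives the claim: distinct cycles traced out by M are
-- disjoint, and each cycle has two orientations, whence the powers of −2.
module Submission where

open import Defs hiding (Matrix; det; ∑; _[_]; _^_; laplacian; weight; subdivisionWeights; matchingSum)
open import Algebra.Bundles using (CommutativeRing; Semiring)
open import Data.Bool.Base using (Bool; true; false; if_then_else_; _∨_)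
open import Data.Fin.Base as Fin using (Fin; zero; suc; toℕ; fromℕ; inject₁; inject≤; _↑ˡ_; _↑ʳ_; splitAt; punchIn; punchOut)
import Data.Fin.Properties as Fin
open import Data.Fin.Properties using (any?; all?)
open import Data.Fin.Induction using (<-weakInduction; >-weakInduction)
open import Data.Fin.Relation.Unary.Top using (view; ‵fromℕ; ‵inject₁)
open import Data.Fin.Subset using (Subset; inside; outside; ⊤; ⊥; _∈_; _∉_; _⊆_; _∪_; _─_; _-_; ⁅_⁆; ⋃; ∁; ∣_∣)
import Data.Fin.Subset.Properties as Sub
open import Data.Fin.Subset.Properties using (_∈?_; _⊆?_)
open import Data.List.Base as List using (List; []; _∷_; _++_; length; filter; allFin; cartesianProductWith)
import Data.List.Properties as List
open import Data.List.Membership.Propositional using (find; lose) renaming (_∈_ to _∈ᴸ_)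
import Data.List.Membership.Propositional.Properties as ∈ᴸ
open import Data.List.Membership.Propositional.Properties.WithK using (unique∧set⇒bag)
open import Data.List.Relation.Binary.BagAndSetEquality using (∼bag⇒↭)
open import Data.List.Relation.Binary.Permutation.Propositional as ↭ using (_↭_)
open import Data.List.Relation.Unary.All as All using (All; []; _∷_)
open import Data.List.Relation.Unary.AllPairs using (AllPairs; []; _∷_; allPairs?)
open import Data.List.Relation.Unary.All.Properties using (¬Any⇒All¬; all-filter)
open import Data.List.Relation.Unary.Any as Any using (here; there)
open import Data.List.Relation.Unary.Unique.Propositional using (Unique)
import Data.List.Relation.Unary.Unique.Propositional.Properties as Unique
open import Data.Nat.Base as ℕ using (ℕ; zero; suc; _∸_; z≤n; s≤s)
import Data.Nat.Properties as ℕ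
open import Data.Nat.DivMod using (m<n⇒m%n≡m; n%n≡0; m%n<n; _%_)
open import Data.Product using (_×_; _,_; ∃; ∃₂; proj₁; proj₂)
open import Data.Sum.Base using (_⊎_; inj₁; inj₂; [_,_]′)
open import Data.Vec.Base as Vec using (Vec; []; _∷_; lookup)
import Data.Vec.Properties as Vec
import Data.Vec.Relation.Unary.Unique.Propositional.Properties as VecUnique
open import Data.Vec.Functional as Vector using (Vector; insertAt; removeAt)
import Data.Vec.Functional.Properties as Vector
open import Function.Base using (_∘_; _|>′_; id; case_of_)
open import Function.Bundles using (mk⇔)
open import Level using (0ℓ)
open import Relation.Binary.PropositionalEquality using (_≡_; _≢_; refl; sym; trans; cong; cong₂; subst; subst₂)
open import Relation.Nullary using (¬_; Dec; yes; no; does; contradiction)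
open import Relation.Nullary.Decidable using (_×-dec_; _⊎-dec_; _→-dec_; ¬?; dec-true; dec-false)
open import Relation.Unary using (Pred; Decidable)

open Graph
open Subgraph

-- `det` expands along the first row, so merging a vertex is phrased in columns, and the only sign
-- to track is that of carrying one column to the front. One vanishing argument then serves twice: a
-- nonempty set of vertices that the walk cannot leave survives every merge, until a loop, that is a
-- zero row, appears. Two vertices that select the same edge form such a set, and so does a traced
-- cycle. Once repeated edges are gone, a closed walk has length at least 3 and is a cycle of the
-- simple graph.
--
-- Tracing is tested cycle by cycle, through the half-edges that start on the cycle. The indicator
-- of a family is therefore a product, and the inner sum may run over all sublists of `cycles G`:
-- families that overlap or leave X are traced by no matching and drop out. Since the test ignores
-- half-edges that start off the cycle, oriented cycles can be peeled off a matching one by one,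
-- each time leaving a saturating matching of the remaining vertices.

-- Finite sums and indicators over a commutative ring

module Sums {a ℓ} (R : CommutativeRing a ℓ) where

  open CommutativeRing R public hiding (zero; _-_)
    renaming (refl to ≈-refl; sym to ≈-sym; trans to ≈-trans; reflexive to ≈-reflexive)
  open Weighted R public
  open import Algebra.Definitions.RawSemiring (Semiring.rawSemiring semiring) public using (sum; product)
  open import Algebra.Properties.Ring ring public using (-0#≈0#; -1*x≈-x; -‿involutive)
  open import Algebra.Properties.CommutativeMonoid.Sum +-commutativeMonoid public
    using (sum-remove; ∑-distrib-+; sum-cong-≋)
  open import Algebra.Properties.CommutativeMonoid.Sum *-commutativeMonoid public
    using () renaming (∑-distrib-+ to product-distrib-*; sum-cong-≋ to product-cong)
  open import Algebra.Properties.Semiring.Sum semiring public using (*-distribˡ-sum)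
  open import Algebra.Solver.CommutativeMonoid +-commutativeMonoid public
    using () renaming (solve to +-solve; _⊕_ to _:+_; _⊜_ to _:=_)
  open import Algebra.Solver.CommutativeMonoid *-commutativeMonoid public
    using () renaming (solve to *-solve; _⊕_ to _:*_; _⊜_ to _:≈_)
  open import Relation.Binary.Reasoning.Setoid setoid public

  [[_]] : ∀ {p} {P : Set p} → Dec P → Carrier
  [[ P? ]] = if does P? then 1# else 0#

  [[]]-yes : ∀ {p} {P : Set p} (P? : Dec P) → P → [[ P? ]] ≈ 1#
  [[]]-yes (yes _) _ = ≈-refl
  [[]]-yes (no ¬p) p = contradiction p ¬p

  [[]]-no : ∀ {p} {P : Set p} (P? : Dec P) → ¬ P → [[ P? ]] ≈ 0#
  [[]]-no (yes p) ¬p = contradiction p ¬p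
  [[]]-no (no _)  _  = ≈-refl

  [[]]-cong : ∀ {p q} {P : Set p} {Q : Set q} (P? : Dec P) (Q? : Dec Q) →
              (P → Q) → (Q → P) → [[ P? ]] ≈ [[ Q? ]]
  [[]]-cong (yes p) Q? f g = ≈-sym ([[]]-yes Q? (f p))
  [[]]-cong (no ¬p) Q? f g = ≈-sym ([[]]-no Q? (¬p ∘ g))

  [[]]-× : ∀ {p q} {P : Set p} {Q : Set q} (P? : Dec P) (Q? : Dec Q) →
           [[ P? ×-dec Q? ]] ≈ [[ P? ]] * [[ Q? ]]
  [[]]-× (yes _) (yes _) = ≈-sym (*-identityˡ 1#)
  [[]]-× (yes _) (no _)  = ≈-sym (zeroʳ 1#)
  [[]]-× (no _)  Q?      = ≈-sym (zeroˡ _)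

  [[]]-⊎ : ∀ {p q} {P : Set p} {Q : Set q} (P? : Dec P) (Q? : Dec Q) → (P → ¬ Q) →
           [[ P? ⊎-dec Q? ]] ≈ [[ P? ]] + [[ Q? ]]
  [[]]-⊎ (yes p) (yes q) h = contradiction q (h p)
  [[]]-⊎ (yes _) (no _)  _ = ≈-sym (+-identityʳ 1#)
  [[]]-⊎ (no _)  (yes _) _ = ≈-sym (+-identityˡ 1#)
  [[]]-⊎ (no _)  (no _)  _ = ≈-sym (+-identityˡ 0#)

  module _ {A : Set} where

    ∑-cong : ∀ xs {f g : A → Carrier} → (∀ {x} → x ∈ᴸ xs → f x ≈ g x) → ∑ xs f ≈ ∑ xs g
    ∑-cong []       h = ≈-refl
    ∑-cong (x ∷ xs) h = +-cong (h (here refl)) (∑-cong xs (h ∘ there))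

    ∑-zero : ∀ xs {f : A → Carrier} → (∀ {x} → x ∈ᴸ xs → f x ≈ 0#) → ∑ xs f ≈ 0#
    ∑-zero []       h = ≈-refl
    ∑-zero (x ∷ xs) h = ≈-trans (+-cong (h (here refl)) (∑-zero xs (h ∘ there))) (+-identityˡ 0#)

    ∑-++ : ∀ xs ys (f : A → Carrier) → ∑ (xs ++ ys) f ≈ ∑ xs f + ∑ ys f
    ∑-++ []       ys f = ≈-sym (+-identityˡ _)
    ∑-++ (x ∷ xs) ys f = ≈-trans (+-congˡ (∑-++ xs ys f)) (≈-sym (+-assoc _ _ _))

    ∑-+ : ∀ xs (f g : A → Carrier) → ∑ xs (λ x → f x + g x) ≈ ∑ xs f + ∑ xs g
    ∑-+ []       f g = ≈-sym (+-identityˡ 0#)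
    ∑-+ (x ∷ xs) f g = ≈-trans (+-congˡ (∑-+ xs f g))
      (+-solve 4 (λ a b c d → ((a :+ b) :+ (c :+ d)) := ((a :+ c) :+ (b :+ d))) ≈-refl _ _ _ _)

    ∑-*ˡ : ∀ y xs (f : A → Carrier) → y * ∑ xs f ≈ ∑ xs (λ x → y * f x)
    ∑-*ˡ y []       f = zeroʳ y
    ∑-*ˡ y (x ∷ xs) f = ≈-trans (distribˡ y _ _) (+-congˡ (∑-*ˡ y xs f))

    ∑-*ʳ : ∀ y xs (f : A → Carrier) → ∑ xs f * y ≈ ∑ xs (λ x → f x * y)
    ∑-*ʳ y []       f = zeroˡ y
    ∑-*ʳ y (x ∷ xs) f = ≈-trans (distribʳ y _ _) (+-congˡ (∑-*ʳ y xs f))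

    ∑-filter : ∀ {p} {P : Pred A p} (P? : Decidable P) xs (f : A → Carrier) →
               ∑ (filter P? xs) f ≈ ∑ xs (λ x → [[ P? x ]] * f x)
    ∑-filter P? []       f = ≈-refl
    ∑-filter P? (x ∷ xs) f with P? x
    ... | yes _ = +-cong (≈-sym (*-identityˡ _)) (∑-filter P? xs f)
    ... | no  _ = ≈-trans (∑-filter P? xs f) (≈-trans (≈-sym (+-identityˡ _)) (+-congʳ (≈-sym (zeroˡ _))))

    ∑-↭ : ∀ {xs ys} (f : A → Carrier) → xs ↭ ys → ∑ xs f ≈ ∑ ys f
    ∑-↭ f ↭.refl         = ≈-refl
    ∑-↭ f (↭.prep x p)   = +-congˡ (∑-↭ f p)
    ∑-↭ f (↭.swap x y p) = ≈-trans (+-congˡ (+-congˡ (∑-↭ f p)))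
      (+-solve 3 (λ a b c → (a :+ (b :+ c)) := (b :+ (a :+ c))) ≈-refl _ _ _)
    ∑-↭ f (↭.trans p q)  = ≈-trans (∑-↭ f p) (∑-↭ f q)

  module _ {A B : Set} where

    ∑-map : ∀ (g : A → B) xs (f : B → Carrier) → ∑ (List.map g xs) f ≈ ∑ xs (f ∘ g)
    ∑-map g []       f = ≈-refl
    ∑-map g (x ∷ xs) f = +-congˡ (∑-map g xs f)

    ∑-swap : ∀ (xs : List A) (ys : List B) (f : A → B → Carrier) →
             ∑ xs (λ x → ∑ ys (f x)) ≈ ∑ ys (λ y → ∑ xs (λ x → f x y))
    ∑-swap []       ys f = ≈-sym (∑-zero ys (λ _ → ≈-refl))
    ∑-swap (x ∷ xs) ys f = ≈-trans (+-congˡ (∑-swap xs ys f)) (≈-sym (∑-+ ys _ _))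

    -- Duplicate-free lists with the same members are permutations of each other, so a reindexing
    -- only has to be checked on members. It serves twice: from selections to matchings, and from
    -- matchings off a cycle to matchings that contain an orientation of it.
    ∑-bijection : ∀ {xs : List A} {ys : List B} {f : A → Carrier} {g : B → Carrier} (to : A → B) →
      Unique xs → Unique ys → (∀ {x} → x ∈ᴸ xs → to x ∈ᴸ ys) →
      (∀ {x x′} → x ∈ᴸ xs → x′ ∈ᴸ xs → to x ≡ to x′ → x ≡ x′) →
      (∀ {y} → y ∈ᴸ ys → ∃ λ x → x ∈ᴸ xs × to x ≡ y) →
      (∀ {x} → x ∈ᴸ xs → f x ≈ g (to x)) → ∑ xs f ≈ ∑ ys g
    ∑-bijection {xs} {ys} {f} {g} to !xs !ys into inj onto eq = begin
      ∑ xs f               ≈⟨ ∑-cong xs eq ⟩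
      ∑ xs (g ∘ to)        ≈⟨ ∑-map to xs g ⟨
      ∑ (List.map to xs) g ≈⟨ ∑-↭ g (∼bag⇒↭ (unique∧set⇒bag (unique-map xs !xs inj) !ys (mk⇔ ⇒ ⇐))) ⟩
      ∑ ys g               ∎
      where
      ⇒ : ∀ {y} → y ∈ᴸ List.map to xs → y ∈ᴸ ys
      ⇒ p with x , x∈ , refl ← ∈ᴸ.∈-map⁻ to p = into x∈

      ⇐ : ∀ {y} → y ∈ᴸ ys → y ∈ᴸ List.map to xs
      ⇐ p with x , x∈ , refl ← onto p = ∈ᴸ.∈-map⁺ to x∈

      unique-map : ∀ zs → Unique zs → (∀ {x x′} → x ∈ᴸ zs → x′ ∈ᴸ zs → to x ≡ to x′ → x ≡ x′) →
                   Unique (List.map to zs)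
      unique-map []       _         _ = []
      unique-map (z ∷ zs) (z∉ ∷ !z) i =
        All.tabulate (λ {y} y∈ z≡ → case ∈ᴸ.∈-map⁻ to y∈ of λ where
          (x , x∈ , y≡) → All.lookup z∉ x∈ (i (here refl) (there x∈) (trans z≡ y≡)))
        ∷ unique-map zs !z (λ p q → i (there p) (there q))

  ∑-cartesianProductWith : ∀ {A B C : Set} (h : A → B → C) xs ys (f : C → Carrier) →
    ∑ (cartesianProductWith h xs ys) f ≈ ∑ xs (λ x → ∑ ys (λ y → f (h x y)))
  ∑-cartesianProductWith h []       ys f = ≈-refl
  ∑-cartesianProductWith h (x ∷ xs) ys f = ≈-trans (∑-++ (List.map (h x) ys) _ f)
    (+-cong (∑-map (h x) ys f) (∑-cartesianProductWith h xs ys f))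

  ∑-tabulate : ∀ {n} {A : Set} (g : Fin n → A) (f : A → Carrier) →
               ∑ (List.tabulate g) f ≈ sum (f ∘ g)
  ∑-tabulate {zero}  g f = ≈-refl
  ∑-tabulate {suc n} g f = +-congˡ (∑-tabulate (g ∘ suc) f)

  sum-∑ : ∀ {n} {A : Set} (xs : List A) (f : Fin n → A → Carrier) →
          sum (λ i → ∑ xs (f i)) ≈ ∑ xs (λ x → sum (λ i → f i x))
  sum-∑ {zero}  xs f = ≈-sym (∑-zero xs (λ _ → ≈-refl))
  sum-∑ {suc n} xs f = ≈-trans (+-congˡ (sum-∑ xs (f ∘ suc))) (≈-sym (∑-+ xs _ _))

  sum-zero : ∀ {n} {f : Vector Carrier n} → (∀ i → f i ≈ 0#) → sum f ≈ 0#
  sum-zero {zero}  h = ≈-refl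
  sum-zero {suc n} h = ≈-trans (+-cong (h zero) (sum-zero (h ∘ suc))) (+-identityˡ 0#)

  sum-only : ∀ {n} {f : Vector Carrier n} i → (∀ j → j ≢ i → f j ≈ 0#) → sum f ≈ f i
  sum-only {suc n} {f} i h = ≈-trans (sum-remove {i = i} f)
    (≈-trans (+-congˡ (sum-zero (λ j → h _ (Fin.punchInᵢ≢i i j)))) (+-identityʳ _))

-- Choosing one entry from each list

choices : ∀ {A : Set} {k} → (Fin k → List A) → List (Vec A k)
choices {k = zero}  H = [] ∷ []
choices {k = suc k} H = cartesianProductWith _∷_ (H zero) (choices (H ∘ suc))

choices-! : ∀ {A : Set} {k} (H : Fin k → List A) → (∀ i → Unique (H i)) → Unique (choices H)
choices-! {k = zero}  H !H = [] ∷ []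
choices-! {k = suc k} H !H =
  Unique.cartesianProductWith⁺ _∷_ Vec.∷-injective (!H zero) (choices-! (H ∘ suc) (!H ∘ suc))

∈-choices⁺ : ∀ {A : Set} {k} (H : Fin k → List A) (φ : Vec A k) →
             (∀ i → lookup φ i ∈ᴸ H i) → φ ∈ᴸ choices H
∈-choices⁺ H []      h = here refl
∈-choices⁺ H (a ∷ φ) h = ∈ᴸ.∈-cartesianProductWith⁺ _∷_ (h zero) (∈-choices⁺ (H ∘ suc) φ (h ∘ suc))

∈-choices⁻ : ∀ {A : Set} {k} (H : Fin k → List A) {φ : Vec A k} →
             φ ∈ᴸ choices H → ∀ i → lookup φ i ∈ᴸ H i
∈-choices⁻ {k = suc k} H p i
  with a , ψ , a∈ , ψ∈ , refl ← ∈ᴸ.∈-cartesianProductWith⁻ _∷_ (H zero) (choices (H ∘ suc)) p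
  with i
... | zero   = a∈
... | suc i′ = ∈-choices⁻ (H ∘ suc) ψ∈ i′

-- Positions of columns under insertion and deletion

-- The position of v once the s-th of the remaining entries is deleted.
cross : ∀ {k} → Fin (suc k) → Fin k → Fin k
cross {suc k}       zero    s       = zero
cross {suc k}       (suc v) zero    = v
cross {suc (suc k)} (suc v) (suc s) = suc (cross v s)

-- Deleting an old entry commutes with inserting a new one, once the insertion point is corrected by
-- `cross`. This identifies the minors in the expansion of a matrix with an inserted column.
insertAt-punchIn-punchIn : ∀ {a} {A : Set a} {k} (xs : Vector A (suc k)) v (x : A) s t →
  insertAt xs v x (punchIn (punchIn v s) t) ≡ insertAt (xs ∘ punchIn s) (cross v s) x t
insertAt-punchIn-punchIn           xs zero    x s       zero    = refl
insertAt-punchIn-punchIn           xs zero    x s       (suc t) = refl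
insertAt-punchIn-punchIn           xs (suc v) x zero    t       = refl
insertAt-punchIn-punchIn {k = suc k} xs (suc v) x (suc s) zero    = refl
insertAt-punchIn-punchIn {k = suc k} xs (suc v) x (suc s) (suc t) =
  insertAt-punchIn-punchIn (xs ∘ suc) v x s t

-- Walks along a partial map, and their contraction

-- If g zero = x (suc v), then vertex zero of the map x i ↦ g i is merged into x (suc v).
contract : ∀ {n k} → (Fin (suc k) → Fin n) → (Fin (suc k) → Fin n) → Fin k → Fin n
contract x g r with g (suc r) Fin.≟ x zero
... | yes _ = g zero
... | no  _ = g (suc r)

contract-yes : ∀ {n k} (x g : Fin (suc k) → Fin n) {r} → g (suc r) ≡ x zero → contract x g r ≡ g zero
contract-yes x g {r} eq with g (suc r) Fin.≟ x zero
... | yes _ = refl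
... | no ne = contradiction eq ne

contract-no : ∀ {n k} (x g : Fin (suc k) → Fin n) {r} → g (suc r) ≢ x zero → contract x g r ≡ g (suc r)
contract-no x g {r} ne with g (suc r) Fin.≟ x zero
... | yes eq = contradiction eq ne
... | no  _  = refl

-- Iterating x i ↦ g i from x i leaves the image of x.
data Reach {n k} (x g : Fin k → Fin n) : Fin k → Set where
  out : ∀ {i} → (∀ j → g i ≢ x j) → Reach x g i
  via : ∀ {i} j → g i ≡ x j → Reach x g j → Reach x g i

-- The points are listed against the walk: each `point (suc a)` is sent to `point a`, and
-- `point zero` to the last point. This is the order in which a walk that grows at the front
-- produces them.
record Orbit {n k} (x g : Fin k → Fin n) : Set where
  field
    {size} : ℕ
    point  : Fin (suc size) → Fin k
    inj    : ∀ {a b} → point a ≡ point b → a ≡ b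
    chain  : ∀ a → g (point (suc a)) ≡ x (point (inject₁ a))
    close  : g (point zero) ≡ x (point (fromℕ size))

module _ {n k} (x g : Fin k → Fin n) where

  private
    -- `w zero` is the current position and the later entries are the past. If the successor already
    -- occurs as `w b`, the entries up to `b` form an orbit; otherwise it is put in front. The fuel
    -- `d` cannot run out too early, because an injective `w` has at most `k` entries.
    walk : ∀ d {t} (w : Fin (suc t) → Fin k) → (∀ {a b} → w a ≡ w b → a ≡ b) →
           (∀ a → g (w (suc a)) ≡ x (w (inject₁ a))) → k ℕ.≤ suc t ℕ.+ d →
           Reach x g (w zero) ⊎ Orbit x g
    walk d {t} w inj chain k≤ with any? (λ j → g (w zero) Fin.≟ x j)
    ... | no none = inj₁ (out λ j eq → none (j , eq))
    ... | yes (j , eq) with any? (λ b → w b Fin.≟ j)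
    ...   | yes (b , refl) = inj₂ (record
      { point = λ a → w (inject≤ a b<)
      ; inj   = λ eq → Fin.inject≤-injective b< b< _ _ (inj eq)
      ; chain = λ a → trans (chain (inject≤ a (ℕ.≤-pred b<))) (cong (x ∘ w) (Fin.toℕ-injective
          (trans (Fin.toℕ-inject₁ _) (trans (Fin.toℕ-inject≤ a _)
            (sym (trans (Fin.toℕ-inject≤ (inject₁ a) b<) (Fin.toℕ-inject₁ a)))))))
      ; close = trans eq (cong (x ∘ w) (Fin.toℕ-injective
          (sym (trans (Fin.toℕ-inject≤ (fromℕ (toℕ b)) b<) (Fin.toℕ-fromℕ (toℕ b))))))
      })
      where
      b< : suc (toℕ b) ℕ.≤ suc t
      b< = Fin.toℕ<n b
    ...   | no new = step d k≤
      where
      w′ : Fin (suc (suc t)) → Fin k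
      w′ = j Vector.∷ w

      inj′ : ∀ {a b} → w′ a ≡ w′ b → a ≡ b
      inj′ {zero}  {zero}  _  = refl
      inj′ {zero}  {suc b} eq = contradiction (b , sym eq) new
      inj′ {suc a} {zero}  eq = contradiction (a , eq) new
      inj′ {suc a} {suc b} eq = cong suc (inj eq)

      chain′ : ∀ a → g (w′ (suc a)) ≡ x (w′ (inject₁ a))
      chain′ zero    = eq
      chain′ (suc a) = chain a

      step : ∀ d → k ℕ.≤ suc t ℕ.+ d → Reach x g (w zero) ⊎ Orbit x g
      step zero    k≤ = contradiction
        (ℕ.≤-trans (Fin.injective⇒≤ {f = w′} inj′) (subst (k ℕ.≤_) (ℕ.+-identityʳ (suc t)) k≤))
        (ℕ.<-irrefl refl)
      step (suc d) k≤ with walk d w′ inj′ chain′ (subst (k ℕ.≤_) (ℕ.+-suc (suc t) d) k≤)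
      ... | inj₁ r = inj₁ (via j eq r)
      ... | inj₂ o = inj₂ o

    reach-or-orbit₁ : ∀ i → Reach x g i ⊎ Orbit x g
    reach-or-orbit₁ i = walk k {zero} (λ _ → i) (λ { {zero} {zero} _ → refl }) (λ ()) (ℕ.n≤1+n k)

    all-or : ∀ {l} {P : Fin l → Set} {Q : Set} → (∀ i → P i ⊎ Q) → (∀ i → P i) ⊎ Q
    all-or {zero}  h = inj₁ λ ()
    all-or {suc l} h with h zero | all-or (h ∘ suc)
    ... | inj₂ q | _      = inj₂ q
    ... | inj₁ _ | inj₂ q = inj₂ q
    ... | inj₁ p | inj₁ r = inj₁ λ { zero → p ; (suc i) → r i }

  reach-or-orbit : (∀ i → Reach x g i) ⊎ Orbit x g
  reach-or-orbit = all-or reach-or-orbit₁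

loop-unreachable : ∀ {n k} (x g : Fin (suc k) → Fin n) → (∀ {i j} → x i ≡ x j → i ≡ j) →
                   g zero ≡ x zero → ¬ Reach x g zero
loop-unreachable x g inj eq (out none) = none zero eq
loop-unreachable x g inj eq (via j eq′ r) with refl ← inj (trans (sym eq) eq′) =
  loop-unreachable x g inj eq r

-- A path through `zero` skips it, going straight to the successor of `zero`, which is exactly the
-- value that `contract` assigns. The hypothesis on `g zero` excludes a path that stays at `zero`.
reach-contract : ∀ {n k} (x g : Fin (suc k) → Fin n) → (∀ {i j} → x i ≡ x j → i ≡ j) →
                 g zero ≢ x zero → ∀ {r} → Reach x g (suc r) → Reach (x ∘ suc) (contract x g) r
reach-contract x g inj g≢ (out none) =
  out λ j eq → none (suc j) (trans (sym (contract-no x g (none zero))) eq)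
reach-contract x g inj g≢ (via (suc j) eq r) = via j
  (trans (contract-no x g λ eq′ → case inj (trans (sym eq) eq′) of λ ()) eq)
  (reach-contract x g inj g≢ r)
reach-contract x g inj g≢ (via zero eq (out none)) =
  out λ j eq′ → none (suc j) (trans (sym (contract-yes x g eq)) eq′)
reach-contract x g inj g≢ (via zero eq (via zero eq′ r)) = contradiction eq′ g≢
reach-contract x g inj g≢ (via zero eq (via (suc j) eq′ r)) =
  via j (trans (contract-yes x g eq) eq′) (reach-contract x g inj g≢ r)

-- Determinants of functional graphs

module Determinants {a ℓ} (R : CommutativeRing a ℓ) where

  open Sums R

  ε : Carrier
  ε = - 1#

  ε*ε≈1 : ε * ε ≈ 1#
  ε*ε≈1 = ≈-trans (-1*x≈-x ε) (-‿involutive 1#)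

  ε^i*ε^i≈1 : ∀ i → ε ^ i * ε ^ i ≈ 1#
  ε^i*ε^i≈1 zero    = *-identityˡ 1#
  ε^i*ε^i≈1 (suc i) = begin
    (ε * ε ^ i) * (ε * ε ^ i) ≈⟨ *-solve 2 (λ a b → ((a :* b) :* (a :* b)) :≈ ((a :* a) :* (b :* b))) ≈-refl _ _ ⟩
    (ε * ε) * (ε ^ i * ε ^ i) ≈⟨ *-cong ε*ε≈1 (ε^i*ε^i≈1 i) ⟩
    1# * 1#                   ≈⟨ *-identityˡ 1# ⟩
    1#                        ∎

  minor : ∀ {k} → Matrix (suc k) → Fin (suc k) → Matrix k
  minor A j r s = A (suc r) (punchIn j s)

  term : ∀ {k} → Matrix (suc k) → Fin (suc k) → Carrier
  term A j = ε ^ toℕ j * A zero j * det (minor A j)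

  det-cong : ∀ {k} {A B : Matrix k} → (∀ i j → A i j ≈ B i j) → det A ≈ det B
  det-cong {zero}          h = ≈-refl
  det-cong {suc k} {A} {B} h = sum-cong-≋ {x = term A} {y = term B} λ j →
    *-cong (*-congˡ (h zero j)) (det-cong λ r s → h (suc r) (punchIn j s))

  ∏ : ∀ {A : Set} {k} → (A → Carrier) → Vec A k → Carrier
  ∏ c []      = 1#
  ∏ c (h ∷ φ) = c h * ∏ c φ

  -- Multilinearity in the rows. The induction needs `N` to be general: in the minor at column `j`
  -- it becomes `N b ∘ punchIn j`, with the same lists of choices for the remaining rows.
  det-rows : ∀ {B : Set} {k} (H : Fin k → List B) (c : B → Carrier) (N : B → Fin k → Carrier)
             {A : Matrix k} → (∀ i j → A i j ≈ ∑ (H i) (λ h → c h * N h j)) →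
             det A ≈ ∑ (choices H) (λ φ → ∏ c φ * det (λ i → N (lookup φ i)))
  det-rows {k = zero}  H c N     h = ≈-sym (≈-trans (+-identityʳ _) (*-identityˡ 1#))
  det-rows {B} {suc k} H c N {A} h = begin
    sum (term A)
      ≈⟨ sum-cong-≋ {x = term A} (λ j → *-cong (*-congˡ (h zero j))
           (det-rows (H ∘ suc) c (λ b → N b ∘ punchIn j) (λ r s → h (suc r) (punchIn j s)))) ⟩
    sum (λ j → ε ^ toℕ j * ∑ H₀ (λ b → c b * N b j) * ∑ Hs (λ φ → ∏ c φ * d φ j))
      ≈⟨ sum-cong-≋ {x = λ j → ε ^ toℕ j * ∑ H₀ (λ b → c b * N b j) * ∑ Hs (λ φ → ∏ c φ * d φ j)} distribute ⟩
    sum (λ j → ∑ H₀ (λ b → ∑ Hs (λ φ → ∏ c (b ∷ φ) * t b φ j)))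
      ≈⟨ sum-∑ H₀ (λ j b → ∑ Hs (λ φ → ∏ c (b ∷ φ) * t b φ j)) ⟩
    ∑ H₀ (λ b → sum (λ j → ∑ Hs (λ φ → ∏ c (b ∷ φ) * t b φ j)))
      ≈⟨ ∑-cong H₀ (λ {b} _ → sum-∑ Hs (λ j φ → ∏ c (b ∷ φ) * t b φ j)) ⟩
    ∑ H₀ (λ b → ∑ Hs (λ φ → sum (λ j → ∏ c (b ∷ φ) * t b φ j)))
      ≈⟨ ∑-cong H₀ (λ {b} _ → ∑-cong Hs (λ {φ} _ → ≈-sym (*-distribˡ-sum (∏ c (b ∷ φ)) (t b φ)))) ⟩
    ∑ H₀ (λ b → ∑ Hs (λ φ → ∏ c (b ∷ φ) * det (λ i → N (lookup (b ∷ φ) i))))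
      ≈⟨ ∑-cartesianProductWith _∷_ H₀ Hs (λ φ → ∏ c φ * det (λ i → N (lookup φ i))) ⟨
    ∑ (choices H) (λ φ → ∏ c φ * det (λ i → N (lookup φ i))) ∎
    where
    H₀ = H zero
    Hs = choices (H ∘ suc)

    d : Vec B k → Fin (suc k) → Carrier
    d φ j = det (λ i s → N (lookup φ i) (punchIn j s))

    t : B → Vec B k → Fin (suc k) → Carrier
    t b φ j = ε ^ toℕ j * N b j * d φ j

    distribute : ∀ j → ε ^ toℕ j * ∑ H₀ (λ b → c b * N b j) * ∑ Hs (λ φ → ∏ c φ * d φ j) ≈
                       ∑ H₀ (λ b → ∑ Hs (λ φ → ∏ c (b ∷ φ) * t b φ j))
    distribute j = ≈-trans (*-congʳ (∑-*ˡ _ H₀ _)) (≈-trans (∑-*ʳ _ H₀ _) (∑-cong H₀ λ _ →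
      ≈-trans (∑-*ˡ _ Hs _) (∑-cong Hs λ _ →
        *-solve 5 (λ s c n p d → ((s :* (c :* n)) :* (p :* d)) :≈ ((c :* p) :* ((s :* n) :* d)))
          ≈-refl _ _ _ _ _)))

  -- The exponents have equal sums. If `toℕ v ≤ toℕ s`, then `punchIn v s` has index `suc (toℕ s)`
  -- and `cross v s` has the index of `v`; otherwise `punchIn v s` has the index of `s`, and
  -- `cross v s` that of `v` less one.
  sign-cross : ∀ {k} (v : Fin (suc k)) s →
               ε ^ toℕ v * ε ^ toℕ (punchIn v s) ≈ ε ^ suc (toℕ s) * ε ^ toℕ (cross v s)
  sign-cross {suc k}       zero    s       = *-comm _ _
  sign-cross {suc k}       (suc v) zero    =
    *-solve 2 (λ e p → ((e :* p) :* one) :≈ ((e :* one) :* p)) ≈-refl ε _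
    where open import Algebra.Solver.CommutativeMonoid *-commutativeMonoid using () renaming (id to one)
  sign-cross {suc (suc k)} (suc v) (suc s) = begin
    (ε * ε ^ toℕ v) * (ε * ε ^ toℕ (punchIn v s))           ≈⟨ regroup ε _ _ ⟩
    (ε * ε) * (ε ^ toℕ v * ε ^ toℕ (punchIn v s))           ≈⟨ *-congˡ (sign-cross v s) ⟩
    (ε * ε) * (ε ^ suc (toℕ s) * ε ^ toℕ (cross v s))       ≈⟨ regroup ε _ _ ⟨
    (ε * ε ^ suc (toℕ s)) * (ε * ε ^ toℕ (cross v s))       ∎
    where
    regroup : ∀ e x y → (e * x) * (e * y) ≈ (e * e) * (x * y)
    regroup = *-solve 3 (λ e x y → ((e :* x) :* (e :* y)) :≈ ((e :* e) :* (x :* y))) ≈-refl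

  minor-∷ : ∀ {k} (x : Fin (suc (suc k)) → Carrier) (C : Fin (suc (suc k)) → Vector Carrier (suc k)) s →
    ∀ r t → minor (λ r → x r Vector.∷ C r) (suc s) r t ≡ (x (suc r) Vector.∷ (C (suc r) ∘ punchIn s)) t
  minor-∷ x C s r zero    = refl
  minor-∷ x C s r (suc t) = refl

  -- Both sides are expanded along row `zero`. The terms of the moved column agree because the
  -- square of its sign is one; in every other term the moved column still occurs in the minor,
  -- where the induction hypothesis and `sign-cross` apply.
  det-insertAt : ∀ {k} (x : Fin (suc k) → Carrier) (C : Fin (suc k) → Vector Carrier k) v →
    det (λ r → x r Vector.∷ C r) ≈ ε ^ toℕ v * det (λ r → insertAt (C r) v (x r))
  det-insertAt {zero}  x C zero = ≈-sym (≈-trans (*-identityˡ _)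
    (det-cong {A = λ r → insertAt (C r) zero (x r)} {B = λ r → x r Vector.∷ C r} λ { zero zero → ≈-refl }))
  det-insertAt {suc k} x C v    = ≈-sym (begin
    ε ^ toℕ v * sum (term I)
      ≈⟨ *-congˡ (sum-remove {i = v} (term I)) ⟩
    ε ^ toℕ v * (term I v + sum (λ s → term I (punchIn v s)))
      ≈⟨ distribˡ _ _ _ ⟩
    ε ^ toℕ v * term I v + ε ^ toℕ v * sum (λ s → term I (punchIn v s))
      ≈⟨ +-cong head-term (*-distribˡ-sum (ε ^ toℕ v) (λ s → term I (punchIn v s))) ⟩
    term J zero + sum (λ s → ε ^ toℕ v * term I (punchIn v s))
      ≈⟨ +-congˡ (sum-cong-≋ {x = λ s → ε ^ toℕ v * term I (punchIn v s)} tail-term) ⟩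
    sum (term J) ∎)
    where
    I J : Matrix (suc (suc k))
    I r = insertAt (C r) v (x r)
    J r = x r Vector.∷ C r

    head-term : ε ^ toℕ v * term I v ≈ term J zero
    head-term = begin
      ε ^ toℕ v * (ε ^ toℕ v * I zero v * det (minor I v))
        ≈⟨ *-solve 4 (λ e f x d → (e :* ((f :* x) :* d)) :≈ (((e :* f) :* x) :* d)) ≈-refl _ _ _ _ ⟩
      ε ^ toℕ v * ε ^ toℕ v * I zero v * det (minor I v)
        ≈⟨ *-cong (*-cong (ε^i*ε^i≈1 (toℕ v)) (≈-reflexive (Vector.insertAt-lookup (C zero) v (x zero))))
             (det-cong λ r s → ≈-reflexive (Vector.insertAt-punchIn (C (suc r)) v (x (suc r)) s)) ⟩
      term J zero ∎

    tail-term : ∀ s → ε ^ toℕ v * term I (punchIn v s) ≈ term J (suc s)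
    tail-term s = begin
      ε ^ toℕ v * (ε ^ toℕ (punchIn v s) * I zero (punchIn v s) * det (minor I (punchIn v s)))
        ≈⟨ *-congˡ (*-cong (*-congˡ (≈-reflexive (Vector.insertAt-punchIn (C zero) v (x zero) s)))
             (det-cong λ r t → ≈-reflexive (insertAt-punchIn-punchIn (C (suc r)) v (x (suc r)) s t))) ⟩
      ε ^ toℕ v * (ε ^ toℕ (punchIn v s) * C zero s * D)
        ≈⟨ *-solve 4 (λ e f x d → (e :* ((f :* x) :* d)) :≈ ((e :* f) :* (x :* d))) ≈-refl _ _ _ _ ⟩
      ε ^ toℕ v * ε ^ toℕ (punchIn v s) * (C zero s * D)
        ≈⟨ *-congʳ (sign-cross v s) ⟩
      ε ^ suc (toℕ s) * ε ^ toℕ (cross v s) * (C zero s * D)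
        ≈⟨ *-solve 4 (λ e f x d → ((e :* f) :* (x :* d)) :≈ ((e :* x) :* (f :* d))) ≈-refl _ _ _ _ ⟩
      ε ^ suc (toℕ s) * C zero s * (ε ^ toℕ (cross v s) * D)
        ≈⟨ *-congˡ (≈-trans (det-cong λ r t → ≈-reflexive (minor-∷ x C s r t))
             (det-insertAt (x ∘ suc) (λ r → C (suc r) ∘ punchIn s) (cross v s))) ⟨
      term J (suc s) ∎
      where D = det (λ r → insertAt (C (suc r) ∘ punchIn s) (cross v s) (x (suc r)))

  det-insertAt′ : ∀ {k} (x : Fin (suc k) → Carrier) (C : Fin (suc k) → Vector Carrier k) v →
    det (λ r → insertAt (C r) v (x r)) ≈ ε ^ toℕ v * det (λ r → x r Vector.∷ C r)
  det-insertAt′ x C v = ≈-sym (begin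
    ε ^ toℕ v * det (λ r → x r Vector.∷ C r) ≈⟨ *-congˡ (det-insertAt x C v) ⟩
    ε ^ toℕ v * (ε ^ toℕ v * D)              ≈⟨ *-assoc _ _ _ ⟨
    ε ^ toℕ v * ε ^ toℕ v * D                ≈⟨ *-congʳ (ε^i*ε^i≈1 (toℕ v)) ⟩
    1# * D                                   ≈⟨ *-identityˡ D ⟩
    D                                        ∎)
    where D = det (λ r → insertAt (C r) v (x r))

  -- Additivity in the first column is enough, since `det-insertAt` carries any column there.
  det-∷-+ : ∀ {k} (x y : Fin (suc k) → Carrier) (C : Fin (suc k) → Vector Carrier k) →
    det (λ r → (x r + y r) Vector.∷ C r) ≈ det (λ r → x r Vector.∷ C r) + det (λ r → y r Vector.∷ C r)
  det-∷-+ {zero}  x y C = begin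
    1# * (x zero + y zero) * 1# + 0#                      ≈⟨ +-identityʳ _ ⟩
    1# * (x zero + y zero) * 1#                           ≈⟨ *-congʳ (distribˡ _ _ _) ⟩
    (1# * x zero + 1# * y zero) * 1#                      ≈⟨ distribʳ _ _ _ ⟩
    1# * x zero * 1# + 1# * y zero * 1#                   ≈⟨ +-cong (+-identityʳ _) (+-identityʳ _) ⟨
    (1# * x zero * 1# + 0#) + (1# * y zero * 1# + 0#)     ∎
  det-∷-+ {suc k} x y C = begin
    term X+Y zero + sum (term X+Y ∘ suc)
      ≈⟨ +-cong (≈-trans (*-congʳ (distribˡ _ _ _)) (distribʳ _ _ _))
           (sum-cong-≋ {x = term X+Y ∘ suc} {y = λ s → term X (suc s) + term Y (suc s)} tail-term) ⟩
    (term X zero + term Y zero) + sum (λ s → term X (suc s) + term Y (suc s))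
      ≈⟨ +-congˡ (∑-distrib-+ (term X ∘ suc) (term Y ∘ suc)) ⟩
    (term X zero + term Y zero) + (sum (term X ∘ suc) + sum (term Y ∘ suc))
      ≈⟨ +-solve 4 (λ a b c d → ((a :+ b) :+ (c :+ d)) := ((a :+ c) :+ (b :+ d))) ≈-refl _ _ _ _ ⟩
    sum (term X) + sum (term Y) ∎
    where
    X Y X+Y : Matrix (suc (suc k))
    X r   = x r Vector.∷ C r
    Y r   = y r Vector.∷ C r
    X+Y r = (x r + y r) Vector.∷ C r

    det-minor : ∀ z s → det (minor (λ r → z r Vector.∷ C r) (suc s)) ≈
                        det (λ r → z (suc r) Vector.∷ (C (suc r) ∘ punchIn s))
    det-minor z s = det-cong λ r t → ≈-reflexive (minor-∷ z C s r t)

    tail-term : ∀ s → term X+Y (suc s) ≈ term X (suc s) + term Y (suc s)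
    tail-term s = ≈-trans
      (*-congˡ (≈-trans (det-minor (λ r → x r + y r) s) (≈-trans (det-∷-+ (x ∘ suc) (y ∘ suc) (λ r → C (suc r) ∘ punchIn s))
        (+-cong (≈-sym (det-minor x s)) (≈-sym (det-minor y s))))))
      (distribˡ _ _ _)

  -- The matrix I - P, where P is the matrix of the partial map that sends `i` to the `j` with
  -- `g i ≡ x j`. A vertex whose `g i` lies outside the image of `x` has a unit row.
  functional : ∀ {n k} → (Fin k → Fin n) → (Fin k → Fin n) → Matrix k
  functional x g i j = [[ i Fin.≟ j ]] + - [[ g i Fin.≟ x j ]]

  [[]]-suc : ∀ {k} (r s : Fin k) → [[ suc r Fin.≟ suc s ]] ≈ [[ r Fin.≟ s ]]
  [[]]-suc r s = [[]]-cong (suc r Fin.≟ suc s) (r Fin.≟ s) Fin.suc-injective (cong suc)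

  x+-x≈0 : ∀ {x y} → x ≈ y → x + - y ≈ 0#
  x+-x≈0 eq = ≈-trans (+-congʳ eq) (-‿inverseʳ _)

  x+-0≈x : ∀ {x y} → y ≈ 0# → x + - y ≈ x
  x+-0≈x eq = ≈-trans (+-congˡ (≈-trans (-‿cong eq) -0#≈0#)) (+-identityʳ _)

  term-zero : ∀ {k} (A : Matrix (suc k)) j → A zero j ≈ 0# → term A j ≈ 0#
  term-zero A j eq = ≈-trans (*-congʳ (≈-trans (*-congˡ eq) (zeroʳ _))) (zeroˡ _)

  det-loop : ∀ {n k} (x g : Fin (suc k) → Fin n) → (∀ {i j} → x i ≡ x j → i ≡ j) →
             g zero ≡ x zero → det (functional x g) ≈ 0#
  det-loop x g inj eq = sum-zero λ j → term-zero (functional x g) j (x+-x≈0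
    ([[]]-cong (zero Fin.≟ j) (g zero Fin.≟ x j)
      (λ 0≡j → trans eq (cong x 0≡j)) (λ g≡ → inj (trans (sym eq) g≡))))

  module _ {n k} (x g : Fin (suc k) → Fin n) (inj : ∀ {i j} → x i ≡ x j → i ≡ j)
           (g≢ : g zero ≢ x zero) where

    private
      N = functional x g
      N′ = functional (x ∘ suc) (contract x g)

      suc≢zero : ∀ {s : Fin k} → x (suc s) ≢ x zero
      suc≢zero eq = case inj eq of λ ()

      term-zero≈ : term N zero ≈ det (minor N zero)
      term-zero≈ = begin
        1# * (1# + - [[ g zero Fin.≟ x zero ]]) * det (minor N zero)
          ≈⟨ *-congʳ (≈-trans (*-identityˡ _) (x+-0≈x ([[]]-no (g zero Fin.≟ x zero) g≢))) ⟩
        1# * det (minor N zero) ≈⟨ *-identityˡ _ ⟩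
        det (minor N zero)      ∎

      unchanged : ∀ r s → g zero ≢ x (suc s) → N (suc r) (suc s) ≈ N′ r s
      unchanged r s ne = +-cong ([[]]-suc r s) (-‿cong ([[]]-cong
        (g (suc r) Fin.≟ x (suc s)) (contract x g r Fin.≟ x (suc s))
        (λ eq → trans (contract-no x g (λ eq′ → suc≢zero (trans (sym eq) eq′))) eq) to))
        where
        to : contract x g r ≡ x (suc s) → g (suc r) ≡ x (suc s)
        to eq with g (suc r) Fin.≟ x zero
        ... | yes _ = contradiction eq ne
        ... | no  _ = eq

      merged : ∀ r v → g zero ≡ x (suc v) → N (suc r) (suc v) + N (suc r) zero ≈ N′ r v
      merged r v eq = begin
        ([[ suc r Fin.≟ suc v ]] + - [[ g (suc r) Fin.≟ x (suc v) ]]) + (0# + - [[ g (suc r) Fin.≟ x zero ]])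
          ≈⟨ +-cong (+-congʳ ([[]]-suc r v)) (+-identityˡ _) ⟩
        ([[ r Fin.≟ v ]] + - [[ g (suc r) Fin.≟ x (suc v) ]]) + - [[ g (suc r) Fin.≟ x zero ]]
          ≈⟨ +-assoc _ _ _ ⟩
        [[ r Fin.≟ v ]] + (- [[ g (suc r) Fin.≟ x (suc v) ]] + - [[ g (suc r) Fin.≟ x zero ]])
          ≈⟨ +-congˡ indicator ⟩
        N′ r v ∎
        where
        indicator : - [[ g (suc r) Fin.≟ x (suc v) ]] + - [[ g (suc r) Fin.≟ x zero ]] ≈
                    - [[ contract x g r Fin.≟ x (suc v) ]]
        indicator with g (suc r) Fin.≟ x zero
        ... | yes eq₀ = ≈-trans (+-cong
                (≈-trans (-‿cong ([[]]-no (g (suc r) Fin.≟ x (suc v)) (λ eq′ → suc≢zero (trans (sym eq′) eq₀)))) -0#≈0#)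
                (-‿cong (≈-sym ([[]]-yes (g zero Fin.≟ x (suc v)) eq))))
              (+-identityˡ _)
        ... | no _ = x+-0≈x ≈-refl

    -- Adding column zero to column v turns row zero into a unit vector.
    det-contract : det N ≈ det N′
    det-contract with any? (λ v → g zero Fin.≟ x (suc v))
    ... | no none = begin
      term N zero + sum (term N ∘ suc)
        ≈⟨ +-congˡ (sum-zero λ s → term-zero N (suc s) (x+-x≈0
             (≈-sym ([[]]-no (g zero Fin.≟ x (suc s)) λ eq → none (s , eq))))) ⟩
      term N zero + 0#   ≈⟨ +-identityʳ _ ⟩
      term N zero        ≈⟨ term-zero≈ ⟩
      det (minor N zero) ≈⟨ det-cong (λ r s → unchanged r s λ eq → none (s , eq)) ⟩
      det N′             ∎
    ... | yes (v , eq) = merge N N′ v term-zero≈ tail-terms entry others columns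
      where
      entry : N zero (suc v) ≈ ε
      entry = ≈-trans (+-identityˡ _) (-‿cong ([[]]-yes (g zero Fin.≟ x (suc v)) eq))

      tail-terms : ∀ s → s ≢ v → term N (suc s) ≈ 0#
      tail-terms s s≢v = term-zero N (suc s) (x+-x≈0 (≈-sym ([[]]-no (g zero Fin.≟ x (suc s))
        λ eq′ → s≢v (Fin.suc-injective (inj (trans (sym eq′) eq))))))

      others : ∀ r s → s ≢ v → N (suc r) (suc s) ≈ N′ r s
      others r s s≢v = unchanged r s λ eq′ → s≢v (Fin.suc-injective (inj (trans (sym eq′) eq)))

      columns : ∀ r → N (suc r) (suc v) + N (suc r) zero ≈ N′ r v
      columns r = merged r v eq

      -- The matrices are made variables so that `k` can be matched as a successor, as `removeAt`
      -- requires.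
      merge : ∀ {k} (N : Matrix (suc k)) (N′ : Matrix k) v → term N zero ≈ det (minor N zero) →
              (∀ s → s ≢ v → term N (suc s) ≈ 0#) → N zero (suc v) ≈ ε →
              (∀ r s → s ≢ v → N (suc r) (suc s) ≈ N′ r s) →
              (∀ r → N (suc r) (suc v) + N (suc r) zero ≈ N′ r v) → det N ≈ det N′
      merge {suc k} N N′ v term₀ terms entry others columns = begin
        term N zero + sum (term N ∘ suc)
          ≈⟨ +-cong term₀ (sum-only v terms) ⟩
        det B + term N (suc v)
          ≈⟨ +-cong (≈-trans (det-cong λ r s → ≈-reflexive (sym (Vector.insertAt-removeAt (B r) v s)))
               (det-insertAt′ y C v)) last-term ⟩
        ε ^ toℕ v * det (λ r → y r Vector.∷ C r) + ε ^ toℕ v * det (λ r → z r Vector.∷ C r)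
          ≈⟨ distribˡ _ _ _ ⟨
        ε ^ toℕ v * (det (λ r → y r Vector.∷ C r) + det (λ r → z r Vector.∷ C r))
          ≈⟨ *-congˡ (det-∷-+ y z C) ⟨
        ε ^ toℕ v * det (λ r → (y r + z r) Vector.∷ C r)
          ≈⟨ det-insertAt′ (λ r → y r + z r) C v ⟨
        det (λ r → insertAt (C r) v (y r + z r))
          ≈⟨ det-cong entries ⟩
        det N′ ∎
        where
        B = minor N zero
        y z : Fin (suc k) → Carrier
        y r = B r v
        z r = N (suc r) zero
        C : Fin (suc k) → Vector Carrier k
        C r = removeAt (B r) v

        -- The entry -1 cancels the extra sign of index `suc v` over `v`, and the minor already has
        -- column `zero` of `N` in front. Both surviving terms thus carry the same sign and differ
        -- only in their first column.
        last-term : term N (suc v) ≈ ε ^ toℕ v * det (λ r → z r Vector.∷ C r)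
        last-term = begin
          ε * ε ^ toℕ v * N zero (suc v) * det (minor N (suc v))
            ≈⟨ *-cong (*-congˡ entry) (det-cong {A = minor N (suc v)} {B = λ r → z r Vector.∷ C r}
                λ { r zero → ≈-refl ; r (suc s) → ≈-refl }) ⟩
          ε * ε ^ toℕ v * ε * D ≈⟨ *-solve 3 (λ e f d → (((e :* f) :* e) :* d) :≈ ((e :* e) :* (f :* d))) ≈-refl _ _ _ ⟩
          ε * ε * (ε ^ toℕ v * D) ≈⟨ *-congʳ ε*ε≈1 ⟩
          1# * (ε ^ toℕ v * D)    ≈⟨ *-identityˡ _ ⟩
          ε ^ toℕ v * D           ∎
          where D = det (λ r → z r Vector.∷ C r)

        entries : ∀ r s → insertAt (C r) v (y r + z r) s ≈ N′ r s
        entries r s with s Fin.≟ v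
        ... | yes refl = ≈-trans (≈-reflexive (Vector.insertAt-lookup (C r) v (y r + z r))) (columns r)
        ... | no s≢v   = ≈-trans (≈-reflexive (trans
                (cong (insertAt (C r) v (y r + z r)) (sym (Fin.punchIn-punchOut v≢s)))
                (trans (Vector.insertAt-punchIn (C r) v (y r + z r) (punchOut v≢s))
                  (cong (B r) (Fin.punchIn-punchOut v≢s)))))
              (others r s s≢v)
          where
          v≢s : v ≢ s
          v≢s = s≢v ∘ sym

  -- Merging `zero` into its successor keeps `S` closed, and nonempty as well: if `zero` is in `S`,
  -- so is its successor. Since no such `S` exists on zero vertices, a loop at `zero` must turn up,
  -- and its row vanishes.
  det-closed : ∀ {n k} (x g : Fin k → Fin n) → (∀ {i j} → x i ≡ x j → i ≡ j) →
    (S : Pred (Fin k) 0ℓ) → ∃ S → (∀ {i} → S i → ∃ λ j → g i ≡ x j × S j) →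
    det (functional x g) ≈ 0#
  det-closed {k = suc k} x g inj S (i , i∈S) closed = case g zero Fin.≟ x zero of λ where
      (yes eq) → det-loop x g inj eq
      (no g≢)  → ≈-trans (det-contract x g inj g≢) (det-closed (x ∘ suc) (contract x g)
        (Fin.suc-injective ∘ inj) (S ∘ suc) (nonempty g≢ i i∈S) (closed′ g≢))
    where
    image : g zero ≢ x zero → S zero → ∃ λ j → g zero ≡ x (suc j) × S (suc j)
    image g≢ s with closed s
    ... | zero  , eq , _  = contradiction eq g≢
    ... | suc j , eq , s′ = j , eq , s′

    nonempty : g zero ≢ x zero → ∀ i → S i → ∃ (S ∘ suc)
    nonempty g≢ zero    s = let j , _ , s′ = image g≢ s in j , s′
    nonempty g≢ (suc i) s = i , s

    closed′ : g zero ≢ x zero → ∀ {r} → S (suc r) → ∃ λ j → contract x g r ≡ x (suc j) × S (suc j)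
    closed′ g≢ s with closed s
    ... | zero  , eq , s₀ = let j , eq′ , s′ = image g≢ s₀ in j , trans (contract-yes x g eq) eq′ , s′
    ... | suc j , eq , s′ = j , trans (contract-no x g λ eq′ → case inj (trans (sym eq) eq′) of λ ()) eq , s′

  det-reach : ∀ {n k} (x g : Fin k → Fin n) → (∀ {i j} → x i ≡ x j → i ≡ j) →
              (∀ i → Reach x g i) → det (functional x g) ≈ 1#
  det-reach {k = zero}  x g inj r = ≈-refl
  det-reach {k = suc k} x g inj r = case g zero Fin.≟ x zero of λ where
    (yes eq) → contradiction (r zero) (loop-unreachable x g inj eq)
    (no g≢)  → ≈-trans (det-contract x g inj g≢) (det-reach (x ∘ suc) (contract x g)
      (Fin.suc-injective ∘ inj) (reach-contract x g inj g≢ ∘ r ∘ suc))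

-- Finite subsets: images, cardinalities, enumerations

∈⟪⟫⁺ : ∀ {n} {P : Fin n → Set} (P? : Decidable P) {i} → P i → i ∈ ⟪ P? ⟫
∈⟪⟫⁺ P? {i} p = Vec.lookup⇒[]= i _ (trans (Vec.lookup∘tabulate _ i) (dec-true (P? i) p))

∈⟪⟫⁻ : ∀ {n} {P : Fin n → Set} (P? : Decidable P) {i} → i ∈ ⟪ P? ⟫ → P i
∈⟪⟫⁻ P? {i} h with P? i | trans (sym (Vec.lookup∘tabulate (λ i → does (P? i)) i)) (Vec.[]=⇒lookup h)
... | yes p | _ = p

-- Abstract, because its lookups would otherwise unfold to large disjunctions.
abstract

  image : ∀ {k n} → (Fin k → Fin n) → Subset n
  image f = ⟪ (λ j → any? λ i → f i Fin.≟ j) ⟫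

  ∈-image⁺ : ∀ {k n} (f : Fin k → Fin n) i → f i ∈ image f
  ∈-image⁺ f i = ∈⟪⟫⁺ (λ j → any? λ i → f i Fin.≟ j) (i , refl)

  ∈-image⁻ : ∀ {k n} (f : Fin k → Fin n) {j} → j ∈ image f → ∃ λ i → f i ≡ j
  ∈-image⁻ f = ∈⟪⟫⁻ (λ j → any? λ i → f i Fin.≟ j)

p─q∌ : ∀ {n x} (p q : Subset n) → x ∈ p ─ q → x ∉ q
p─q∌ (s ∷ p) (outside ∷ q) (Vec.there h) (Vec.there h′) = p─q∌ p q h h′
p─q∌ (s ∷ p) (inside  ∷ q) (Vec.there h) (Vec.there h′) = p─q∌ p q h h′

∣p─q∣ : ∀ {n} (p q : Subset n) → q ⊆ p → ∣ p ─ q ∣ ≡ ∣ p ∣ ∸ ∣ q ∣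
∣p─q∣ []            []            q⊆p = refl
∣p─q∣ (inside  ∷ p) (inside  ∷ q) q⊆p = ∣p─q∣ p q (Sub.drop-∷-⊆ q⊆p)
∣p─q∣ (inside  ∷ p) (outside ∷ q) q⊆p = trans (cong suc (∣p─q∣ p q q⊆p′)) (sym (ℕ.+-∸-assoc 1 (Sub.p⊆q⇒∣p∣≤∣q∣ q⊆p′)))
  where
  q⊆p′ : q ⊆ p
  q⊆p′ = Sub.drop-∷-⊆ q⊆p
∣p─q∣ (outside ∷ p) (inside  ∷ q) q⊆p = case q⊆p Vec.here of λ ()
∣p─q∣ (outside ∷ p) (outside ∷ q) q⊆p = ∣p─q∣ p q (Sub.drop-∷-⊆ q⊆p)

-- The map may depend on the membership proof, as does the half-edge chosen to cover a vertex. The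
-- induction removes the image of each element of `p` from `q`.
injection⇒∣p∣≤∣q∣ : ∀ {a b} (p : Subset a) (q : Subset b) (f : ∀ {i} → i ∈ p → Fin b) →
  (∀ {i} (i∈ : i ∈ p) → f i∈ ∈ q) → (∀ {i j} (i∈ : i ∈ p) (j∈ : j ∈ p) → f i∈ ≡ f j∈ → i ≡ j) →
  ∣ p ∣ ℕ.≤ ∣ q ∣
injection⇒∣p∣≤∣q∣ []            q f f∈ inj = z≤n
injection⇒∣p∣≤∣q∣ (outside ∷ p) q f f∈ inj = injection⇒∣p∣≤∣q∣ p q (λ i∈ → f (Vec.there i∈))
  (λ i∈ → f∈ (Vec.there i∈)) (λ i∈ j∈ eq → Fin.suc-injective (inj (Vec.there i∈) (Vec.there j∈) eq))
injection⇒∣p∣≤∣q∣ (inside ∷ p)  q f f∈ inj = ℕ.≤-<-trans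
  (injection⇒∣p∣≤∣q∣ p (q - f Vec.here) (λ i∈ → f (Vec.there i∈))
    (λ i∈ → Sub.x∈p∧x≢y⇒x∈p-y (f∈ (Vec.there i∈)) λ eq → case inj (Vec.there i∈) Vec.here eq of λ ())
    (λ i∈ j∈ eq → Fin.suc-injective (inj (Vec.there i∈) (Vec.there j∈) eq)))
  (Sub.x∈p⇒∣p-x∣<∣p∣ (f∈ Vec.here))

elements∈ : ∀ {n} (X : Subset n) i → lookup (elements X) i ∈ X
elements∈ (inside  ∷ X) zero    = Vec.here
elements∈ (inside  ∷ X) (suc i) = subst (_∈ inside ∷ X) (sym (Vec.lookup-map i suc (elements X))) (Vec.there (elements∈ X i))
elements∈ (outside ∷ X) i       = subst (_∈ outside ∷ X) (sym (Vec.lookup-map i suc (elements X))) (Vec.there (elements∈ X i))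

elements-injective : ∀ {n} (X : Subset n) {i j} → lookup (elements X) i ≡ lookup (elements X) j → i ≡ j
elements-injective (inside ∷ X) {zero}  {zero}  eq = refl
elements-injective (inside ∷ X) {zero}  {suc j} eq = case trans eq (Vec.lookup-map j suc (elements X)) of λ ()
elements-injective (inside ∷ X) {suc i} {zero}  eq = case trans (sym (Vec.lookup-map i suc (elements X))) eq of λ ()
elements-injective (inside ∷ X) {suc i} {suc j} eq = cong suc (elements-injective X (Fin.suc-injective
  (trans (sym (Vec.lookup-map i suc (elements X))) (trans eq (Vec.lookup-map j suc (elements X))))))
elements-injective (outside ∷ X) {i} {j} eq = elements-injective X (Fin.suc-injective
  (trans (sym (Vec.lookup-map i suc (elements X))) (trans eq (Vec.lookup-map j suc (elements X)))))

elements-surjective : ∀ {n} (X : Subset n) {v} → v ∈ X → ∃ λ i → lookup (elements X) i ≡ v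
elements-surjective (inside  ∷ X) Vec.here      = zero , refl
elements-surjective (inside  ∷ X) (Vec.there h) = let i , eq = elements-surjective X h in
  suc i , trans (Vec.lookup-map i suc (elements X)) (cong suc eq)
elements-surjective (outside ∷ X) (Vec.there h) = let i , eq = elements-surjective X h in
  i , trans (Vec.lookup-map i suc (elements X)) (cong suc eq)

subsets-! : ∀ m → Unique (subsets m)
subsets-! zero    = [] ∷ []
subsets-! (suc m) = Unique.++⁺ (Unique.map⁺ (λ { refl → refl }) (subsets-! m)) (Unique.map⁺ (λ { refl → refl }) (subsets-! m))
  λ { (p , q) → case ∈ᴸ.∈-map⁻ (inside ∷_) p of λ where
      (_ , _ , refl) → case ∈ᴸ.∈-map⁻ (outside ∷_) q of λ { (_ , _ , ()) } }

∈-subsets : ∀ {m} (M : Subset m) → M ∈ᴸ subsets m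
∈-subsets []            = here refl
∈-subsets (inside  ∷ M) = ∈ᴸ.∈-++⁺ˡ (∈ᴸ.∈-map⁺ (inside ∷_) (∈-subsets M))
∈-subsets (outside ∷ M) = ∈ᴸ.∈-++⁺ʳ _ (∈ᴸ.∈-map⁺ (outside ∷_) (∈-subsets M))

fromVec : ∀ {q k} → Vec (Fin q) k → Subset q
fromVec []      = ⊥
fromVec (h ∷ φ) = ⁅ h ⁆ ∪ fromVec φ

∈-fromVec⁺ : ∀ {q k} (φ : Vec (Fin q) k) i → lookup φ i ∈ fromVec φ
∈-fromVec⁺ (h ∷ φ) zero    = Sub.x∈p∪q⁺ (inj₁ (Sub.x∈⁅x⁆ h))
∈-fromVec⁺ (h ∷ φ) (suc i) = Sub.x∈p∪q⁺ (inj₂ (∈-fromVec⁺ φ i))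

∈-fromVec⁻ : ∀ {q k} (φ : Vec (Fin q) k) {h} → h ∈ fromVec φ → ∃ λ i → lookup φ i ≡ h
∈-fromVec⁻ []      h∈ = contradiction h∈ Sub.∉⊥
∈-fromVec⁻ (h ∷ φ) h∈ with Sub.x∈p∪q⁻ ⁅ h ⁆ (fromVec φ) h∈
... | inj₁ h∈′ = zero , sym (Sub.x∈⁅y⁆⇒x≡y h h∈′)
... | inj₂ h∈′ = let i , eq = ∈-fromVec⁻ φ h∈′ in suc i , eq

-- The cyclic successor

toℕ-next : ∀ {l} (i : Fin (3 ℕ.+ l)) → toℕ (next i) ≡ suc (toℕ i) % (3 ℕ.+ l)
toℕ-next {l} i = Fin.toℕ-fromℕ< (m%n<n (suc (toℕ i)) (3 ℕ.+ l))

next-fromℕ : ∀ l → next (fromℕ (2 ℕ.+ l)) ≡ zero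
next-fromℕ l = Fin.toℕ-injective (trans (toℕ-next (fromℕ (2 ℕ.+ l)))
  (trans (cong (λ k → suc k % (3 ℕ.+ l)) (Fin.toℕ-fromℕ (2 ℕ.+ l))) (n%n≡0 (3 ℕ.+ l))))

next-inject₁ : ∀ {l} (i : Fin (2 ℕ.+ l)) → next (inject₁ i) ≡ suc i
next-inject₁ {l} i = Fin.toℕ-injective (trans (toℕ-next (inject₁ i))
  (trans (cong (λ k → suc k % (3 ℕ.+ l)) (Fin.toℕ-inject₁ i)) (m<n⇒m%n≡m (s≤s (Fin.toℕ<n i)))))

next-injective : ∀ {l} {i j : Fin (3 ℕ.+ l)} → next i ≡ next j → i ≡ j
next-injective {l} {i} {j} eq with view i | view j
... | ‵fromℕ      | ‵fromℕ      = refl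
... | ‵fromℕ      | ‵inject₁ j′ = case trans (sym (next-fromℕ l)) (trans eq (next-inject₁ j′)) of λ ()
... | ‵inject₁ i′ | ‵fromℕ      = case trans (sym (next-fromℕ l)) (trans (sym eq) (next-inject₁ i′)) of λ ()
... | ‵inject₁ i′ | ‵inject₁ j′ =
  cong inject₁ (Fin.suc-injective (trans (sym (next-inject₁ i′)) (trans eq (next-inject₁ j′))))

next-surjective : ∀ {l} (i : Fin (3 ℕ.+ l)) → ∃ λ j → next j ≡ i
next-surjective zero    = fromℕ _ , next-fromℕ _
next-surjective (suc i) = inject₁ i , next-inject₁ i

next≢ : ∀ {l} (i : Fin (3 ℕ.+ l)) → next i ≢ i
next≢ {l} i eq with view i
... | ‵fromℕ      = case trans (sym (next-fromℕ l)) eq of λ ()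
... | ‵inject₁ i′ = ℕ.1+n≢n (trans (cong toℕ (trans (sym (next-inject₁ i′)) eq)) (Fin.toℕ-inject₁ i′))

-- Here length at least 3 enters: from the last index two steps lead to index 1, which is not the
-- last. This is what keeps the edges around a cycle distinct.
next-next≢ : ∀ {l} (i : Fin (3 ℕ.+ l)) → next (next i) ≢ i
next-next≢ {l} i eq with view i
... | ‵fromℕ      = case trans (sym (next-inject₁ {l} zero)) (trans (cong next (sym (next-fromℕ l))) eq) of λ ()
... | ‵inject₁ i′ = helper (suc i′) refl (trans (cong next (sym (next-inject₁ i′))) eq)
  where
  helper : ∀ j → j ≡ suc i′ → next j ≢ inject₁ i′
  helper j j≡ eq′ with view j
  ... | ‵fromℕ      = case trans j≡ (cong suc (Fin.inject₁-injective (trans (sym eq′) (trans (next-fromℕ l) refl)))) of λ ()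
  ... | ‵inject₁ j′ = ℕ.m≢1+m+n (toℕ i′) (trans (sym (Fin.toℕ-inject₁ i′)) (trans (cong toℕ (trans (sym eq′) (next-inject₁ j′)))
                        (cong suc (trans (sym (Fin.toℕ-inject₁ j′)) (trans (cong toℕ j≡) (ℕ.+-comm 1 (toℕ i′)))))))

-- From `i` up to the last index, around to `zero`, and up again to `j`.
cyclic : ∀ {l} (P : Pred (Fin (3 ℕ.+ l)) 0ℓ) → (∀ i → P i → P (next i)) → ∀ {i} j → P i → P j
cyclic {l} P step {i} j p = <-weakInduction P (subst P (next-fromℕ l) (step _ (top i p)))
  (λ i → subst P (next-inject₁ i) ∘ step (inject₁ i)) j
  where
  top : ∀ i → P i → P (fromℕ (2 ℕ.+ l))
  top = >-weakInduction (λ i → P i → P (fromℕ (2 ℕ.+ l))) id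
    (λ i up → up ∘ subst P (next-inject₁ i) ∘ step (inject₁ i))

cyclic⁻ : ∀ {l} (P : Pred (Fin (3 ℕ.+ l)) 0ℓ) → (∀ i → P (next i) → P i) → ∀ {i} j → P i → P j
cyclic⁻ {l} P step {i} j p = >-weakInduction P (step _ (subst P (sym (next-fromℕ l)) (bottom i p)))
  (λ i → step (inject₁ i) ∘ subst P (sym (next-inject₁ i))) j
  where
  bottom : ∀ i → P i → P zero
  bottom = <-weakInduction (λ i → P i → P zero) id
    (λ i down → down ∘ step (inject₁ i) ∘ subst P (sym (next-inject₁ i)))

-- Half-edges and saturating matchings

-- The edges of the subdivision are the half-edges of G: h joins the vertex end h to edge h *.
module HalfEdges {n m : ℕ} (G : Graph n m) where

  Half : Set
  Half = Fin (m ℕ.+ m)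

  end other : Half → Fin n
  end   h = [ lo G , hi G ]′ (splitAt m h)
  other h = [ hi G , lo G ]′ (splitAt m h)

  edge : Half → Fin m
  edge h = [ id , id ]′ (splitAt m h)

  lo-subdivision : ∀ h → lo (subdivision G) h ≡ end h ↑ˡ m
  lo-subdivision h with splitAt m h
  ... | inj₁ _ = refl
  ... | inj₂ _ = refl

  hi-subdivision : ∀ h → hi (subdivision G) h ≡ n ↑ʳ edge h
  hi-subdivision h with splitAt m h
  ... | inj₁ _ = refl
  ... | inj₂ _ = refl

  end≢other : ∀ h → end h ≢ other h
  end≢other h eq with splitAt m h
  ... | inj₁ e = Fin.<⇒≢ (lo<hi G e) eq
  ... | inj₂ e = Fin.<⇒≢ (lo<hi G e) (sym eq)

  half-ext : ∀ {h h′} → end h ≡ end h′ → edge h ≡ edge h′ → h ≡ h′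
  half-ext {h} {h′} p q = trans (sym (Fin.join-splitAt m m h))
    (trans (cong (Fin.join m m) (go (splitAt m h) (splitAt m h′) p q)) (Fin.join-splitAt m m h′))
    where
    go : ∀ s t → [ lo G , hi G ]′ s ≡ [ lo G , hi G ]′ t → [ id , id ]′ s ≡ [ id , id ]′ t → s ≡ t
    go (inj₁ e) (inj₁ e′) p q = cong inj₁ q
    go (inj₁ e) (inj₂ e′) p refl = contradiction p (Fin.<⇒≢ (lo<hi G e))
    go (inj₂ e) (inj₁ e′) p refl = contradiction (sym p) (Fin.<⇒≢ (lo<hi G e))
    go (inj₂ e) (inj₂ e′) p q = cong inj₂ q

  joins : ∀ h → Joins G (edge h) (end h) (other h)
  joins h with splitAt m h
  ... | inj₁ _ = inj₁ (refl , refl)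
  ... | inj₂ _ = inj₂ (refl , refl)

  halfOf : ∀ {e u v} → Joins G e u v → ∃ λ h → end h ≡ u × other h ≡ v × edge h ≡ e
  halfOf {e} (inj₁ (p , q)) with eq ← Fin.splitAt-↑ˡ m e m = e ↑ˡ m ,
    trans (cong [ lo G , hi G ]′ eq) p , trans (cong [ hi G , lo G ]′ eq) q , cong [ id , id ]′ eq
  halfOf {e} (inj₂ (p , q)) with eq ← Fin.splitAt-↑ʳ m m e = m ↑ʳ e ,
    trans (cong [ lo G , hi G ]′ eq) q , trans (cong [ hi G , lo G ]′ eq) p , cong [ id , id ]′ eq

  joins-swap : ∀ {e u v} → Joins G e u v → Joins G e v u
  joins-swap (inj₁ p) = inj₂ p
  joins-swap (inj₂ p) = inj₁ p

  joins-unique : ∀ {e f u v} → Joins G e u v → Joins G f u v → e ≡ f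
  joins-unique (inj₁ (p , q)) (inj₁ (r , s)) = simple G (trans p (sym r)) (trans q (sym s))
  joins-unique (inj₂ (p , q)) (inj₂ (r , s)) = simple G (trans p (sym r)) (trans q (sym s))
  joins-unique {e} {f} (inj₁ (p , q)) (inj₂ (r , s)) =
    contradiction (subst₂ Fin._<_ (trans p (sym s)) (trans q (sym r)) (lo<hi G e)) (Fin.<-asym (lo<hi G f))
  joins-unique {e} {f} (inj₂ (p , q)) (inj₁ (r , s)) =
    contradiction (subst₂ Fin._<_ (trans p (sym s)) (trans q (sym r)) (lo<hi G e)) (Fin.<-asym (lo<hi G f))

  joins-ends : ∀ {e u v u′ v′} → Joins G e u v → Joins G e u′ v′ → (u ≡ u′ × v ≡ v′) ⊎ (u ≡ v′ × v ≡ u′)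
  joins-ends (inj₁ (refl , refl)) (inj₁ (refl , refl)) = inj₁ (refl , refl)
  joins-ends (inj₁ (refl , refl)) (inj₂ (refl , refl)) = inj₂ (refl , refl)
  joins-ends (inj₂ (refl , refl)) (inj₁ (refl , refl)) = inj₂ (refl , refl)
  joins-ends (inj₂ (refl , refl)) (inj₂ (refl , refl)) = inj₁ (refl , refl)

  same-edge : ∀ {h h′} → edge h ≡ edge h′ → (end h ≡ end h′ × other h ≡ other h′) ⊎ (end h ≡ other h′ × other h ≡ end h′)
  same-edge {h} {h′} eq = joins-ends (subst (λ e → Joins G e (end h) (other h)) eq (joins h)) (joins h′)

  private
    inSpan? : (F : Subset m) → Decidable λ v → ∃ λ e → e ∈ F × Incident G e v
    inSpan? F v = any? λ e → (e ∈? F) ×-dec incident? G e v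

  span-end : ∀ {F} h → edge h ∈ F → end h ∈ span G F
  span-end {F} h e∈F = ∈⟪⟫⁺ (inSpan? F) (edge h , e∈F , incident (joins h))
    where
    incident : ∀ {e u v} → Joins G e u v → Incident G e u
    incident (inj₁ (p , _)) = inj₁ p
    incident (inj₂ (_ , p)) = inj₂ p

  span-other : ∀ {F} h → edge h ∈ F → other h ∈ span G F
  span-other {F} h e∈F with h′ , p , _ , r ← halfOf (joins-swap (joins h)) =
    subst (_∈ span G F) p (span-end h′ (subst (_∈ F) (sym r) e∈F))

  span⁻ : ∀ {F v} → v ∈ span G F → ∃ λ h → edge h ∈ F × end h ≡ v
  span⁻ {F} v∈ with ∈⟪⟫⁻ (inSpan? F) v∈
  ... | e , e∈F , inj₁ p = let h , q , _ , r = halfOf (inj₁ (refl , refl)) in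
        h , subst (_∈ F) (sym r) e∈F , trans q p
  ... | e , e∈F , inj₂ p = let h , q , _ , r = halfOf (inj₂ (refl , refl)) in
        h , subst (_∈ F) (sym r) e∈F , trans q p

  span-mono : ∀ {F F′} → F ⊆ F′ → span G F ⊆ span G F′
  span-mono F⊆ v∈ with h , e∈ , refl ← span⁻ v∈ = span-end h (F⊆ e∈)

  span-∪ : ∀ F F′ → span G (F ∪ F′) ≡ span G F ∪ span G F′
  span-∪ F F′ = Sub.⊆-antisym to (λ v∈ → [ span-mono (Sub.p⊆p∪q F′) , span-mono (Sub.q⊆p∪q F F′) ]′
                                     (Sub.x∈p∪q⁻ _ _ v∈))
    where
    to : span G (F ∪ F′) ⊆ span G F ∪ span G F′
    to v∈ with h , e∈ , refl ← span⁻ v∈ =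
      Sub.x∈p∪q⁺ ([ inj₁ ∘ span-end h , inj₂ ∘ span-end h ]′ (Sub.x∈p∪q⁻ F F′ e∈))

  span-⊥ : span G ⊥ ≡ ⊥
  span-⊥ = Sub.Empty-unique λ (v , v∈) → let h , e∈ , _ = span⁻ v∈ in Sub.∉⊥ e∈

  -- Matchings with exactly as many edges as `Y` has vertices and with all ends in `Y`, described by
  -- covering instead of counting. In this form, adding or removing an orientation of a cycle
  -- involves no cardinalities.
  record Saturating (Y : Subset n) (M : Subset (m ℕ.+ m)) : Set where
    field
      end∈     : ∀ {h} → h ∈ M → end h ∈ Y
      end-inj  : ∀ {h h′} → h ∈ M → h′ ∈ M → end h ≡ end h′ → h ≡ h′
      edge-inj : ∀ {h h′} → h ∈ M → h′ ∈ M → edge h ≡ edge h′ → h ≡ h′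
      covers   : ∀ {v} → v ∈ Y → ∃ λ h → h ∈ M × end h ≡ v

  open Saturating public

  FullMatching : Subset (m ℕ.+ m) → ℕ → Subset (m ℕ.+ m) → Set
  FullMatching E j M = M ⊆ E × IsMatching (subdivision G) M × ∣ M ∣ ≡ j

  fullMatching? : ∀ E j → Decidable (FullMatching E j)
  fullMatching? E j M = (M ⊆? E) ×-dec isMatching? (subdivision G) M ×-dec (∣ M ∣ ℕ.≟ j)

  module _ {Y : Subset n} {E M : Subset (m ℕ.+ m)} (E⇒Y : ∀ {h} → h ∈ E → end h ∈ Y) (Y⇒E : ∀ {h} → end h ∈ Y → h ∈ E) where

    fullMatching⇒saturating : FullMatching E ∣ Y ∣ M → Saturating Y M
    fullMatching⇒saturating (M⊆E , match , ∣M∣≡) = record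
      { end∈     = end∈Y
      ; end-inj  = end-inj′
      ; edge-inj = λ {h} {h′} h∈ h′∈ eq → case h Fin.≟ h′ of λ where
          (yes p) → p
          (no p)  → contradiction (inj₂ (hi-subdivision h) ,
            inj₂ (trans (hi-subdivision h′) (cong (n ↑ʳ_) (sym eq)))) (match h h′ h∈ h′∈ p (n ↑ʳ edge h))
      ; covers   = λ {v} v∈Y → case any? (λ h → (h ∈? M) ×-dec (end h Fin.≟ v)) of λ where
          (yes p)   → p
          -- If `v` were uncovered, `end` would inject `M` into the smaller set `Y - v`, although
          -- `M` has as many elements as `Y`.
          (no none) → contradiction (ℕ.≤-<-trans
            (subst (ℕ._≤ ∣ Y - v ∣) ∣M∣≡ (injection⇒∣p∣≤∣q∣ M (Y - v) (λ {h} _ → end h)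
              (λ h∈ → Sub.x∈p∧x≢y⇒x∈p-y (end∈Y h∈) (λ eq → none (_ , h∈ , eq))) end-inj′))
            (Sub.x∈p⇒∣p-x∣<∣p∣ v∈Y)) (ℕ.<-irrefl refl)
      }
      where
      end∈Y : ∀ {h} → h ∈ M → end h ∈ Y
      end∈Y h∈ = E⇒Y (M⊆E h∈)

      end-inj′ : ∀ {h h′} → h ∈ M → h′ ∈ M → end h ≡ end h′ → h ≡ h′
      end-inj′ {h} {h′} h∈ h′∈ eq = case h Fin.≟ h′ of λ where
        (yes p) → p
        (no p)  → contradiction (inj₁ (lo-subdivision h) ,
          inj₁ (trans (lo-subdivision h′) (cong (_↑ˡ m) (sym eq)))) (match h h′ h∈ h′∈ p (end h ↑ˡ m))

    saturating⇒fullMatching : Saturating Y M → FullMatching E ∣ Y ∣ M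
    saturating⇒fullMatching sat = (λ h∈ → Y⇒E (end∈ sat h∈)) , match , ℕ.≤-antisym
      (injection⇒∣p∣≤∣q∣ M Y (λ {h} _ → end h) (end∈ sat) (end-inj sat))
      (injection⇒∣p∣≤∣q∣ Y M (λ v∈ → proj₁ (covers sat v∈)) (λ v∈ → proj₁ (proj₂ (covers sat v∈)))
        λ u∈ v∈ eq → trans (sym (proj₂ (proj₂ (covers sat u∈)))) (trans (cong end eq) (proj₂ (proj₂ (covers sat v∈)))))
      where
      match : IsMatching (subdivision G) M
      match h h′ h∈ h′∈ h≢h′ v (inj₁ p , inj₁ q) = h≢h′ (end-inj sat h∈ h′∈ (Fin.↑ˡ-injective m _ _
        (trans (sym (lo-subdivision h)) (trans p (trans (sym q) (lo-subdivision h′))))))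
      match h h′ h∈ h′∈ h≢h′ v (inj₁ p , inj₂ q) = clash (trans (sym (lo-subdivision h))
        (trans p (trans (sym q) (hi-subdivision h′))))
        where
        clash : ∀ {v e} → v ↑ˡ m ≢ n ↑ʳ e
        clash {v} {e} eq = case trans (sym (Fin.splitAt-↑ˡ n v m)) (trans (cong (splitAt n) eq) (Fin.splitAt-↑ʳ n m e)) of λ ()
      match h h′ h∈ h′∈ h≢h′ v (inj₂ p , inj₁ q) = match h′ h h′∈ h∈ (h≢h′ ∘ sym) v (inj₁ q , inj₂ p)
      match h h′ h∈ h′∈ h≢h′ v (inj₂ p , inj₂ q) = h≢h′ (edge-inj sat h∈ h′∈ (Fin.↑ʳ-injective n _ _
        (trans (sym (hi-subdivision h)) (trans p (trans (sym q) (hi-subdivision h′))))))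

  halvesAt : Subset n → Subset (m ℕ.+ m)
  halvesAt Y = ⟪ (λ h → end h ∈? Y) ⟫

  -- Written as a filter of the same list as `matchings`, so that both are equal as lists whenever
  -- their conditions are equivalent.
  saturatings : Subset n → List (Subset (m ℕ.+ m))
  saturatings Y = filter (fullMatching? (halvesAt Y) ∣ Y ∣) (subsets (m ℕ.+ m))

  saturatings-! : ∀ Y → Unique (saturatings Y)
  saturatings-! Y = Unique.filter⁺ (fullMatching? (halvesAt Y) ∣ Y ∣) (subsets-! (m ℕ.+ m))

  ∈-saturatings⁺ : ∀ {Y M} → Saturating Y M → M ∈ᴸ saturatings Y
  ∈-saturatings⁺ {Y} {M} sat = ∈ᴸ.∈-filter⁺ (fullMatching? (halvesAt Y) ∣ Y ∣) (∈-subsets M)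
    (saturating⇒fullMatching (∈⟪⟫⁻ (λ h → end h ∈? Y)) (∈⟪⟫⁺ (λ h → end h ∈? Y)) sat)

  ∈-saturatings⁻ : ∀ {Y M} → M ∈ᴸ saturatings Y → Saturating Y M
  ∈-saturatings⁻ {Y} {M} M∈ = fullMatching⇒saturating (∈⟪⟫⁻ (λ h → end h ∈? Y)) (∈⟪⟫⁺ (λ h → end h ∈? Y))
    (proj₂ (∈ᴸ.∈-filter⁻ (fullMatching? (halvesAt Y) ∣ Y ∣) {xs = subsets (m ℕ.+ m)} M∈))

  matchings≡saturatings : (H : Subgraph (subdivision G)) (Y : Subset n) {j : ℕ} → j ≡ ∣ Y ∣ →
    (∀ {h} → h ∈ edges H → end h ∈ Y) → (∀ {h} → end h ∈ Y → h ∈ edges H) →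
    matchings H j ≡ saturatings Y
  matchings≡saturatings H Y refl ⇒ ⇐ = List.filter-≐ (fullMatching? (edges H) ∣ Y ∣) (fullMatching? (halvesAt Y) ∣ Y ∣)
    ( (λ {M} p → saturating⇒fullMatching from to (fullMatching⇒saturating {M = M} ⇒ ⇐ p))
    , (λ {M} p → saturating⇒fullMatching ⇒ ⇐ (fullMatching⇒saturating {M = M} from to p)) )
    (subsets (m ℕ.+ m))
    where
    to : ∀ {h} → end h ∈ Y → h ∈ halvesAt Y
    to = ∈⟪⟫⁺ (λ h → end h ∈? Y)
    from : ∀ {h} → h ∈ halvesAt Y → end h ∈ Y
    from = ∈⟪⟫⁻ (λ h → end h ∈? Y)

-- The two orientations of a cycle

module Orientations {n m : ℕ} (G : Graph n m) where

  open HalfEdges G public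

  -- For `M` saturating a set that contains the vertices of the cycle `F`, this says that `M` traces
  -- `F`. It depends only on the half-edges of `M` that start on `F`, so changes elsewhere do not
  -- affect it.
  Orients : Subset (m ℕ.+ m) → Subset m → Set
  Orients M F = ∀ h → h ∈ M → end h ∈ span G F → edge h ∈ F

  orients? : ∀ M → Decidable (Orients M)
  orients? M F = all? λ h → (h ∈? M) →-dec (end h ∈? span G F) →-dec (edge h ∈? F)

  -- `connected` says that `O` is a single closed walk: a vertex set closed under its steps contains
  -- all of the span or none of it. Two traced cycles with a common vertex are compared through this
  -- field.
  record Orientation (F : Subset m) (O : Subset (m ℕ.+ m)) : Set where
    field
      saturating : Saturating (span G F) O
      edge∈      : ∀ {h} → h ∈ O → edge h ∈ F
      onto       : ∀ {e} → e ∈ F → ∃ λ h → h ∈ O × edge h ≡ e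
      connected  : ∀ {S} → (∀ {h} → h ∈ O → end h ∈ S → other h ∈ S) →
                   ∀ {u v} → u ∈ span G F → v ∈ span G F → u ∈ S → v ∈ S

  record TwoOrientations (F : Subset m) : Set where
    field
      {O₀ O₁}      : Subset (m ℕ.+ m)
      orientation₀ : Orientation F O₀
      orientation₁ : Orientation F O₁
      disjoint     : ∀ {h} → h ∈ O₀ → h ∉ O₁
      nonempty     : ∃ λ v → v ∈ span G F
      exhaustive   : ∀ {Y M} → Saturating Y M → span G F ⊆ Y → Orients M F → O₀ ⊆ M ⊎ O₁ ⊆ M

  -- A cyclic successor σ replaces next, whose unfolding is prohibitively large.
  module _ {F : Subset m} {k : ℕ} (σ : Fin k → Fin k) (i₀ : Fin k)
    (σ-inj : ∀ {i j} → σ i ≡ σ j → i ≡ j) (σ-surj : ∀ i → ∃ λ j → σ j ≡ i)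
    (σ≢ : ∀ i → σ i ≢ i) (σσ≢ : ∀ i → σ (σ i) ≢ i)
    (forward  : ∀ (P : Pred (Fin k) 0ℓ) → (∀ i → P i → P (σ i)) → ∀ {i} j → P i → P j)
    (backward : ∀ (P : Pred (Fin k) 0ℓ) → (∀ i → P (σ i) → P i) → ∀ {i} j → P i → P j)
    (v : Fin k → Fin n) (v-inj : ∀ {i j} → v i ≡ v j → i ≡ j)
    (tail head : Fin k → Half) (e : Fin k → Fin m)
    (end-tail : ∀ i → end (tail i) ≡ v i) (other-tail : ∀ i → other (tail i) ≡ v (σ i))
    (edge-tail : ∀ i → edge (tail i) ≡ e i)
    (end-head : ∀ i → end (head i) ≡ v (σ i)) (other-head : ∀ i → other (head i) ≡ v i)
    (edge-head : ∀ i → edge (head i) ≡ e i)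
    (joins-e : ∀ i → Joins G (e i) (v i) (v (σ i)))
    (e∈F : ∀ i → e i ∈ F) (F-e : ∀ {f} → f ∈ F → ∃ λ i → e i ≡ f)
    where

    private
      e-inj : ∀ {i j} → e i ≡ e j → i ≡ j
      e-inj {i} {j} eq
        with joins-ends (joins-e i) (subst (λ f → Joins G f (v j) (v (σ j))) (sym eq) (joins-e j))
      ... | inj₁ (p , _) = v-inj p
      -- The same edge traversed in opposite directions would make `σ` return after two steps.
      ... | inj₂ (p , q) = contradiction (trans (cong σ (v-inj {σ i} {j} q)) (sym (v-inj {i} {σ j} p))) (σσ≢ i)

      F-ends : ∀ {h} → edge h ∈ F → ∃ λ i → e i ≡ edge h × (end h ≡ v i ⊎ end h ≡ v (σ i))
      F-ends {h} e∈ with i , eq ← F-e e∈ = i , eq ,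
        [ (λ (p , _) → inj₁ p) , (λ (p , _) → inj₂ p) ]′ (joins-ends (joins h) (subst (λ f → Joins G f (v i) (v (σ i))) eq (joins-e i)))

      v∈ : ∀ i → v i ∈ span G F
      v∈ i = subst (_∈ span G F) (end-tail i) (span-end (tail i) (subst (_∈ F) (sym (edge-tail i)) (e∈F i)))

      span-v : ∀ {u} → u ∈ span G F → ∃ λ i → v i ≡ u
      span-v u∈ with h , e∈ , refl ← span⁻ u∈ with F-ends e∈
      ... | i , _ , inj₁ p = i , sym p
      ... | i , _ , inj₂ p = σ i , sym p

      -- Both directions at once: `f i` is the half of `e i` that leaves `v (π i)` for `v (ρ i)`,
      -- with `π`, `ρ` equal to `id`, `σ` forwards and to `σ`, `id` backwards.
      orientation : (f : Fin k → Half) (π ρ : Fin k → Fin k) → (∀ i → edge (f i) ≡ e i) →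
        (∀ i → end (f i) ≡ v (π i)) → (∀ i → other (f i) ≡ v (ρ i)) →
        (∀ {i j} → π i ≡ π j → i ≡ j) → (∀ i → ∃ λ j → π j ≡ i) →
        (∀ (P : Pred (Fin k) 0ℓ) → (∀ i → P (π i) → P (ρ i)) → ∀ {i} j → P i → P j) →
        Orientation F (image f)
      orientation f π ρ edge-f end-f other-f π-inj π-surj reach = record
        { saturating = record
          { end∈     = λ h∈ → case ∈-image⁻ f h∈ of λ where
              (i , refl) → subst (_∈ span G F) (sym (end-f i)) (v∈ (π i))
          ; end-inj  = λ h∈ h′∈ eq → case (∈-image⁻ f h∈ , ∈-image⁻ f h′∈) of λ where
              ((i , refl) , (j , refl)) → cong f (π-inj (v-inj {π i} {π j} (trans (sym (end-f i)) (trans eq (end-f j)))))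
          ; edge-inj = λ h∈ h′∈ eq → case (∈-image⁻ f h∈ , ∈-image⁻ f h′∈) of λ where
              ((i , refl) , (j , refl)) → cong f (e-inj (trans (sym (edge-f i)) (trans eq (edge-f j))))
          ; covers   = λ u∈ → case span-v u∈ of λ where
              (i , refl) → let j , eq = π-surj i in f j , ∈-image⁺ f j , trans (end-f j) (cong v eq)
          }
        ; edge∈      = λ h∈ → case ∈-image⁻ f h∈ of λ where
            (i , refl) → subst (_∈ F) (sym (edge-f i)) (e∈F i)
        ; onto       = λ e∈ → let i , eq = F-e e∈ in f i , ∈-image⁺ f i , trans (edge-f i) eq
        ; connected  = λ {S} closed {a} {b} a∈ b∈ a∈S → case (span-v a∈ , span-v b∈) of λ where
            ((i , refl) , (j , refl)) → reach (λ i → v i ∈ S)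
              (λ i p → subst (_∈ S) (other-f i) (closed (∈-image⁺ f i) (subst (_∈ S) (sym (end-f i)) p))) j a∈S
        }

      disjoint : ∀ {h} → h ∈ image tail → h ∉ image head
      disjoint h∈ h∈′ with i , refl ← ∈-image⁻ tail h∈ with j , eq ← ∈-image⁻ head h∈′ =
        σ≢ j (v-inj {σ j} {j} (trans (sym (end-head j)) (trans (cong end eq)
          (trans (end-tail i) (cong v (sym (e-inj (trans (sym (edge-head j)) (trans (cong edge eq) (edge-tail i))))))))))

      -- At `v (σ i)` the matching continues forwards along the next edge or returns along `e i`. It
      -- cannot return if it has come forwards along `e i`, since an edge is used only once. So one
      -- forward half-edge forces all of them, and if there is none, all are backward.
      exhaustive : ∀ {Y M} → Saturating Y M → span G F ⊆ Y → Orients M F → image tail ⊆ M ⊎ image head ⊆ M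
      exhaustive {Y} {M} sat F⊆Y orients = choose (any? λ i → tail i ∈? M)
        where
        at : ∀ i → tail (σ i) ∈ M ⊎ head i ∈ M
        at i with h , h∈ , eq ← covers sat (F⊆Y (v∈ (σ i)))
             with F-ends (orients h h∈ (subst (_∈ span G F) (sym eq) (v∈ (σ i))))
        ... | j , e≡ , inj₁ p with refl ← v-inj {σ i} {j} (trans (sym eq) p) =
              inj₁ (subst (_∈ M) (half-ext (trans p (sym (end-tail (σ i)))) (trans (sym e≡) (sym (edge-tail (σ i))))) h∈)
        ... | j , e≡ , inj₂ p with refl ← σ-inj {i} {j} (v-inj {σ i} {σ j} (trans (sym eq) p)) =
              inj₂ (subst (_∈ M) (half-ext (trans p (sym (end-head i))) (trans (sym e≡) (sym (edge-head i)))) h∈)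

        advance : ∀ i → tail i ∈ M → tail (σ i) ∈ M
        advance i t∈ with at i
        ... | inj₁ t∈′ = t∈′
        ... | inj₂ h∈  = contradiction
              (v-inj {σ i} {i} (trans (sym (end-head i)) (trans (cong end (edge-inj sat h∈ t∈ (trans (edge-head i) (sym (edge-tail i))))) (end-tail i))))
              (σ≢ i)

        choose : Dec (∃ λ i → tail i ∈ M) → image tail ⊆ M ⊎ image head ⊆ M
        choose (yes (i , t∈)) = inj₁ sub
          where
          sub : image tail ⊆ M
          sub h∈ with j , refl ← ∈-image⁻ tail h∈ = forward (λ i → tail i ∈ M) advance j t∈
        choose (no none) = inj₂ sub
          where
          sub : image head ⊆ M
          sub h∈ with j , refl ← ∈-image⁻ head h∈ with at j
          ... | inj₁ t∈ = contradiction (_ , t∈) none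
          ... | inj₂ h∈′ = h∈′

    cyclicOrientations : TwoOrientations F
    cyclicOrientations = record
      { orientation₀ = orientation tail id σ edge-tail end-tail other-tail id (λ i → i , refl) forward
      ; orientation₁ = orientation head σ id edge-head end-head other-head σ-inj σ-surj backward
      ; disjoint     = disjoint
      ; nonempty     = v i₀ , v∈ i₀
      ; exhaustive   = exhaustive
      }

  twoOrientations : ∀ {F} → IsCycle G F → TwoOrientations F
  twoOrientations {F} (l , w , unique , adjacent , F⇔) = cyclicOrientations next zero
    next-injective next-surjective next≢ next-next≢ cyclic cyclic⁻
    (lookup w) (λ {i} {j} → VecUnique.lookup-injective unique i j)
    (λ i → proj₁ (tails i)) (λ i → proj₁ (heads i)) (λ i → proj₁ (adjacent i))
    (λ i → proj₁ (proj₂ (tails i))) (λ i → proj₁ (proj₂ (proj₂ (tails i)))) (λ i → proj₂ (proj₂ (proj₂ (tails i))))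
    (λ i → proj₁ (proj₂ (heads i))) (λ i → proj₁ (proj₂ (proj₂ (heads i)))) (λ i → proj₂ (proj₂ (proj₂ (heads i))))
    (λ i → proj₂ (adjacent i)) (λ i → proj₂ (F⇔ _) (i , proj₂ (adjacent i)))
    (λ f∈ → let i , j = proj₁ (F⇔ _) f∈ in i , joins-unique (proj₂ (adjacent i)) j)
    where
    tails : ∀ i → ∃ λ h → end h ≡ lookup w i × other h ≡ lookup w (next i) × edge h ≡ proj₁ (adjacent i)
    tails i = halfOf (proj₂ (adjacent i))

    heads : ∀ i → ∃ λ h → end h ≡ lookup w (next i) × other h ≡ lookup w i × edge h ≡ proj₁ (adjacent i)
    heads i = halfOf (joins-swap (proj₂ (adjacent i)))

  -- An orbit of length 1 would be a loop. In one of length 2 both vertices would select the unique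
  -- edge between them, against the injectivity of the selected edges. Longer orbits are cycles.
  orbit⇒cycle : ∀ {X k} (x : Fin k → Fin n) → (∀ {i j} → x i ≡ x j → i ≡ j) → (∀ i → x i ∈ X) →
    (φ : Vec Half k) → (∀ i → end (lookup φ i) ≡ x i) →
    (∀ {i j} → edge (lookup φ i) ≡ edge (lookup φ j) → i ≡ j) →
    Orbit x (other ∘ lookup φ) → ∃ λ F → IsCycle G F × Orients (fromVec φ) F × span G F ⊆ X
  orbit⇒cycle {X} x x-inj x∈X φ end-φ edge-φ-inj orbit = go size point inj chain close
    where
    open Orbit orbit

    e : ∀ i → Fin m
    e i = edge (lookup φ i)

    no-loop : ∀ {i} → other (lookup φ i) ≢ x i
    no-loop {i} eq = end≢other (lookup φ i) (trans (end-φ i) (sym eq))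

    no-2-cycle : ∀ {i j} → other (lookup φ i) ≡ x j → other (lookup φ j) ≢ x i
    no-2-cycle {i} {j} p q = contradiction
      (edge-φ-inj (joins-unique (joins (lookup φ i)) (joins-swap (subst₂ (Joins G (e j))
        (trans (end-φ j) (sym p)) (trans q (sym (end-φ i))) (joins (lookup φ j))))))
      λ { refl → no-loop p }

    go : ∀ t (w : Fin (suc t) → Fin _) → (∀ {a b} → w a ≡ w b → a ≡ b) →
         (∀ a → other (lookup φ (w (suc a))) ≡ x (w (inject₁ a))) →
         other (lookup φ (w zero)) ≡ x (w (fromℕ t)) →
         ∃ λ F → IsCycle G F × Orients (fromVec φ) F × span G F ⊆ X
    go zero          w w-inj chain close = contradiction close no-loop
    go (suc zero)    w w-inj chain close = contradiction (chain zero) (no-2-cycle close)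
    go (suc (suc l)) w w-inj chain close = F , (l , Vec.tabulate v , unique , adjacent , F⇔) , orients , F⊆X
      where
      v : Fin (3 ℕ.+ l) → Fin n
      v = x ∘ w

      F : Subset m
      F = image (e ∘ w)

      v-lookup : ∀ i → lookup (Vec.tabulate v) i ≡ v i
      v-lookup = Vec.lookup∘tabulate v

      unique = VecUnique.tabulate⁺ {f = v} (w-inj ∘ x-inj)

      back : ∀ i → other (lookup φ (w (next i))) ≡ v i
      back i with view i
      ... | ‵fromℕ      = trans (cong (other ∘ lookup φ ∘ w) (next-fromℕ l)) close
      ... | ‵inject₁ i′ = trans (cong (other ∘ lookup φ ∘ w) (next-inject₁ i′)) (chain i′)

      -- The points run against the walk, so the edge between positions `i` and `next i` is the one
      -- selected at `w (next i)`.
      step : ∀ i → Joins G (e (w (next i))) (lookup (Vec.tabulate v) i) (lookup (Vec.tabulate v) (next i))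
      step i = subst₂ (Joins G (e (w (next i)))) (trans (back i) (sym (v-lookup i)))
        (trans (end-φ (w (next i))) (sym (v-lookup (next i)))) (joins-swap (joins (lookup φ (w (next i)))))

      adjacent = λ i → _ , step i

      F⇔ = λ f →
        (λ f∈ → case ∈-image⁻ (e ∘ w) f∈ of λ where
          (i , refl) → case next-surjective i of λ { (j , refl) → j , step j }) ,
        (λ (i , j) → subst (_∈ F) (joins-unique (step i) j) (∈-image⁺ (e ∘ w) (next i)))

      F-v : ∀ {u} → u ∈ span G F → ∃ λ i → v i ≡ u
      F-v u∈ with h , e∈ , refl ← span⁻ u∈ with i , eq ← ∈-image⁻ (e ∘ w) e∈ with same-edge eq
      ... | inj₁ (p , _) = i , trans (sym (end-φ (w i))) p
      ... | inj₂ (_ , q) = let j , eq′ = next-surjective i in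
            j , trans (sym (back j)) (trans (cong (other ∘ lookup φ ∘ w) eq′) q)

      orients : Orients (fromVec φ) F
      orients h h∈ u∈ with a , refl ← ∈-fromVec⁻ φ h∈ with i , eq ← F-v u∈ =
        subst (λ a → e a ∈ F) (x-inj (trans eq (end-φ a))) (∈-image⁺ (e ∘ w) i)

      F⊆X : span G F ⊆ X
      F⊆X u∈ with i , refl ← F-v u∈ = x∈X (w i)

-- Properties inherited by sublists

∈-sublists⇒All : ∀ {A : Set} {p} {P : Pred A p} (xs : List A) {C} → C ∈ᴸ sublists xs → All P xs → All P C
∈-sublists⇒All []       (here refl) _        = []
∈-sublists⇒All (x ∷ xs) C∈ (p ∷ ps) with ∈ᴸ.∈-++⁻ (List.map (x ∷_) (sublists xs)) C∈
... | inj₂ C∈′ = ∈-sublists⇒All xs C∈′ ps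
... | inj₁ C∈′ with C′ , C′∈ , refl ← ∈ᴸ.∈-map⁻ (x ∷_) C∈′ = p ∷ ∈-sublists⇒All xs C′∈ ps

∈-sublists⇒AllPairs : ∀ {A : Set} {r} {_~_ : A → A → Set r} (xs : List A) {C} →
                      C ∈ᴸ sublists xs → AllPairs _~_ xs → AllPairs _~_ C
∈-sublists⇒AllPairs []       (here refl) _        = []
∈-sublists⇒AllPairs (x ∷ xs) C∈ (p ∷ ps) with ∈ᴸ.∈-++⁻ (List.map (x ∷_) (sublists xs)) C∈
... | inj₂ C∈′ = ∈-sublists⇒AllPairs xs C∈′ ps
... | inj₁ C∈′ with C′ , C′∈ , refl ← ∈ᴸ.∈-map⁻ (x ∷_) C∈′ =
      ∈-sublists⇒All xs C′∈ p ∷ ∈-sublists⇒AllPairs xs C′∈ ps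

-- Splitting an oriented cycle off a matching

module Splitting {n m : ℕ} (G : Graph n m) where

  open Orientations G public

  open Orientation
  open TwoOrientations

  orients⁺ : ∀ {F O Y M} → Orientation F O → Saturating Y M → O ⊆ M → Orients M F
  orients⁺ {F} or sat O⊆M h h∈ end∈F with h′ , h′∈ , eq ← covers (saturating or) end∈F =
    subst (λ h → edge h ∈ F) (end-inj sat (O⊆M h′∈) h∈ eq) (edge∈ or h′∈)

  -- Both orientations have a half-edge at a common vertex, and `M` has only one there.
  not-both : ∀ {F Y M} (two : TwoOrientations F) → Saturating Y M → O₀ two ⊆ M → ¬ (O₁ two ⊆ M)
  not-both two sat O₀⊆ O₁⊆
    with v , v∈ ← nonempty two
    with h , h∈ , eq ← covers (saturating (orientation₀ two)) v∈
    with h′ , h′∈ , eq′ ← covers (saturating (orientation₁ two)) v∈ =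
    disjoint two h∈ (subst (_∈ O₁ two) (end-inj sat (O₁⊆ h′∈) (O₀⊆ h∈) (trans eq′ (sym eq))) h′∈)

  module _ {F O Y} (or : Orientation F O) (F⊆Y : span G F ⊆ Y) where

    private
      Y′ = Y ─ span G F

    ∉-orientation : ∀ {M h} → Saturating Y′ M → h ∈ M → h ∉ O
    ∉-orientation sat h∈ h∈O = p─q∌ Y (span G F) (end∈ sat h∈) (end∈ (saturating or) h∈O)

    -- Together with `saturating-─` this is the bijection that peels an oriented cycle off a
    -- matching. No edge is used twice, because a half-edge of `M` along an edge of `F` would start
    -- on the span of `F`.
    saturating-∪ : ∀ {M} → Saturating Y′ M → Saturating Y (O ∪ M)
    saturating-∪ {M} sat = record
      { end∈     = λ h∈ → [ F⊆Y ∘ end∈ (saturating or) , Sub.p─q⊆p Y (span G F) ∘ end∈ sat ]′ (Sub.x∈p∪q⁻ O M h∈)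
      ; end-inj  = λ h∈ h′∈ → end-inj′ (Sub.x∈p∪q⁻ O M h∈) (Sub.x∈p∪q⁻ O M h′∈)
      ; edge-inj = λ h∈ h′∈ → edge-inj′ (Sub.x∈p∪q⁻ O M h∈) (Sub.x∈p∪q⁻ O M h′∈)
      ; covers   = λ {v} v∈ → covers′ v∈ (v ∈? span G F)
      }
      where
      end-clash : ∀ {h h′} → h ∈ O → h′ ∈ M → end h ≢ end h′
      end-clash h∈ h′∈ eq = p─q∌ Y (span G F) (end∈ sat h′∈) (subst (_∈ span G F) eq (end∈ (saturating or) h∈))

      edge-clash : ∀ {h h′} → h ∈ O → h′ ∈ M → edge h ≢ edge h′
      edge-clash {h} {h′} h∈ h′∈ eq =
        p─q∌ Y (span G F) (end∈ sat h′∈) (span-end h′ (subst (_∈ F) eq (edge∈ or h∈)))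

      end-inj′ : ∀ {h h′} → h ∈ O ⊎ h ∈ M → h′ ∈ O ⊎ h′ ∈ M → end h ≡ end h′ → h ≡ h′
      end-inj′ (inj₁ p) (inj₁ q) eq = end-inj (saturating or) p q eq
      end-inj′ (inj₁ p) (inj₂ q) eq = contradiction eq (end-clash p q)
      end-inj′ (inj₂ p) (inj₁ q) eq = contradiction (sym eq) (end-clash q p)
      end-inj′ (inj₂ p) (inj₂ q) eq = end-inj sat p q eq

      edge-inj′ : ∀ {h h′} → h ∈ O ⊎ h ∈ M → h′ ∈ O ⊎ h′ ∈ M → edge h ≡ edge h′ → h ≡ h′
      edge-inj′ (inj₁ p) (inj₁ q) eq = edge-inj (saturating or) p q eq
      edge-inj′ (inj₁ p) (inj₂ q) eq = contradiction eq (edge-clash p q)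
      edge-inj′ (inj₂ p) (inj₁ q) eq = contradiction (sym eq) (edge-clash q p)
      edge-inj′ (inj₂ p) (inj₂ q) eq = edge-inj sat p q eq

      covers′ : ∀ {v} → v ∈ Y → Dec (v ∈ span G F) → ∃ λ h → h ∈ O ∪ M × end h ≡ v
      covers′ v∈ (yes v∈F) = let h , h∈ , eq = covers (saturating or) v∈F in h , Sub.x∈p∪q⁺ (inj₁ h∈) , eq
      covers′ v∈ (no  v∉F) = let h , h∈ , eq = covers sat (Sub.x∈p∧x∉q⇒x∈p─q v∈ v∉F) in h , Sub.x∈p∪q⁺ (inj₂ h∈) , eq

    saturating-─ : ∀ {M} → Saturating Y M → O ⊆ M → Saturating Y′ (M ─ O)
    saturating-─ {M} sat O⊆M = record
      { end∈     = λ {h} h∈ → Sub.x∈p∧x∉q⇒x∈p─q (end∈ sat (∈M h∈)) λ end∈F →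
          let h′ , h′∈ , eq = covers (saturating or) end∈F in
          p─q∌ M O h∈ (subst (_∈ O) (end-inj sat (O⊆M h′∈) (∈M h∈) eq) h′∈)
      ; end-inj  = λ h∈ h′∈ → end-inj sat (∈M h∈) (∈M h′∈)
      ; edge-inj = λ h∈ h′∈ → edge-inj sat (∈M h∈) (∈M h′∈)
      ; covers   = λ v∈ → let h , h∈ , eq = covers sat (Sub.p─q⊆p Y (span G F) v∈) in
          h , Sub.x∈p∧x∉q⇒x∈p─q h∈ (λ h∈O → p─q∌ Y (span G F) v∈ (subst (_∈ span G F) eq (end∈ (saturating or) h∈O))) , eq
      }
      where
      ∈M : ∀ {h} → h ∈ M ─ O → h ∈ M
      ∈M = Sub.p─q⊆p M O

    ∪-cancel : ∀ {M M′} → Saturating Y′ M → Saturating Y′ M′ → O ∪ M ≡ O ∪ M′ → M ≡ M′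
    ∪-cancel sat sat′ eq = Sub.⊆-antisym (sub sat eq) (sub sat′ (sym eq))
      where
      sub : ∀ {M M′} → Saturating Y′ M → O ∪ M ≡ O ∪ M′ → M ⊆ M′
      sub {M} {M′} sat eq {h} h∈ = [ (λ h∈O → contradiction h∈O (∉-orientation sat h∈)) , id ]′
        (Sub.x∈p∪q⁻ O M′ (subst (h ∈_) eq (Sub.q⊆p∪q O M h∈)))

    ∪-─ : ∀ {M} → O ⊆ M → O ∪ (M ─ O) ≡ M
    ∪-─ {M} O⊆M = Sub.⊆-antisym
      (λ h∈ → [ O⊆M , Sub.p─q⊆p M O ]′ (Sub.x∈p∪q⁻ O (M ─ O) h∈))
      (λ {h} h∈ → case h ∈? O of λ where
        (yes h∈O) → Sub.x∈p∪q⁺ (inj₁ h∈O)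
        (no  h∉O) → Sub.x∈p∪q⁺ (inj₂ (Sub.x∈p∧x∉q⇒x∈p─q h∈ h∉O)))

    orients-∪⁺ : ∀ {M F′} → VertexDisjoint G F F′ → Orients M F′ → Orients (O ∪ M) F′
    orients-∪⁺ {M} dis o h h∈ end∈F′ with Sub.x∈p∪q⁻ O M h∈
    ... | inj₁ h∈O = contradiction (_ , Sub.x∈p∩q⁺ (end∈ (saturating or) h∈O , end∈F′)) dis
    ... | inj₂ h∈M = o h h∈M end∈F′

    orients-∪⁻ : ∀ {M F′} → Orients (O ∪ M) F′ → Orients M F′
    orients-∪⁻ {M} o h h∈ = o h (Sub.q⊆p∪q O M h∈)

  -- Containment in `X` is part of the condition because `Orients` holds vacuously for a cycle that
  -- avoids `X`, and it can also hold for one that lies only partly in `X`.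
  Good : Subset n → Subset (m ℕ.+ m) → Subset m → Set
  Good X M F = Orients M F × span G F ⊆ X

  good? : ∀ X M → Decidable (Good X M)
  good? X M F = orients? M F ×-dec (span G F ⊆? X)

  span-closed : ∀ {M F h} → Orients M F → h ∈ M → end h ∈ span G F → other h ∈ span G F
  span-closed {h = h} o h∈ end∈F = span-other h (o h h∈ end∈F)

  -- Both cycles are traced out by following M from a common vertex.
  good-disjoint : ∀ {X M F F′} → IsCycle G F → IsCycle G F′ → Saturating X M →
                  Good X M F → Good X M F′ → F ≢ F′ → VertexDisjoint G F F′
  good-disjoint {X} {M} cyc cyc′ sat good good′ F≢F′ (v , v∈) =
    let v∈F , v∈F′ = Sub.x∈p∩q⁻ _ _ v∈ in
    F≢F′ (Sub.⊆-antisym (sub cyc good good′ v∈F v∈F′) (sub cyc′ good′ good v∈F′ v∈F))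
    where
    follow : ∀ {F F′ O v} → Orientation F O → O ⊆ M → Orients M F′ → v ∈ span G F → v ∈ span G F′ → F ⊆ F′
    follow or O⊆M o′ v∈F v∈F′ e∈ with h , h∈ , refl ← onto or e∈ =
      o′ h (O⊆M h∈) (connected or (λ h∈ → span-closed o′ (O⊆M h∈)) v∈F (end∈ (saturating or) h∈) v∈F′)

    sub : ∀ {F F′ v} → IsCycle G F → Good X M F → Good X M F′ → v ∈ span G F → v ∈ span G F′ → F ⊆ F′
    sub cyc (o , F⊆X) (o′ , _) v∈F v∈F′ with two ← twoOrientations cyc with exhaustive two sat F⊆X o
    ... | inj₁ O⊆M = follow (orientation₀ two) O⊆M o′ v∈F v∈F′
    ... | inj₂ O⊆M = follow (orientation₁ two) O⊆M o′ v∈F v∈F′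

-- Weights of edge sets and alternating sums

module Weights {a ℓ} (R : CommutativeRing a ℓ) where

  open Determinants R public
  open Sums R public

  sum-↑ : ∀ {i j} (f : Vector Carrier (i ℕ.+ j)) → sum f ≈ sum (λ e → f (e ↑ˡ j)) + sum (λ e → f (i ↑ʳ e))
  sum-↑ {zero}  f = ≈-sym (+-identityˡ _)
  sum-↑ {suc i} f = ≈-trans (+-congˡ (sum-↑ {i} (f ∘ suc))) (≈-sym (+-assoc _ _ _))

  factor : ∀ {q} → (Fin q → Carrier) → Subset q → Vector Carrier q
  factor c F e = if lookup F e then c e else 1#

  weight-cong : ∀ {q} {c d : Fin q → Carrier} (F : Subset q) → (∀ e → c e ≈ d e) → weight c F ≈ weight d F
  weight-cong {c = c} {d} F eq = product-cong {x = factor c F} {y = factor d F} pointwise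
    where
    pointwise : ∀ e → factor c F e ≈ factor d F e
    pointwise e with lookup F e
    ... | true  = eq e
    ... | false = ≈-refl

  weight-⊥ : ∀ {q} (c : Fin q → Carrier) → weight c ⊥ ≈ 1#
  weight-⊥ {zero}  c = ≈-refl
  weight-⊥ {suc q} c = ≈-trans (*-identityˡ _) (weight-⊥ (c ∘ suc))

  weight-⁅⁆ : ∀ {q} (c : Fin q → Carrier) x → weight c ⁅ x ⁆ ≈ c x
  weight-⁅⁆ c zero    = ≈-trans (*-congˡ (weight-⊥ (c ∘ suc))) (*-identityʳ _)
  weight-⁅⁆ c (suc x) = ≈-trans (*-identityˡ _) (weight-⁅⁆ (c ∘ suc) x)

  weight-∪ : ∀ {q} (c : Fin q → Carrier) (F F′ : Subset q) → (∀ {e} → e ∈ F → e ∉ F′) →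
             weight c (F ∪ F′) ≈ weight c F * weight c F′
  weight-∪ c F F′ dis = ≈-trans
    (product-cong {x = factor c (F ∪ F′)} {y = λ e → factor c F e * factor c F′ e} pointwise)
    (product-distrib-* (factor c F) (factor c F′))
    where
    pointwise : ∀ e → factor c (F ∪ F′) e ≈ factor c F e * factor c F′ e
    pointwise e rewrite Vec.lookup-zipWith _∨_ e F F′ with lookup F e in p | lookup F′ e in q
    ... | true  | true  = contradiction (Vec.lookup⇒[]= e F′ q) (dis (Vec.lookup⇒[]= e F p))
    ... | true  | false = ≈-sym (*-identityʳ _)
    ... | false | true  = ≈-sym (*-identityˡ _)
    ... | false | false = ≈-sym (*-identityˡ _)

  weight-- : ∀ {q} (c : Fin q → Carrier) (F : Subset q) {x} → x ∈ F → weight c F ≈ c x * weight c (F - x)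
  weight-- c F {x} x∈ = begin
    weight c F                          ≡⟨ cong (weight c) F≡ ⟨
    weight c (⁅ x ⁆ ∪ (F - x))          ≈⟨ weight-∪ c ⁅ x ⁆ (F - x) (λ e∈ e∈′ → p─q∌ F ⁅ x ⁆ e∈′ e∈) ⟩
    weight c ⁅ x ⁆ * weight c (F - x)   ≈⟨ *-congʳ (weight-⁅⁆ c x) ⟩
    c x * weight c (F - x)              ∎
    where
    F≡ : ⁅ x ⁆ ∪ (F - x) ≡ F
    F≡ = Sub.⊆-antisym
      (λ {e} e∈ → [ (λ e∈′ → subst (_∈ F) (sym (Sub.x∈⁅y⁆⇒x≡y x e∈′)) x∈) , Sub.p─q⊆p F ⁅ x ⁆ ]′ (Sub.x∈p∪q⁻ ⁅ x ⁆ (F - x) e∈))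
      (λ {e} e∈ → case e Fin.≟ x of λ where
        (yes refl) → Sub.x∈p∪q⁺ (inj₁ (Sub.x∈⁅x⁆ x))
        (no e≢x)   → Sub.x∈p∪q⁺ (inj₂ (Sub.x∈p∧x≢y⇒x∈p-y e∈ e≢x)))

  weight-bijection : ∀ {p q} (c : Fin q → Carrier) (O : Subset p) (F : Subset q) (f : Fin p → Fin q) →
    (∀ {h} → h ∈ O → f h ∈ F) → (∀ {h h′} → h ∈ O → h′ ∈ O → f h ≡ f h′ → h ≡ h′) →
    (∀ {e} → e ∈ F → ∃ λ h → h ∈ O × f h ≡ e) → weight (c ∘ f) O ≈ weight c F
  weight-bijection c [] F f into inj onto = ≈-trans (≈-sym (weight-⊥ c))
    (≈-reflexive (cong (weight c) (sym (Sub.Empty-unique λ (_ , e∈) → case onto e∈ of λ { (_ , () , _) }))))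
  weight-bijection c (outside ∷ O) F f into inj onto = ≈-trans (*-identityˡ _)
    (weight-bijection c O F (f ∘ suc) (into ∘ Vec.there)
      (λ h∈ h′∈ eq → Fin.suc-injective (inj (Vec.there h∈) (Vec.there h′∈) eq))
      (λ e∈ → case onto e∈ of λ { (suc h , Vec.there h∈ , eq) → h , h∈ , eq }))
  weight-bijection c (inside ∷ O) F f into inj onto = ≈-trans
    (*-congˡ (weight-bijection c O (F - f zero) (f ∘ suc)
      (λ h∈ → Sub.x∈p∧x≢y⇒x∈p-y (into (Vec.there h∈)) λ eq → case inj (Vec.there h∈) Vec.here eq of λ ())
      (λ h∈ h′∈ eq → Fin.suc-injective (inj (Vec.there h∈) (Vec.there h′∈) eq))
      (λ e∈ → case onto (Sub.p─q⊆p F ⁅ f zero ⁆ e∈) of λ where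
        (zero  , _ , eq)            → contradiction (subst (_∈ ⁅ f zero ⁆) eq (Sub.x∈⁅x⁆ (f zero))) (p─q∌ F ⁅ f zero ⁆ e∈)
        (suc h , Vec.there h∈ , eq) → h , h∈ , eq)))
    (≈-sym (weight-- c F (into Vec.here)))

  -- The empty family yields the pure matching term of the expansion; the indicator left on the
  -- other families is the first condition in `cycleUnions`.
  ∑-sublists-nonempty : ∀ {A : Set} (xs : List A) (f : List A → Carrier) →
    ∑ (sublists xs) f ≈ f [] + ∑ (sublists xs) (λ C → [[ 1 ℕ.≤? length C ]] * f C)
  ∑-sublists-nonempty [] f = +-congˡ (≈-sym (≈-trans (+-identityʳ _) (zeroˡ _)))
  ∑-sublists-nonempty (x ∷ xs) f = begin
    ∑ (List.map (x ∷_) (sublists xs) ++ sublists xs) f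
      ≈⟨ ∑-++ (List.map (x ∷_) (sublists xs)) (sublists xs) f ⟩
    ∑ (List.map (x ∷_) (sublists xs)) f + ∑ (sublists xs) f
      ≈⟨ +-cong with-x (∑-sublists-nonempty xs f) ⟩
    ∑ (List.map (x ∷_) (sublists xs)) f′ + (f [] + ∑ (sublists xs) f′)
      ≈⟨ +-solve 3 (λ a b c → (a :+ (b :+ c)) := (b :+ (a :+ c))) ≈-refl _ _ _ ⟩
    f [] + (∑ (List.map (x ∷_) (sublists xs)) f′ + ∑ (sublists xs) f′)
      ≈⟨ +-congˡ (∑-++ (List.map (x ∷_) (sublists xs)) (sublists xs) f′) ⟨
    f [] + ∑ (sublists (x ∷ xs)) f′ ∎
    where
    f′ = λ C → [[ 1 ℕ.≤? length C ]] * f C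

    with-x : ∑ (List.map (x ∷_) (sublists xs)) f ≈ ∑ (List.map (x ∷_) (sublists xs)) f′
    with-x = ∑-cong (List.map (x ∷_) (sublists xs)) λ C∈ → case ∈ᴸ.∈-map⁻ (x ∷_) C∈ of λ where
      (C , _ , refl) → ≈-sym (≈-trans (*-congʳ ([[]]-yes (1 ℕ.≤? suc (length C)) (s≤s z≤n))) (*-identityˡ _))

  module _ {A : Set} {P : Pred A 0ℓ} (P? : Decidable P) where

    -- The expansion of (1 - 1)^t, where t counts the entries satisfying `P`; `alternating-∷` splits
    -- off one factor.
    alternating : List A → Carrier
    alternating xs = ∑ (sublists xs) (λ C → [[ All.all? P? C ]] * ε ^ length C)

    all-∷ : ∀ x C → [[ All.all? P? (x ∷ C) ]] ≈ [[ P? x ]] * [[ All.all? P? C ]]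
    all-∷ x C = ≈-trans ([[]]-cong (All.all? P? (x ∷ C)) (P? x ×-dec All.all? P? C)
      (λ { (p ∷ ps) → p , ps }) (λ (p , ps) → p ∷ ps)) ([[]]-× (P? x) (All.all? P? C))

    alternating-∷ : ∀ x xs → alternating (x ∷ xs) ≈ [[ P? x ]] * (ε * alternating xs) + alternating xs
    alternating-∷ x xs = begin
      ∑ (sublists (x ∷ xs)) f
        ≈⟨ ∑-++ (List.map (x ∷_) (sublists xs)) (sublists xs) f ⟩
      ∑ (List.map (x ∷_) (sublists xs)) f + alternating xs
        ≈⟨ +-congʳ (∑-map (x ∷_) (sublists xs) f) ⟩
      ∑ (sublists xs) (f ∘ (x ∷_)) + alternating xs
        ≈⟨ +-congʳ (∑-cong (sublists xs) λ {C} _ → ≈-trans (*-congʳ (all-∷ x C))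
             (*-solve 4 (λ p q e s → ((p :* q) :* (e :* s)) :≈ ((p :* e) :* (q :* s))) ≈-refl _ _ _ _)) ⟩
      ∑ (sublists xs) (λ C → [[ P? x ]] * ε * f C) + alternating xs
        ≈⟨ +-congʳ (≈-trans (≈-sym (∑-*ˡ _ (sublists xs) f)) (*-assoc _ _ _)) ⟩
      [[ P? x ]] * (ε * alternating xs) + alternating xs ∎
      where
      f = λ C → [[ All.all? P? C ]] * ε ^ length C

    alternating-none : ∀ xs → All (¬_ ∘ P) xs → alternating xs ≈ 1#
    alternating-none []       _        = ≈-trans (+-identityʳ _) (*-identityˡ 1#)
    alternating-none (x ∷ xs) (¬p ∷ h) = begin
      alternating (x ∷ xs)                               ≈⟨ alternating-∷ x xs ⟩
      [[ P? x ]] * (ε * alternating xs) + alternating xs ≈⟨ +-congʳ (≈-trans (*-congʳ ([[]]-no (P? x) ¬p)) (zeroˡ _)) ⟩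
      0# + alternating xs                                ≈⟨ +-identityˡ _ ⟩
      alternating xs                                     ≈⟨ alternating-none xs h ⟩
      1#                                                 ∎

    alternating-some : ∀ xs {x} → x ∈ᴸ xs → P x → alternating xs ≈ 0#
    alternating-some (x ∷ xs) (here refl) p = begin
      alternating (x ∷ xs)                               ≈⟨ alternating-∷ x xs ⟩
      [[ P? x ]] * (ε * alternating xs) + alternating xs ≈⟨ +-congʳ (≈-trans (*-congʳ ([[]]-yes (P? x) p)) (*-identityˡ _)) ⟩
      ε * alternating xs + alternating xs                ≈⟨ +-congʳ (-1*x≈-x _) ⟩
      - alternating xs + alternating xs                  ≈⟨ -‿inverseˡ _ ⟩
      0#                                                 ∎
    alternating-some (x ∷ xs) (there y∈) p = begin
      alternating (x ∷ xs)                               ≈⟨ alternating-∷ x xs ⟩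
      [[ P? x ]] * (ε * alternating xs) + alternating xs ≈⟨ +-cong (*-congˡ (*-congˡ ih)) ih ⟩
      [[ P? x ]] * (ε * 0#) + 0#                         ≈⟨ +-identityʳ _ ⟩
      [[ P? x ]] * (ε * 0#)                              ≈⟨ ≈-trans (*-congˡ (zeroʳ ε)) (zeroʳ _) ⟩
      0#                                                 ∎
      where ih = alternating-some xs y∈ p

-- Vertex deletion in the subdivision

↑ˡ∈++⁺ : ∀ {k l} {p : Subset k} {q : Subset l} {i} → i ∈ p → i ↑ˡ l ∈ p Vec.++ q
↑ˡ∈++⁺ {p = p} {q} {i} h = Vec.lookup⇒[]= _ _ (trans (Vec.lookup-++ˡ p q i) (Vec.[]=⇒lookup h))

↑ˡ∈++⁻ : ∀ {k l} {p : Subset k} {q : Subset l} {i} → i ↑ˡ l ∈ p Vec.++ q → i ∈ p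
↑ˡ∈++⁻ {p = p} {q} {i} h = Vec.lookup⇒[]= _ _ (trans (sym (Vec.lookup-++ˡ p q i)) (Vec.[]=⇒lookup h))

↑ʳ∈++⁻ : ∀ {k l} {p : Subset k} {q : Subset l} {i} → k ↑ʳ i ∈ p Vec.++ q → i ∈ q
↑ʳ∈++⁻ {p = p} {q} {i} h = Vec.lookup⇒[]= _ _ (trans (sym (Vec.lookup-++ʳ p q i)) (Vec.[]=⇒lookup h))

∈-∖⁺ : ∀ {n m} {G : Graph n m} (H : Subgraph G) D {e} →
       e ∈ edges H → lo G e ∉ D → hi G e ∉ D → e ∈ edges (H ∖ D)
∈-∖⁺ {G = G} H D e∈ p q =
  ∈⟪⟫⁺ (λ e → (e ∈? edges H) ×-dec ¬? (lo G e ∈? D) ×-dec ¬? (hi G e ∈? D)) (e∈ , p , q)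

∈-∖⁻ : ∀ {n m} {G : Graph n m} (H : Subgraph G) D {e} →
       e ∈ edges (H ∖ D) → e ∈ edges H × lo G e ∉ D × hi G e ∉ D
∈-∖⁻ {G = G} H D = ∈⟪⟫⁻ (λ e → (e ∈? edges H) ×-dec ¬? (lo G e ∈? D) ×-dec ¬? (hi G e ∈? D))

module Deletion {n m : ℕ} (G : Graph n m) where

  open Splitting G

  module _ (H : Subgraph (subdivision G)) (P : Subset n) (Q : Subset m) where

    ∈-delete⁺ : ∀ {h} → h ∈ edges H → end h ∉ P → edge h ∉ Q → h ∈ edges (H ∖ (P Vec.++ Q))
    ∈-delete⁺ {h} h∈ p q = ∈-∖⁺ H (P Vec.++ Q) h∈
      (λ r → p (↑ˡ∈++⁻ (subst (_∈ P Vec.++ Q) (lo-subdivision h) r)))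
      (λ r → q (↑ʳ∈++⁻ {p = P} (subst (_∈ P Vec.++ Q) (hi-subdivision h) r)))

    ∈-delete⁻ : ∀ {h} → h ∈ edges (H ∖ (P Vec.++ Q)) → h ∈ edges H × end h ∉ P
    ∈-delete⁻ {h} h∈ with h∈H , p , _ ← ∈-∖⁻ H (P Vec.++ Q) h∈ =
      h∈H , λ r → p (subst (_∈ P Vec.++ Q) (sym (lo-subdivision h)) (↑ˡ∈++⁺ r))

  matchings-X : ∀ X → matchings (whole (subdivision G) ∖ original (∁ X)) ∣ X ∣ ≡ saturatings X
  matchings-X X = matchings≡saturatings (S ∖ original (∁ X)) X refl
    (λ h∈ → Sub.x∉∁p⇒x∈p (proj₂ (∈-delete⁻ S (∁ X) ⊥ h∈)))
    (λ v∈ → ∈-delete⁺ S (∁ X) ⊥ Sub.∈⊤ (Sub.x∈p⇒x∉∁p v∈) Sub.∉⊥)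
    where S = whole (subdivision G)

  -- A half-edge along a removed edge starts at a removed vertex. Deleting the vertices e* of the
  -- cycles therefore removes no further half-edges, and what remains are those that start in
  -- `X ─ span G (⋃ C)`.
  matchings-X─C : ∀ X C → span G (⋃ C) ⊆ X →
    matchings (whole (subdivision G) ∖ᴳ subdivide (union G C) ∖ original (∁ X)) (∣ X ∣ ∸ ∣ span G (⋃ C) ∣) ≡
    saturatings (X ─ span G (⋃ C))
  matchings-X─C X C V⊆X = matchings≡saturatings (S′ ∖ original (∁ X)) (X ─ V) (sym (∣p─q∣ X V V⊆X))
    (λ h∈ → let h∈′ , ∉R = ∈-delete⁻ S′ (∁ X) ⊥ h∈ in
      Sub.x∈p∧x∉q⇒x∈p─q (Sub.x∉∁p⇒x∈p ∉R) (proj₂ (∈-delete⁻ S V (⋃ C) h∈′)))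
    (λ {h} v∈ → ∈-delete⁺ S′ (∁ X) ⊥
      (∈-delete⁺ S V (⋃ C) Sub.∈⊤ (p─q∌ X V v∈) (λ e∈ → p─q∌ X V v∈ (span-end h e∈)))
      (Sub.x∈p⇒x∉∁p (Sub.p─q⊆p X V v∈)) Sub.∉⊥)
    where
    S = whole (subdivision G)
    V = span G (⋃ C)
    S′ = S ∖ᴳ subdivide (union G C)

  span-⋃⁻ : ∀ {X} C → span G (⋃ C) ⊆ X → All (λ F → span G F ⊆ X) C
  span-⋃⁻ []      h = []
  span-⋃⁻ (F ∷ C) h = (λ v∈ → h (span-mono (Sub.p⊆p∪q (⋃ C)) v∈)) ∷
    span-⋃⁻ C (λ v∈ → h (span-mono (Sub.q⊆p∪q F (⋃ C)) v∈))

  span-⋃⁺ : ∀ {X} C → All (λ F → span G F ⊆ X) C → span G (⋃ C) ⊆ X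
  span-⋃⁺ []      []      v∈ = contradiction (subst (_ ∈_) span-⊥ v∈) Sub.∉⊥
  span-⋃⁺ (F ∷ C) (h ∷ a) v∈ =
    [ h , span-⋃⁺ C a ]′ (Sub.x∈p∪q⁻ _ _ (subst (_ ∈_) (span-∪ F (⋃ C)) v∈))

  span-⊆-─ : ∀ {Y F F′} → span G F′ ⊆ Y → VertexDisjoint G F F′ → span G F′ ⊆ Y ─ span G F
  span-⊆-─ F′⊆Y dis v∈ = Sub.x∈p∧x∉q⇒x∈p─q (F′⊆Y v∈) (λ v∈F → dis (_ , Sub.x∈p∩q⁺ (v∈F , v∈)))

  spans-⊆-─ : ∀ {Y F C} → All (VertexDisjoint G F) C → All (λ F′ → span G F′ ⊆ Y) C →
              All (λ F′ → span G F′ ⊆ Y ─ span G F) C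
  spans-⊆-─ []         []         = []
  spans-⊆-─ (dis ∷ ds) (⊆Y ∷ ⊆Ys) = span-⊆-─ ⊆Y dis ∷ spans-⊆-─ ds ⊆Ys

  -- Disjointness from `F` is containment in the complement of its span, to which `span-⋃⁺` applies.
  disjoint-⋃ : ∀ {F} C → All (VertexDisjoint G F) C → ∀ {v} → v ∈ span G F → v ∉ span G (⋃ C)
  disjoint-⋃ {F} C dis {v} v∈F v∈C = p─q∌ ⊤ (span G F)
    (span-⋃⁺ {X = ⊤ ─ span G F} C (All.map (λ d {v} → span-⊆-─ Sub.⊆⊤ d {v}) dis) v∈C) v∈F

  good⇒disjoint : ∀ {X M} C → Saturating X M → All (IsCycle G) C → Unique C → All (Good X M) C →
                  AllPairs (VertexDisjoint G) C
  good⇒disjoint []      sat _          _          _          = []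
  good⇒disjoint (F ∷ C) sat (cyc ∷ cs) (F≢ ∷ !C) (good ∷ gs) =
    All.tabulate (λ F′∈ → good-disjoint cyc (All.lookup cs F′∈) sat good (All.lookup gs F′∈) (All.lookup F≢ F′∈))
    ∷ good⇒disjoint C sat cs !C gs

-- Weighted counts of the matchings that trace given cycles

module OrientationSums {a ℓ} (R : CommutativeRing a ℓ) {n m : ℕ} (G : Graph n m)
                 (c : Fin m → CommutativeRing.Carrier R) where

  open Weights R public
  open Splitting G
  open Deletion G
  open Orientation
  open TwoOrientations

  c* : Half → Carrier
  c* = subdivisionWeights c

  w : Subset (m ℕ.+ m) → Carrier
  w = weight c*

  c*≡ : ∀ h → c* h ≡ c (edge h)
  c*≡ h with splitAt m h
  ... | inj₁ _ = refl
  ... | inj₂ _ = refl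

  weight-orientation : ∀ {F O} → Orientation F O → w O ≈ weight c F
  weight-orientation {F} {O} or = ≈-trans (weight-cong O (λ h → ≈-reflexive (c*≡ h)))
    (weight-bijection c O F edge (edge∈ or) (edge-inj (saturating or)) (onto or))

  orientedBy : Subset n → List (Subset m) → Carrier
  orientedBy Y C = ∑ (saturatings Y) (λ M → [[ All.all? (orients? M) C ]] * w M)

  -- Reindexing by `O ∪_`: the weight splits off `weight c F`, and the cycles of `C`, being disjoint
  -- from `F`, are traced by `O ∪ M` exactly when `M` traces them.
  fix-orientation : ∀ {F O Y} C → Orientation F O → span G F ⊆ Y → All (VertexDisjoint G F) C →
    ∑ (saturatings Y) (λ M → [[ O ⊆? M ]] * ([[ All.all? (orients? M) C ]] * w M)) ≈
    weight c F * orientedBy (Y ─ span G F) C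
  fix-orientation {F} {O} {Y} C or F⊆Y dis = ≈-sym (begin
    weight c F * orientedBy Y′ C
      ≈⟨ ∑-*ˡ _ (saturatings Y′) _ ⟩
    ∑ (saturatings Y′) (λ M → weight c F * ([[ All.all? (orients? M) C ]] * w M))
      ≈⟨ ∑-bijection (O ∪_) (saturatings-! Y′) (Unique.filter⁺ (O ⊆?_) (saturatings-! Y)) into inj surj weights ⟩
    ∑ (filter (O ⊆?_) (saturatings Y)) (λ M → [[ All.all? (orients? M) C ]] * w M)
      ≈⟨ ∑-filter (O ⊆?_) (saturatings Y) _ ⟩
    ∑ (saturatings Y) (λ M → [[ O ⊆? M ]] * ([[ All.all? (orients? M) C ]] * w M)) ∎)
    where
    Y′ = Y ─ span G F

    into : ∀ {M} → M ∈ᴸ saturatings Y′ → O ∪ M ∈ᴸ filter (O ⊆?_) (saturatings Y)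
    into {M} M∈ = ∈ᴸ.∈-filter⁺ (O ⊆?_) (∈-saturatings⁺ (saturating-∪ or F⊆Y (∈-saturatings⁻ M∈))) (Sub.p⊆p∪q M)

    inj : ∀ {M M′} → M ∈ᴸ saturatings Y′ → M′ ∈ᴸ saturatings Y′ → O ∪ M ≡ O ∪ M′ → M ≡ M′
    inj M∈ M′∈ = ∪-cancel or F⊆Y (∈-saturatings⁻ M∈) (∈-saturatings⁻ M′∈)

    surj : ∀ {M} → M ∈ᴸ filter (O ⊆?_) (saturatings Y) → ∃ λ M′ → M′ ∈ᴸ saturatings Y′ × O ∪ M′ ≡ M
    surj {M} M∈ with M∈′ , O⊆M ← ∈ᴸ.∈-filter⁻ (O ⊆?_) {xs = saturatings Y} M∈ =
      M ─ O , ∈-saturatings⁺ (saturating-─ or F⊆Y (∈-saturatings⁻ M∈′) O⊆M) , ∪-─ or F⊆Y O⊆M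

    weights : ∀ {M} → M ∈ᴸ saturatings Y′ → weight c F * ([[ All.all? (orients? M) C ]] * w M) ≈
              [[ All.all? (orients? (O ∪ M)) C ]] * w (O ∪ M)
    weights {M} M∈ = begin
      weight c F * ([[ All.all? (orients? M) C ]] * w M)
        ≈⟨ *-solve 3 (λ a b d → (a :* (b :* d)) :≈ (b :* (a :* d))) ≈-refl _ _ _ ⟩
      [[ All.all? (orients? M) C ]] * (weight c F * w M)
        ≈⟨ *-cong
             ([[]]-cong (All.all? (orients? M) C) (All.all? (orients? (O ∪ M)) C)
               (λ o → All.zipWith (λ (d , o) → orients-∪⁺ or F⊆Y d o) (dis , o)) (All.map (orients-∪⁻ or F⊆Y)))
             (≈-trans (*-congʳ (≈-sym (weight-orientation or)))
               (≈-sym (weight-∪ c* O M (λ h∈O h∈M → ∉-orientation or F⊆Y (∈-saturatings⁻ M∈) h∈M h∈O)))) ⟩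
      [[ All.all? (orients? (O ∪ M)) C ]] * w (O ∪ M) ∎

  -- To trace `F` is to contain exactly one of its two orientations, and both contribute the same
  -- amount.
  orientedBy-∷ : ∀ {F Y} C → IsCycle G F → span G F ⊆ Y → All (VertexDisjoint G F) C →
    orientedBy Y (F ∷ C) ≈ (1# + 1#) * weight c F * orientedBy (Y ─ span G F) C
  orientedBy-∷ {F} {Y} C cyc F⊆Y dis = begin
    orientedBy Y (F ∷ C)
      ≈⟨ ∑-cong (saturatings Y) split ⟩
    ∑ (saturatings Y) (λ M → [[ O₀ two ⊆? M ]] * rest M + [[ O₁ two ⊆? M ]] * rest M)
      ≈⟨ ∑-+ (saturatings Y) _ _ ⟩
    ∑ (saturatings Y) (λ M → [[ O₀ two ⊆? M ]] * rest M) + ∑ (saturatings Y) (λ M → [[ O₁ two ⊆? M ]] * rest M)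
      ≈⟨ +-cong (fix-orientation C (orientation₀ two) F⊆Y dis) (fix-orientation C (orientation₁ two) F⊆Y dis) ⟩
    x + x                                                   ≈⟨ +-cong (*-identityˡ x) (*-identityˡ x) ⟨
    1# * x + 1# * x                                         ≈⟨ distribʳ x 1# 1# ⟨
    (1# + 1#) * x                                           ≈⟨ *-assoc _ _ _ ⟨
    (1# + 1#) * weight c F * orientedBy (Y ─ span G F) C    ∎
    where
    two = twoOrientations cyc
    rest = λ M → [[ All.all? (orients? M) C ]] * w M
    x = weight c F * orientedBy (Y ─ span G F) C

    split : ∀ {M} → M ∈ᴸ saturatings Y → [[ All.all? (orients? M) (F ∷ C) ]] * w M ≈
            [[ O₀ two ⊆? M ]] * rest M + [[ O₁ two ⊆? M ]] * rest M
    split {M} M∈ = begin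
      [[ All.all? (orients? M) (F ∷ C) ]] * w M
        ≈⟨ *-congʳ (all-∷ (orients? M) F C) ⟩
      [[ orients? M F ]] * [[ All.all? (orients? M) C ]] * w M
        ≈⟨ *-assoc _ _ _ ⟩
      [[ orients? M F ]] * rest M
        ≈⟨ *-congʳ (≈-trans
             ([[]]-cong (orients? M F) ((O₀ two ⊆? M) ⊎-dec (O₁ two ⊆? M)) (exhaustive two sat F⊆Y)
               [ orients⁺ (orientation₀ two) sat , orients⁺ (orientation₁ two) sat ]′)
             ([[]]-⊎ (O₀ two ⊆? M) (O₁ two ⊆? M) (not-both two sat))) ⟩
      ([[ O₀ two ⊆? M ]] + [[ O₁ two ⊆? M ]]) * rest M
        ≈⟨ distribʳ _ _ _ ⟩
      [[ O₀ two ⊆? M ]] * rest M + [[ O₁ two ⊆? M ]] * rest M ∎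
      where sat = ∈-saturatings⁻ M∈

  orientedBy≈ : ∀ Y C → All (IsCycle G) C → AllPairs (VertexDisjoint G) C → All (λ F → span G F ⊆ Y) C →
    orientedBy Y C ≈ (1# + 1#) ^ length C * weight c (⋃ C) * ∑ (saturatings (Y ─ span G (⋃ C))) w
  orientedBy≈ Y [] _ _ _ = begin
    orientedBy Y []                             ≈⟨ ∑-cong (saturatings Y) (λ _ → *-identityˡ _) ⟩
    ∑ (saturatings Y) w                         ≡⟨ cong (λ Y → ∑ (saturatings Y) w)
                                                     (trans (cong (Y ─_) span-⊥) (Sub.p─⊥≡p Y)) ⟨
    s                                           ≈⟨ *-identityˡ s ⟨
    1# * s                                      ≈⟨ *-congʳ (≈-trans (*-identityˡ _) (weight-⊥ c)) ⟨
    1# * weight c ⊥ * s                         ∎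
    where s = ∑ (saturatings (Y ─ span G ⊥)) w
  orientedBy≈ Y (F ∷ C) (cyc ∷ cs) (dis ∷ ds) (F⊆Y ∷ ⊆Y) = begin
    orientedBy Y (F ∷ C)
      ≈⟨ orientedBy-∷ C cyc F⊆Y dis ⟩
    (1# + 1#) * weight c F * orientedBy (Y ─ span G F) C
      ≈⟨ *-congˡ (orientedBy≈ (Y ─ span G F) C cs ds
           (spans-⊆-─ dis ⊆Y)) ⟩
    (1# + 1#) * weight c F * ((1# + 1#) ^ length C * weight c (⋃ C) * ∑ (saturatings (Y ─ span G F ─ span G (⋃ C))) w)
      ≈⟨ *-solve 5 (λ t f p u s → ((t :* f) :* ((p :* u) :* s)) :≈ (((t :* p) :* (f :* u)) :* s)) ≈-refl _ _ _ _ _ ⟩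
    (1# + 1#) * (1# + 1#) ^ length C * (weight c F * weight c (⋃ C)) * ∑ (saturatings (Y ─ span G F ─ span G (⋃ C))) w
      ≈⟨ *-cong (*-congˡ (≈-sym (weight-∪ c F (⋃ C) edge-disjoint)))
           (≈-reflexive (cong (λ Y → ∑ (saturatings Y) w)
             (trans (Sub.p─q─r≡p─q∪r Y _ _) (cong (Y ─_) (sym (span-∪ F (⋃ C))))))) ⟩
    (1# + 1#) ^ suc (length C) * weight c (F ∪ ⋃ C) * ∑ (saturatings (Y ─ span G (F ∪ ⋃ C))) w ∎
    where
    edge-disjoint : ∀ {e} → e ∈ F → e ∉ ⋃ C
    edge-disjoint {e} e∈F e∈C with h , _ , _ , refl ← halfOf {e = e} (inj₁ (refl , refl)) =
      disjoint-⋃ C dis (span-end h e∈F) (span-end h e∈C)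

-- The Laplacian minor as a signed sum over saturating matchings

module LaplacianDeterminant {a ℓ} (R : CommutativeRing a ℓ) {n m : ℕ} (G : Graph n m)
                 (c : Fin m → CommutativeRing.Carrier R) where

  open Splitting G
  open Deletion G
  open OrientationSums R G c

  -- The Laplacian is ∑ₑ cₑ bₑ bₑᵀ, with bₑ the difference of the two ends of e.
  row : Half → Fin n → Carrier
  row h v = [[ end h Fin.≟ v ]] + - [[ other h Fin.≟ v ]]

  module _ (x : Carrier) {P Q : Set} where

    1*[x*1-0] : 1# * (x * (1# + - 0#)) ≈ x
    1*[x*1-0] = ≈-trans (*-identityˡ _) (≈-trans (*-congˡ (x+-0≈x ≈-refl)) (*-identityʳ x))

    1*[x*0-1] : 1# * (x * (0# + - 1#)) ≈ - x
    1*[x*0-1] = ≈-trans (*-identityˡ _) (≈-trans (*-congˡ (+-identityˡ _))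
      (≈-trans (*-comm _ _) (-1*x≈-x x)))

    1*[x*0-0] : 1# * (x * (0# + - 0#)) ≈ 0#
    1*[x*0-0] = ≈-trans (*-identityˡ _) (≈-trans (*-congˡ (x+-0≈x ≈-refl)) (zeroʳ x))

    diagonal : (P? : Dec P) (Q? : Dec Q) → (P → ¬ Q) →
      [[ P? ]] * (x * ([[ P? ]] + - [[ Q? ]])) + [[ Q? ]] * (x * ([[ Q? ]] + - [[ P? ]])) ≈
      (if does (P? ⊎-dec Q?) then x else 0#)
    diagonal (yes p) (yes q) h = contradiction q (h p)
    diagonal (yes p) (no ¬q) _ = ≈-trans (+-cong 1*[x*1-0] (zeroˡ _)) (+-identityʳ x)
    diagonal (no ¬p) (yes q) _ = ≈-trans (+-cong (zeroˡ _) 1*[x*1-0]) (+-identityˡ x)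
    diagonal (no ¬p) (no ¬q) _ = ≈-trans (+-cong (zeroˡ _) (zeroˡ _)) (+-identityˡ 0#)

    -- For one edge, `P`, `Q`, `P′`, `Q′` are to be read as lo = u, hi = v, lo = v, hi = u. The
    -- first two exclusions come from u ≠ v, the last from lo ≠ hi.
    off-diagonal : ∀ {P′ Q′ : Set} (P? : Dec P) (Q? : Dec Q) (P′? : Dec P′) (Q′? : Dec Q′) →
      (P → ¬ P′) → (Q → ¬ Q′) → (P → ¬ Q′) →
      [[ P? ]] * (x * ([[ P′? ]] + - [[ Q? ]])) + [[ Q′? ]] * (x * ([[ Q? ]] + - [[ P′? ]])) ≈
      (if does ((P? ×-dec Q?) ⊎-dec (P′? ×-dec Q′?)) then - x else 0#)
    off-diagonal (yes p) Q?      (yes p′) Q′?      h _ _ = contradiction p′ (h p)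
    off-diagonal (yes p) Q?      (no _)   (yes q′) _ _ h = contradiction q′ (h p)
    off-diagonal (yes p) (yes _) (no _)   (no _)   _ _ _ = ≈-trans (+-cong 1*[x*0-1] (zeroˡ _)) (+-identityʳ _)
    off-diagonal (yes p) (no _)  (no _)   (no _)   _ _ _ = ≈-trans (+-cong 1*[x*0-0] (zeroˡ _)) (+-identityʳ _)
    off-diagonal (no _)  (yes q) P′?      (yes q′) _ h _ = contradiction q′ (h q)
    off-diagonal (no _)  (no _)  (yes _)  (yes _)  _ _ _ = ≈-trans (+-cong (zeroˡ _) 1*[x*0-1]) (+-identityˡ _)
    off-diagonal (no _)  (no _)  (no _)   (yes _)  _ _ _ = ≈-trans (+-cong (zeroˡ _) 1*[x*0-0]) (+-identityˡ _)
    off-diagonal (no _)  Q?      (yes _)  (no _)   _ _ _ = ≈-trans (+-cong (zeroˡ _) (zeroˡ _)) (+-identityˡ 0#)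
    off-diagonal (no _)  Q?      (no _)   (no _)   _ _ _ = ≈-trans (+-cong (zeroˡ _) (zeroˡ _)) (+-identityˡ 0#)

  sum-halves : ∀ u v → ∑ (filter (λ h → end h Fin.≟ u) (allFin (m ℕ.+ m))) (λ h → c* h * row h v) ≈
    sum (λ e → [[ lo G e Fin.≟ u ]] * (c e * ([[ lo G e Fin.≟ v ]] + - [[ hi G e Fin.≟ v ]])) +
               [[ hi G e Fin.≟ u ]] * (c e * ([[ hi G e Fin.≟ v ]] + - [[ lo G e Fin.≟ v ]])))
  sum-halves u v = begin
    ∑ (filter (λ h → end h Fin.≟ u) (allFin (m ℕ.+ m))) (λ h → c* h * row h v)
      ≈⟨ ∑-filter (λ h → end h Fin.≟ u) (allFin (m ℕ.+ m)) _ ⟩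
    ∑ (allFin (m ℕ.+ m)) f
      ≈⟨ ∑-tabulate id f ⟩
    sum f
      ≈⟨ sum-↑ {m} f ⟩
    sum (λ e → f (e ↑ˡ m)) + sum (λ e → f (m ↑ʳ e))
      ≈⟨ +-cong (sum-cong-≋ {x = λ e → f (e ↑ˡ m)} (λ e → ≈-reflexive (cong g (Fin.splitAt-↑ˡ m e m))))
                (sum-cong-≋ {x = λ e → f (m ↑ʳ e)} (λ e → ≈-reflexive (cong g (Fin.splitAt-↑ʳ m m e)))) ⟩
    sum (λ e → g (inj₁ e)) + sum (λ e → g (inj₂ e))
      ≈⟨ ∑-distrib-+ (λ e → g (inj₁ e)) (λ e → g (inj₂ e)) ⟨
    sum (λ e → g (inj₁ e) + g (inj₂ e)) ∎
    where
    g : Fin m ⊎ Fin m → Carrier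
    g s = [[ [ lo G , hi G ]′ s Fin.≟ u ]] * ([ c , c ]′ s *
            ([[ [ lo G , hi G ]′ s Fin.≟ v ]] + - [[ [ hi G , lo G ]′ s Fin.≟ v ]]))

    f : Half → Carrier
    f h = [[ end h Fin.≟ u ]] * (c* h * row h v)

  laplacian-rows : ∀ u v → laplacian G c u v ≈
    ∑ (filter (λ h → end h Fin.≟ u) (allFin (m ℕ.+ m))) (λ h → c* h * row h v)
  laplacian-rows u v = ≈-trans entry (≈-sym (sum-halves u v))
    where
    lo≢hi : ∀ e {u} → lo G e ≡ u → hi G e ≢ u
    lo≢hi e p q = Fin.<⇒≢ (lo<hi G e) (trans p (sym q))

    f : Fin m → Carrier
    f e = [[ lo G e Fin.≟ u ]] * (c e * ([[ lo G e Fin.≟ v ]] + - [[ hi G e Fin.≟ v ]])) +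
          [[ hi G e Fin.≟ u ]] * (c e * ([[ hi G e Fin.≟ v ]] + - [[ lo G e Fin.≟ v ]]))

    joined : u ≢ v → ∀ e → f e ≈ (if does (joins? G e u v) then - c e else 0#)
    joined u≢v e = off-diagonal (c e) (lo G e Fin.≟ u) (hi G e Fin.≟ v) (lo G e Fin.≟ v) (hi G e Fin.≟ u)
      (λ p q → u≢v (trans (sym p) q)) (λ p q → u≢v (trans (sym q) p)) (lo≢hi e)

    if-yes : ∀ {P : Set} (P? : Dec P) {x} → P → (if does P? then x else 0#) ≈ x
    if-yes P? p rewrite dec-true P? p = ≈-refl

    if-no : ∀ {P : Set} (P? : Dec P) {x} → ¬ P → (if does P? then x else 0#) ≈ 0#
    if-no P? ¬p rewrite dec-false P? ¬p = ≈-refl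

    entry : laplacian G c u v ≈ sum f
    entry with u Fin.≟ v
    ... | yes refl = ≈-sym (sum-cong-≋ {x = f} λ e →
            diagonal (c e) (lo G e Fin.≟ u) (hi G e Fin.≟ u) (lo≢hi e))
    ... | no u≢v with any? (λ e → joins? G e u v)
    -- Simplicity makes `e` the only edge between `u` and `v`, so a single summand survives.
    ...   | yes (e , j) = ≈-sym (≈-trans (sum-only e λ f f≢e → ≈-trans (joined u≢v f)
              (if-no (joins? G f u v) λ j′ → f≢e (joins-unique j′ j)))
            (≈-trans (joined u≢v e) (if-yes (joins? G e u v) j)))
    ...   | no none = ≈-sym (sum-zero λ e → ≈-trans (joined u≢v e) (if-no (joins? G e u v) λ j → none (e , j)))

  ∏≈weight : ∀ {q k} (d : Fin q → Carrier) (φ : Vec (Fin q) k) →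
             (∀ {i j} → lookup φ i ≡ lookup φ j → i ≡ j) → ∏ d φ ≈ weight d (fromVec φ)
  ∏≈weight d []      inj = ≈-sym (weight-⊥ d)
  ∏≈weight d (h ∷ φ) inj = ≈-sym (≈-trans
    (weight-∪ d ⁅ h ⁆ (fromVec φ) λ e∈ e∈′ → case ∈-fromVec⁻ φ e∈′ of λ where
      (i , eq) → case inj {zero} {suc i} (sym (trans eq (Sub.x∈⁅y⁆⇒x≡y h e∈))) of λ ())
    (*-cong (weight-⁅⁆ d h) (≈-sym (∏≈weight d φ (Fin.suc-injective ∘ inj)))))

  signed : Subset n → Subset (m ℕ.+ m) → Carrier
  signed X M = alternating (good? X M) (cycles G)

  module _ (X : Subset n) where

    private
      k = ∣ X ∣

      x : Fin k → Fin n
      x = lookup (elements X)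

      x-inj : ∀ {i j} → x i ≡ x j → i ≡ j
      x-inj = elements-injective X

      H : Fin k → List Half
      H i = filter (λ h → end h Fin.≟ x i) (allFin (m ℕ.+ m))

      Selection : Vec Half k → Set
      Selection φ = ∀ i → end (lookup φ i) ≡ x i

      ∈H⁻ : ∀ φ → φ ∈ᴸ choices H → Selection φ
      ∈H⁻ φ φ∈ i = proj₂ (∈ᴸ.∈-filter⁻ (λ h → end h Fin.≟ x i) {xs = allFin (m ℕ.+ m)} (∈-choices⁻ H φ∈ i))

      ∈H⁺ : ∀ φ → Selection φ → φ ∈ᴸ choices H
      ∈H⁺ φ s = ∈-choices⁺ H φ λ i → ∈ᴸ.∈-filter⁺ (λ h → end h Fin.≟ x i) (∈ᴸ.∈-allFin _) (s i)

      Repeats : Vec Half k → Set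
      Repeats φ = ∃₂ λ i j → edge (lookup φ i) ≡ edge (lookup φ j) × i ≢ j

      repeats? : Decidable Repeats
      repeats? φ = any? λ i → any? λ j → (edge (lookup φ i) Fin.≟ edge (lookup φ j)) ×-dec ¬? (i Fin.≟ j)

      distinct : ∀ φ → ¬ Repeats φ → ∀ {i j} → edge (lookup φ i) ≡ edge (lookup φ j) → i ≡ j
      distinct φ ¬r {i} {j} eq = case i Fin.≟ j of λ where
        (yes i≡j) → i≡j
        (no  i≢j) → contradiction (i , j , eq , i≢j) ¬r

      next-vertex : Vec Half k → Fin k → Fin n
      next-vertex φ i = other (lookup φ i)

      det-selection : ∀ φ → Selection φ →
        det (λ i j → row (lookup φ i) (x j)) ≈ det (functional x (next-vertex φ))
      det-selection φ s = det-cong {A = λ i j → row (lookup φ i) (x j)} {B = functional x (next-vertex φ)}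
        λ i j → +-congʳ ([[]]-cong (end (lookup φ i) Fin.≟ x j) (i Fin.≟ j)
          (λ eq → x-inj (trans (sym (s i)) eq)) (λ eq → trans (s i) (cong x eq)))

      -- Distinct vertices that select the same edge are its two ends. Each points to the other, and
      -- the pair is a set that the walk cannot leave.
      det-repeats : ∀ φ → Selection φ → Repeats φ → det (functional x (next-vertex φ)) ≈ 0#
      det-repeats φ s (i , j , eq , i≢j) =
        det-closed x (next-vertex φ) x-inj (λ a → a ≡ i ⊎ a ≡ j) (i , inj₁ refl) λ where
          (inj₁ refl) → j , crossed i j eq i≢j , inj₂ refl
          (inj₂ refl) → i , crossed j i (sym eq) (i≢j ∘ sym) , inj₁ refl
        where
        crossed : ∀ i j → edge (lookup φ i) ≡ edge (lookup φ j) → i ≢ j → other (lookup φ i) ≡ x j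
        crossed i j eq i≢j = case same-edge eq of λ where
          (inj₁ (p , _)) → contradiction (x-inj (trans (sym (s i)) (trans p (s j)))) i≢j
          (inj₂ (_ , q)) → trans q (s j)

      det-good : ∀ φ {F} → Selection φ → IsCycle G F → Good X (fromVec φ) F →
                 det (functional x (next-vertex φ)) ≈ 0#
      det-good φ {F} s cyc (o , F⊆X) = det-closed x (next-vertex φ) x-inj (λ i → x i ∈ span G F)
        (let v , v∈ = TwoOrientations.nonempty (twoOrientations cyc)
             i , eq = elements-surjective X (F⊆X v∈) in i , subst (_∈ span G F) (sym eq) v∈)
        λ {i} i∈ →
          let next∈ = span-closed o (∈-fromVec⁺ φ i) (subst (_∈ span G F) (sym (s i)) i∈)
              j , eq = elements-surjective X (F⊆X next∈) in
          j , sym eq , subst (_∈ span G F) (sym eq) next∈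

      ∈cycles⁻ : ∀ {F} → F ∈ᴸ cycles G → IsCycle G F
      ∈cycles⁻ F∈ = proj₂ (∈ᴸ.∈-filter⁻ (isCycle? G) {xs = subsets m} F∈)

      -- If a cycle inside `X` is traced, both sides vanish. Otherwise there is no orbit, since an
      -- orbit would give such a cycle; then every walk leaves `X`, and both sides are one.
      det≈signed : ∀ φ → Selection φ → ¬ Repeats φ →
                   det (functional x (next-vertex φ)) ≈ signed X (fromVec φ)
      det≈signed φ s ¬r = decide (Any.any? (good? X M) (cycles G))
        where
        M = fromVec φ

        no-cycle : ¬ Any.Any (Good X M) (cycles G) → ¬ Orbit x (next-vertex φ)
        no-cycle none orbit =
          let F , cyc , good = orbit⇒cycle x x-inj (elements∈ X) φ s (distinct φ ¬r) orbit in
          none (lose (∈ᴸ.∈-filter⁺ (isCycle? G) (∈-subsets F) cyc) good)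

        decide : Dec (Any.Any (Good X M) (cycles G)) → det (functional x (next-vertex φ)) ≈ signed X M
        decide (yes some) = let F , F∈ , good = find some in
          ≈-trans (det-good φ s (∈cycles⁻ F∈) good) (≈-sym (alternating-some (good? X M) (cycles G) F∈ good))
        decide (no none) = ≈-trans
          (det-reach x (next-vertex φ) x-inj
            ([ id , (λ orbit → contradiction orbit (no-cycle none)) ]′ (reach-or-orbit x (next-vertex φ))))
          (≈-sym (alternating-none (good? X M) (cycles G) (¬Any⇒All¬ _ none)))

      selection⇒saturating : ∀ φ → Selection φ → ¬ Repeats φ → Saturating X (fromVec φ)
      selection⇒saturating φ s ¬r = record
        { end∈     = λ h∈ → case ∈-fromVec⁻ φ h∈ of λ where
            (i , refl) → subst (_∈ X) (sym (s i)) (elements∈ X i)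
        ; end-inj  = λ h∈ h′∈ eq → case (∈-fromVec⁻ φ h∈ , ∈-fromVec⁻ φ h′∈) of λ where
            ((i , refl) , (j , refl)) → cong (lookup φ) (x-inj (trans (sym (s i)) (trans eq (s j))))
        ; edge-inj = λ h∈ h′∈ eq → case (∈-fromVec⁻ φ h∈ , ∈-fromVec⁻ φ h′∈) of λ where
            ((i , refl) , (j , refl)) → cong (lookup φ) (distinct φ ¬r eq)
        ; covers   = λ v∈ → case elements-surjective X v∈ of λ where
            (i , eq) → lookup φ i , ∈-fromVec⁺ φ i , trans (s i) eq
        }

      fromVec-injective : ∀ {φ ψ} → Selection φ → Selection ψ → fromVec φ ≡ fromVec ψ → φ ≡ ψ
      fromVec-injective {φ} {ψ} s t eq = trans (sym (Vec.tabulate∘lookup φ))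
        (trans (Vec.tabulate-cong pointwise) (Vec.tabulate∘lookup ψ))
        where
        pointwise : ∀ i → lookup φ i ≡ lookup ψ i
        pointwise i with j , p ← ∈-fromVec⁻ ψ (subst (lookup φ i ∈_) eq (∈-fromVec⁺ φ i)) =
          trans (sym p) (cong (lookup ψ) (x-inj (trans (sym (t j)) (trans (cong end p) (s i)))))

      saturating⇒selection : ∀ {M} → Saturating X M → ∃ λ φ → Selection φ × ¬ Repeats φ × fromVec φ ≡ M
      saturating⇒selection {M} sat = φ , s , ¬r , Sub.⊆-antisym ⇒ ⇐
        where
        cover : ∀ i → ∃ λ h → h ∈ M × end h ≡ x i
        cover i = covers sat (elements∈ X i)

        φ = Vec.tabulate (λ i → proj₁ (cover i))

        φ-lookup : ∀ i → lookup φ i ≡ proj₁ (cover i)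
        φ-lookup = Vec.lookup∘tabulate (λ i → proj₁ (cover i))

        φ∈M : ∀ i → lookup φ i ∈ M
        φ∈M i = subst (_∈ M) (sym (φ-lookup i)) (proj₁ (proj₂ (cover i)))

        s : Selection φ
        s i = trans (cong end (φ-lookup i)) (proj₂ (proj₂ (cover i)))

        ¬r : ¬ Repeats φ
        ¬r (i , j , eq , i≢j) = i≢j (x-inj (trans (sym (s i))
          (trans (cong end (edge-inj sat (φ∈M i) (φ∈M j) eq)) (s j))))

        ⇒ : fromVec φ ⊆ M
        ⇒ h∈ with i , refl ← ∈-fromVec⁻ φ h∈ = φ∈M i

        ⇐ : M ⊆ fromVec φ
        ⇐ h∈ with i , eq ← elements-surjective X (end∈ sat h∈) =
          subst (_∈ fromVec φ) (end-inj sat (φ∈M i) h∈ (trans (s i) eq)) (∈-fromVec⁺ φ i)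

    det-laplacian : det (laplacian G c [ X ]) ≈ ∑ (saturatings X) (λ M → w M * signed X M)
    det-laplacian = begin
      det (laplacian G c [ X ])
        ≈⟨ det-rows H c* (λ h j → row h (x j)) (λ i j → laplacian-rows (x i) (x j)) ⟩
      ∑ (choices H) (λ φ → ∏ c* φ * det (λ i j → row (lookup φ i) (x j)))
        ≈⟨ ∑-cong (choices H) (λ {φ} φ∈ → drop-repeats φ (∈H⁻ φ φ∈)) ⟩
      ∑ (choices H) (λ φ → [[ ¬? (repeats? φ) ]] * (w (fromVec φ) * signed X (fromVec φ)))
        ≈⟨ ∑-filter (¬? ∘ repeats?) (choices H) _ ⟨
      ∑ (filter (¬? ∘ repeats?) (choices H)) (λ φ → w (fromVec φ) * signed X (fromVec φ))
        ≈⟨ ∑-bijection fromVec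
             (Unique.filter⁺ (¬? ∘ repeats?) (choices-! H λ i → Unique.filter⁺ (λ h → end h Fin.≟ x i) (Unique.allFin⁺ (m ℕ.+ m))))
             (saturatings-! X)
             (λ {φ} φ∈ → let φ∈′ , ¬r = ∈distinct⁻ φ∈ in ∈-saturatings⁺ (selection⇒saturating φ (∈H⁻ φ φ∈′) ¬r))
             (λ {φ} {ψ} φ∈ ψ∈ → fromVec-injective (∈H⁻ φ (proj₁ (∈distinct⁻ φ∈))) (∈H⁻ ψ (proj₁ (∈distinct⁻ ψ∈))))
             (λ M∈ → let φ , s , ¬r , eq = saturating⇒selection (∈-saturatings⁻ M∈) in
               φ , ∈ᴸ.∈-filter⁺ (¬? ∘ repeats?) (∈H⁺ φ s) ¬r , eq)
             (λ _ → ≈-refl) ⟩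
      ∑ (saturatings X) (λ M → w M * signed X M) ∎
      where
      ∈distinct⁻ : ∀ {φ} → φ ∈ᴸ filter (¬? ∘ repeats?) (choices H) → φ ∈ᴸ choices H × ¬ Repeats φ
      ∈distinct⁻ = ∈ᴸ.∈-filter⁻ (¬? ∘ repeats?) {xs = choices H}

      drop-repeats : ∀ φ → Selection φ → ∏ c* φ * det (λ i j → row (lookup φ i) (x j)) ≈
                     [[ ¬? (repeats? φ) ]] * (w (fromVec φ) * signed X (fromVec φ))
      drop-repeats φ s = by (repeats? φ)
        where
        by : Dec (Repeats φ) → ∏ c* φ * det (λ i j → row (lookup φ i) (x j)) ≈
             [[ ¬? (repeats? φ) ]] * (w (fromVec φ) * signed X (fromVec φ))
        by (yes r) = ≈-trans (*-congˡ (≈-trans (det-selection φ s) (det-repeats φ s r)))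
          (≈-trans (zeroʳ _) (≈-sym (≈-trans (*-congʳ ([[]]-no (¬? (repeats? φ)) (λ ¬r → ¬r r))) (zeroˡ _))))
        by (no ¬r) = ≈-trans
          (*-cong (∏≈weight c* φ (λ eq → distinct φ ¬r (cong edge eq))) (≈-trans (det-selection φ s) (det≈signed φ s ¬r)))
          (≈-sym (≈-trans (*-congʳ ([[]]-yes (¬? (repeats? φ)) ¬r)) (*-identityˡ _)))

-- Exchange of the sums over matchings and over families of cycles

module SignedSum {a ℓ} (R : CommutativeRing a ℓ) {n m : ℕ} (G : Graph n m)
                 (c : Fin m → CommutativeRing.Carrier R) (X : Subset n) where

  open Splitting G
  open Deletion G
  open OrientationSums R G c
  open LaplacianDeterminant R G c

  sign : Subset (m ℕ.+ m) → List (Subset m) → Carrier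
  sign M C = [[ All.all? (good? X M) C ]] * ε ^ length C

  signedTerm : List (Subset m) → Carrier
  signedTerm C = ∑ (saturatings X) (λ M → w M * sign M C)

  S : Subgraph (subdivision G)
  S = whole (subdivision G)

  cycleTerm : List (Subset m) → Carrier
  cycleTerm C = (- (1# + 1#)) ^ length C * weight c (⋃ C) *
    matchingSum c* (S ∖ᴳ subdivide (union G C) ∖ original (∁ X)) (∣ X ∣ ∸ ∣ span G (⋃ C) ∣)

  det≈signedTerms : det (laplacian G c [ X ]) ≈ ∑ (sublists (cycles G)) signedTerm
  det≈signedTerms = begin
    det (laplacian G c [ X ])
      ≈⟨ det-laplacian X ⟩
    ∑ (saturatings X) (λ M → w M * signed X M)
      ≈⟨ ∑-cong (saturatings X) (λ {M} _ → ∑-*ˡ (w M) (sublists (cycles G)) (sign M)) ⟩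
    ∑ (saturatings X) (λ M → ∑ (sublists (cycles G)) (λ C → w M * sign M C))
      ≈⟨ ∑-swap (saturatings X) (sublists (cycles G)) (λ M C → w M * sign M C) ⟩
    ∑ (sublists (cycles G)) signedTerm ∎

  signedTerm-[] : signedTerm [] ≈ matchingSum c* (S ∖ original (∁ X)) ∣ X ∣
  signedTerm-[] = begin
    signedTerm []         ≈⟨ ∑-cong (saturatings X) (λ _ → ≈-trans (*-congˡ (*-identityˡ 1#)) (*-identityʳ _)) ⟩
    ∑ (saturatings X) w   ≡⟨ cong (λ Ms → ∑ Ms w) (matchings-X X) ⟨
    matchingSum c* (S ∖ original (∁ X)) ∣ X ∣ ∎

  -2^ : ∀ p → (- (1# + 1#)) ^ p ≈ ε ^ p * (1# + 1#) ^ p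
  -2^ zero    = ≈-sym (*-identityˡ 1#)
  -2^ (suc p) = ≈-trans (*-cong (≈-sym (-1*x≈-x (1# + 1#))) (-2^ p))
    (*-solve 4 (λ e t x y → ((e :* t) :* (x :* y)) :≈ ((e :* x) :* (t :* y))) ≈-refl _ _ _ _)

  signedTerm≈cycleTerm : ∀ C → All (IsCycle G) C → AllPairs (VertexDisjoint G) C → span G (⋃ C) ⊆ X →
                         signedTerm C ≈ cycleTerm C
  signedTerm≈cycleTerm C cyc dis V⊆X = begin
    signedTerm C
      ≈⟨ ∑-cong (saturatings X) (λ {M} _ → ≈-trans
           (*-congˡ (*-congʳ ([[]]-cong (All.all? (good? X M) C) (All.all? (orients? M) C)
             (All.map proj₁) (λ o → All.zip (o , span-⋃⁻ C V⊆X)))))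
           (*-solve 3 (λ w o s → (w :* (o :* s)) :≈ (s :* (o :* w))) ≈-refl _ _ _)) ⟩
    ∑ (saturatings X) (λ M → ε ^ length C * ([[ All.all? (orients? M) C ]] * w M))
      ≈⟨ ∑-*ˡ _ (saturatings X) _ ⟨
    ε ^ length C * orientedBy X C
      ≈⟨ *-congˡ (orientedBy≈ X C cyc dis (span-⋃⁻ C V⊆X)) ⟩
    ε ^ length C * ((1# + 1#) ^ length C * weight c (⋃ C) * ∑ (saturatings (X ─ span G (⋃ C))) w)
      ≈⟨ *-solve 4 (λ e t u s → (e :* ((t :* u) :* s)) :≈ (((e :* t) :* u) :* s)) ≈-refl _ _ _ _ ⟩
    ε ^ length C * (1# + 1#) ^ length C * weight c (⋃ C) * ∑ (saturatings (X ─ span G (⋃ C))) w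
      ≈⟨ *-cong (*-congʳ (≈-sym (-2^ (length C))))
           (≈-reflexive (cong (λ Ms → ∑ Ms w) (sym (matchings-X─C X C V⊆X)))) ⟩
    cycleTerm C ∎

  signedTerm-0 : ∀ C → (∀ {M} → Saturating X M → ¬ All (Good X M) C) → signedTerm C ≈ 0#
  signedTerm-0 C none = ∑-zero (saturatings X) λ {M} M∈ → ≈-trans
    (*-congˡ (≈-trans (*-congʳ ([[]]-no (All.all? (good? X M) C) (none (∈-saturatings⁻ M∈)))) (zeroˡ _)))
    (zeroʳ _)

  -- A family that overlaps or leaves `X` is good for no saturating matching, so its term is zero.
  -- The sum over all sublists thereby acquires the conditions that define the cycle unions inside
  -- `X`.
  signedTerm≈ : ∀ {C} → C ∈ᴸ sublists (cycles G) →
    signedTerm C ≈ [[ allPairs? (vertexDisjoint? G) C ]] * ([[ span G (⋃ C) ⊆? X ]] * cycleTerm C)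
  signedTerm≈ {C} C∈ = by (allPairs? (vertexDisjoint? G) C) (span G (⋃ C) ⊆? X)
    where
    cyc : All (IsCycle G) C
    cyc = ∈-sublists⇒All (cycles G) C∈ (all-filter (isCycle? G) (subsets m))

    !C : Unique C
    !C = ∈-sublists⇒AllPairs (cycles G) C∈ (Unique.filter⁺ (isCycle? G) (subsets-! m))

    by : (dis? : Dec (AllPairs (VertexDisjoint G) C)) (V? : Dec (span G (⋃ C) ⊆ X)) →
         signedTerm C ≈ [[ dis? ]] * ([[ V? ]] * cycleTerm C)
    by (yes dis) (yes V⊆X) = ≈-trans (signedTerm≈cycleTerm C cyc dis V⊆X)
      (≈-sym (≈-trans (*-identityˡ _) (*-identityˡ _)))
    by (yes _)   (no V⊈X)  = ≈-trans
      (signedTerm-0 C λ _ good → V⊈X (span-⋃⁺ C (All.map proj₂ good)))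
      (≈-sym (≈-trans (*-congˡ (zeroˡ _)) (zeroʳ _)))
    by (no ¬dis) _         = ≈-trans
      (signedTerm-0 C λ sat good → ¬dis (good⇒disjoint C sat cyc !C good))
      (≈-sym (zeroˡ _))

  cycle-expansion : det (laplacian G c [ X ]) ≈
    matchingSum c* (S ∖ original (∁ X)) ∣ X ∣ +
    ∑ (filter (λ C → span G (⋃ C) ⊆? X) (cycleUnions G)) cycleTerm
  cycle-expansion = begin
    det (laplacian G c [ X ])
      ≈⟨ det≈signedTerms ⟩
    ∑ (sublists (cycles G)) signedTerm
      ≈⟨ ∑-sublists-nonempty (cycles G) signedTerm ⟩
    signedTerm [] + ∑ (sublists (cycles G)) (λ C → [[ 1 ℕ.≤? length C ]] * signedTerm C)
      ≈⟨ +-cong signedTerm-[] (∑-cong (sublists (cycles G)) λ {C} C∈ → ≈-trans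
           (*-congˡ (signedTerm≈ C∈)) (≈-trans (≈-sym (*-assoc _ _ _))
           (*-congʳ (≈-sym ([[]]-× (1 ℕ.≤? length C) (allPairs? (vertexDisjoint? G) C)))))) ⟩
    matchingSum c* (S ∖ original (∁ X)) ∣ X ∣ +
      ∑ (sublists (cycles G)) (λ C → [[ disjoint? C ]] * ([[ span G (⋃ C) ⊆? X ]] * cycleTerm C))
      ≈⟨ +-congˡ (∑-filter disjoint? (sublists (cycles G)) _) ⟨
    matchingSum c* (S ∖ original (∁ X)) ∣ X ∣ +
      ∑ (cycleUnions G) (λ C → [[ span G (⋃ C) ⊆? X ]] * cycleTerm C)
      ≈⟨ +-congˡ (∑-filter (λ C → span G (⋃ C) ⊆? X) (cycleUnions G) cycleTerm) ⟨
    matchingSum c* (S ∖ original (∁ X)) ∣ X ∣ +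
      ∑ (filter (λ C → span G (⋃ C) ⊆? X) (cycleUnions G)) cycleTerm ∎
    where
    disjoint? : Decidable (λ C → 1 ℕ.≤ length C × AllPairs (VertexDisjoint G) C)
    disjoint? C = (1 ℕ.≤? length C) ×-dec allPairs? (vertexDisjoint? G) C

  -- Replacing the operations of the ring one at a time

  base : Carrier
  base = - (1# + 1#)

  matchingSum* : Subgraph (subdivision G) → ℕ → Carrier
  matchingSum* = matchingSum c*

  determinant : Carrier
  determinant = det (laplacian G c [ X ])

  base-resp : (_+′_ : Carrier → Carrier → Carrier) (-′_ : Carrier → Carrier) (1′ : Carrier) →
    (∀ x y → x + y ≡ x +′ y) → (∀ x → - x ≡ -′ x) → 1# ≡ 1′ → base ≡ -′ (1′ +′ 1′)
  base-resp _+′_ -′_ 1′ +≡ -≡ 1≡ = trans (-≡ _) (cong -′_ (trans (+≡ _ _) (cong₂ _+′_ 1≡ 1≡)))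

  power-resp : (_^′_ : Carrier → ℕ → Carrier) → (∀ x p → x ^ p ≡ x ^′ p) →
    ∀ {b} → base ≡ b → ∀ p → base ^ p ≡ b ^′ p
  power-resp _^′_ ^≡ b≡ p = trans (^≡ _ p) (cong (_^′ p) b≡)

  matchingSum-resp : (μ : (Half → Carrier) → Subgraph (subdivision G) → ℕ → Carrier) →
    (∀ d H j → matchingSum d H j ≡ μ d H j) → ∀ {d} → c* ≡ d → ∀ H j → matchingSum* H j ≡ μ d H j
  matchingSum-resp μ μ≡ d≡ H j = trans (μ≡ c* H j) (cong (λ d → μ d H j) d≡)

  -- The operations are abstracted because conversion between ℝ-terms whose heads
  -- differ η-expands them and compares their Cauchy proofs.  At ℝ, each hypothesis
  -- is checked separately, mostly on variables, where this comparison is cheap.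
  det-expansion :
    (_≈′_ : Carrier → Carrier → Set ℓ) (_+′_ _*′_ : Carrier → Carrier → Carrier)
    (∑′ : List (List (Subset m)) → (List (Subset m) → Carrier) → Carrier)
    (d : Carrier) (p : ℕ → Carrier) (ω : Subset m → Carrier) (μ : Subgraph (subdivision G) → ℕ → Carrier) →
    (∀ {x y} → x ≈ y → x ≈′ y) → (∀ x y → x + y ≡ x +′ y) → (∀ x y → x * y ≡ x *′ y) →
    (∀ xs f → ∑ xs f ≡ ∑′ xs f) → determinant ≡ d → (∀ k → base ^ k ≡ p k) →
    (∀ F → weight c F ≡ ω F) → (∀ H j → matchingSum* H j ≡ μ H j) →
    d ≈′ (μ (whole (subdivision G) ∖ original (∁ X)) ∣ X ∣ +′
      ∑′ (filter (λ C → verts (union G C) ⊆? X) (cycleUnions G))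
        (λ C → (p (#components C) *′ ω (edges (union G C))) *′
          μ (whole (subdivision G) ∖ᴳ subdivide (union G C) ∖ original (∁ X)) (∣ X ∣ ∸ ∣ verts (union G C) ∣)))
  det-expansion _≈′_ _+′_ _*′_ ∑′ d p ω μ ≈⇒ +≡ *≡ ∑≡ d≡ p≡ ω≡ μ≡ =
    subst₂ _≈′_ d≡ (trans (+≡ _ _) (cong₂ _+′_ (μ≡ _ _) (∑≡ Cs terms′))) (≈⇒ (≈-trans cycle-expansion
      (+-congˡ (∑-cong Cs λ {C} _ → ≈-reflexive (term≡ C)))))
    where
    Cs = filter (λ C → span G (⋃ C) ⊆? X) (cycleUnions G)

    terms′ : List (Subset m) → Carrier
    terms′ C = (p (length C) *′ ω (⋃ C)) *′
      μ (S ∖ᴳ subdivide (union G C) ∖ original (∁ X)) (∣ X ∣ ∸ ∣ span G (⋃ C) ∣)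

    term≡ : ∀ C → cycleTerm C ≡ terms′ C
    term≡ C = trans (*≡ _ _) (cong₂ _*′_
      (trans (*≡ _ _) (cong₂ _*′_ (p≡ (length C)) (ω≡ (⋃ C)))) (μ≡ _ _))

-- The expansion over the real numbers

open import Defs

-- The detour through _|>′_ makes Agda infer the type of its left argument before
-- it compares that type with the goal; otherwise it unifies up to unfolding of _≃_.
module _ {n m : ℕ} (G : Graph n m) (c : Fin m → ℝ) (X : Subset n) where

  private
    module Generic = SignedSum ℝ-commutativeRing G c X

  determinant≡ : Generic.determinant ≡ det (laplacian G c [ X ])
  determinant≡ = refl

  c*≡ : OrientationSums.c* ℝ-commutativeRing G c ≡ subdivisionWeights c
  c*≡ = refl

  base≡ : Generic.base ≡ -ᴿ (1ᴿ +ᴿ 1ᴿ)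
  base≡ = Generic.base-resp _+ᴿ_ -ᴿ_ 1ᴿ (λ _ _ → refl) (λ _ → refl) refl

  power≡ : ∀ p → Weighted._^_ ℝ-commutativeRing Generic.base p ≡ (-ᴿ (1ᴿ +ᴿ 1ᴿ)) ^ p
  power≡ p = Generic.power-resp _^_ (λ _ _ → refl) base≡ p |>′ λ eq → eq

  weight≡ : ∀ F → Weighted.weight ℝ-commutativeRing c F ≡ weight c F
  weight≡ F = refl

  matchingSum≡ : ∀ H j → Generic.matchingSum* H j ≡ matchingSum {G = subdivision G} (subdivisionWeights c) H j
  matchingSum≡ H j = Generic.matchingSum-resp (matchingSum {G = subdivision G}) (λ _ _ _ → refl) c*≡ H j |>′ λ eq → eq

  expansion : (d : ℝ) (p : ℕ → ℝ) (ω : Subset m → ℝ) (μ : Subgraph (subdivision G) → ℕ → ℝ) →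
    Generic.determinant ≡ d → (∀ k → Weighted._^_ ℝ-commutativeRing Generic.base k ≡ p k) →
    (∀ F → Weighted.weight ℝ-commutativeRing c F ≡ ω F) → (∀ H j → Generic.matchingSum* H j ≡ μ H j) →
    d ≃ μ (whole (subdivision G) ∖ original (∁ X)) ∣ X ∣ +ᴿ
      ∑ (filter (λ C → verts (union G C) ⊆? X) (cycleUnions G))
        (λ C → p (#components C) *ᴿ ω (edges (union G C)) *ᴿ
          μ (whole (subdivision G) ∖ᴳ subdivide (union G C) ∖ original (∁ X)) (∣ X ∣ ∸ ∣ verts (union G C) ∣))
  expansion d p ω μ d≡ p≡ ω≡ μ≡ = Generic.det-expansion _≃_ _+ᴿ_ _*ᴿ_ ∑ d p ω μ (λ x≈y → x≈y)
    (λ _ _ → refl) (λ _ _ → refl) (λ _ _ → refl) d≡ p≡ ω≡ μ≡ |>′ λ x → x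

theorem7p1 : ∀ {n m : ℕ} (G : Graph n m) → Connected G →
  (c : Fin m → ℝ) → (∀ e → 0ᴿ <ᴿ c e) →
  (X : Subset n) →
  let S       = whole (subdivision G)
      R       = original (∁ X)
      c*      = subdivisionWeights c
      V       = λ C → Subgraph.verts (union G C)
      E       = λ C → Subgraph.edges (union G C)
      SX      = S ∖ R
      SXC     = λ C → S ∖ᴳ subdivide (union G C) ∖ R
  in
  det (laplacian G c [ X ])
    ≃ matchingSum c* SX ∣ X ∣
      +ᴿ ∑ (filter (λ C → V C ⊆? X) (cycleUnions G))
           (λ C → (-ᴿ (1ᴿ +ᴿ 1ᴿ)) ^ #components C
                  *ᴿ weight c (E C)
                  *ᴿ matchingSum c* (SXC C) (∣ X ∣ ∸ ∣ V C ∣))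
theorem7p1 G _ c _ X =
  expansion G c X _ _ _ _ (determinant≡ G c X) (power≡ G c X) (weight≡ G c X) (matchingSum≡ G c X) |>′ λ x → x
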